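{- Let $(\mathcal N,\mathcal O,\mathfrak l)$ be a plabic network with perfect orientation $\mathcal O=\mathcal O(I)$ and gauge ray direction $\mathfrak l$. Let $\{B_j \mid j\in\bar I\}$ be $n-k$ linearly independent vectors assigned to the boundary sinks $b_j$, and let the vectors at the edges $e_j$ ending at $b_j$ be defined by $E_{e_j}=(-1)^{\mathrm{int}(e_j)}w_{e_j}B_j$, $j\in\bar I$. Consider the linear system formed by the equations at all internal vertices: - at each bivalent vertex with incoming edge $e$ and outgoing edge $f$: $E_e=(-1)^{\mathrm{int}(e)+\mathrm{wind}(e,f)}w_eE_f$; - at each trivalent black vertex with incoming edges $e_2,e_3$ and outgoing edge $e_1$: $E_{e_i}=(-1)^{\mathrm{int}(e_i)+\mathrm{wind}(e_i,e_1)}w_{e_i}E_{e_1}$, $i=2,3$; - at each trivalent white vertex with incoming edge $e_3$ and outgoing edges $e_1,e_2$: $E_{e_3}=(-1)^{\mathrm{int}(e_3)+\mathrm{wind}(e_3,e_1)}w_{e_3}E_{e_1}+(-1)^{\mathrm{int}(e_3)+\mathrm{wind}(e_3,e_2)}w_{e_3}E_{e_2}$, in the unknowns $E_e$, where $e$ ranges over the edges not ending at boundary sinks. Then the number of equations equals the number of unknowns and the system has full rank; therefore it is consistent and provides a unique system of edge vectors on $(\mathcal N,\mathcal O,\mathfrak l)$. Moreover, if variables and equations are properly ordered (the row of each equation having the same index as the edge on its left-hand side), the determinant of the matrix $M$ of this linear system is the sum of the weights of all conservative flows: $$\det M=\sum_{C\in\mathcal C(\mathcal G)}w(C).$$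
   Context: **Plabic networks.** Let $D$ be a closed convex disk whose boundary contains a straight segment. A plabic graph $\mathcal G$ is a finite directed planar graph embedded in $D$ with straight edges. It has boundary vertices $b_1,\dots,b_n$ on the segment, labelled clockwise, each of degree 1 (a source if its edge is outgoing, a sink otherwise). The remaining (internal) vertices lie inside $D$ and have degree 2 or 3. No component is isolated from the boundary. The graph is perfect: each internal vertex has exactly one incoming edge (then it is white) or exactly one outgoing edge (then it is black); a bivalent vertex has one incoming and one outgoing edge and is given either color. The orientation $\mathcal O$ is called a perfect orientation. $I=\{i_1<\dots<i_k\}$ is the set of indices of the boundary sources and $\bar I=[n]\setminus I$. A network $\mathcal N$ is $\mathcal G$ with a positive weight $w_e$ on each edge. **Gauge rays.** A gauge ray direction $\mathfrak l$ is an oriented direction, not parallel to any edge, such that the rays with direction $\mathfrak l$ starting at boundary vertices point inside $D$ and contain no internal vertices. The gauge rays are the rays $\mathfrak l_{i_r}$ starting at the boundary sources $b_{i_r}$. $\mathrm{int}(e)$ is the number of intersections of the edge $e$ with the gauge rays (the base point of a ray is not counted). **Winding.** For nonzero planar vectors, $s(a,b)=+1,0,-1$ if the ordered pair $(a,b)$ is positively oriented, parallel, negatively oriented respectively. For consecutive directed edges $e,f$: $\mathrm{wind}(e,f)=1$ if $s(e,f)=s(e,\mathfrak l)=s(\mathfrak l,f)=1$; $\mathrm{wind}(e,f)=-1$ if $s(e,f)=s(e,\mathfrak l)=s(\mathfrak l,f)=-1$; otherwise $0$. **Matrix $M$.** All terms with unknowns are moved to the left-hand side, so that the equation whose left-hand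 side is $E_e$ has coefficient $1$ at $E_e$; the terms with the given vectors at the boundary sinks form the inhomogeneous part. **Conservative flows.** A conservative flow $C$ is a collection of distinct edges, none incident to the boundary, such that at each internal vertex the number of edges of $C$ arriving equals the number of edges of $C$ leaving. $\mathcal C(\mathcal G)$ is the set of conservative flows, including the empty (trivial) one. $w(C)$ is the product of the weights of the edges of $C$, with weight $1$ for the trivial flow. -}

module Defs where

open import Algebra.Bundles using (CommutativeRing; Semiring)
open import Algebra.Module.Bundles using (Module)
import Algebra.Properties.Ring as RingProperties
import Algebra.Definitions.RawMonoid as RawMonoidDefs
import Algebra.Definitions.RawSemiring as RawSemiringDefs
open import Data.Bool.Base using (if_then_else_)
open import Data.Fin.Base as Fin using (Fin; zero; suc; toℕ; punchIn)
import Data.Fin.Properties as Fin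
open import Data.Fin.Subset using (Subset; inside; outside; _∈_)
open import Data.Fin.Subset.Properties using (_∈?_)
open import Data.Integer.Base as ℤ using (ℤ; +_; -[1+_]; 0ℤ; 1ℤ; -1ℤ; ∣_∣)
open import Data.List.Base as List
  using (List; []; _∷_; _++_; length; filter; allFin; concatMap; lookup; tabulate)
open import Data.List.Relation.Binary.Permutation.Propositional using (_↭_)
open import Data.List.Relation.Unary.All using (All)
open import Data.Nat.Base as ℕ using (ℕ; zero; suc)
import Data.Nat.Properties as ℕ
open import Data.Product.Base using (Σ; ∃; ∃₂; _×_; _,_; proj₁; proj₂)
open import Data.Sum.Base using (_⊎_; inj₁; inj₂)
import Data.Sum.Properties as Sum
open import Data.Vec.Base as Vec using ([]; _∷_)
open import Function.Definitions using (Injective)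
open import Level using (Level; _⊔_; 0ℓ) renaming (suc to lsuc)
open import Relation.Binary.Core using (Rel)
open import Relation.Binary.Construct.Closure.Equivalence using (EqClosure)
import Relation.Binary.Construct.StrictToNonStrict as NonStrict
open import Relation.Binary.Definitions using (DecidableEquality; tri<; tri≈; tri>)
open import Relation.Binary.PropositionalEquality.Core using (_≡_; _≢_)
import Relation.Binary.Reasoning.Setoid as SetoidReasoning
open import Relation.Binary.Structures using (IsStrictTotalOrder)
open import Relation.Nullary.Decidable.Core
  using (Dec; yes; no; ¬?; _×-dec_; _⊎-dec_; _→-dec_; does)
open import Relation.Nullary.Negation.Core using (¬_)
open import Relation.Unary using (Pred; Decidable)

-- The intended model is the field of real numbers; no completeness is assumed.

record OrderedField (c ℓ₁ ℓ₂ : Level) : Set (lsuc (c ⊔ ℓ₁ ⊔ ℓ₂)) where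
  infix 4 _<_
  field
    commutativeRing : CommutativeRing c ℓ₁
  open CommutativeRing commutativeRing public hiding (zero)
  field
    _<_                : Rel Carrier ℓ₂
    isStrictTotalOrder : IsStrictTotalOrder _≈_ _<_
    +-monoʳ-<          : ∀ z {x y} → x < y → z + x < z + y
    *-pos              : ∀ {x y} → 0# < x → 0# < y → 0# < x * y
    0<1                : 0# < 1#
    inverse            : ∀ x → ¬ x ≈ 0# → ∃ λ y → x * y ≈ 1#

  open IsStrictTotalOrder isStrictTotalOrder public
    using (compare; _≟_; _<?_; <-resp-≈)
  open NonStrict _≈_ _<_ public using (_≤_)

  _≤?_ : ∀ x y → Dec (x ≤ y)
  _≤?_ = NonStrict.decidable′ _≈_ _<_ compare

  open RawMonoidDefs +-rawMonoid public using (sum)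
  open RawSemiringDefs (Semiring.rawSemiring semiring) public
    using (product; _^_)

  ∑ : List Carrier → Carrier
  ∑ = List.foldr _+_ 0#

  -- Only the parity of z matters, so this is the integer power of -1.
  [-1]^ : ℤ → Carrier
  [-1]^ z = (- 1#) ^ ∣ z ∣

module _ {c ℓ₁ ℓ₂} (K : OrderedField c ℓ₁ ℓ₂) where
  open OrderedField K

  Matrix : ℕ → ℕ → Set c
  Matrix p q = Fin p → Fin q → Carrier

  -- Expansion along the first row.
  det : ∀ {n} → Matrix n n → Carrier
  det {zero}  A = 1#
  det {suc n} A =
    sum λ j → (- 1#) ^ toℕ j * (A zero j * det (λ i k → A (suc i) (punchIn j k)))

  RowsIndependent : ∀ {p q} → Matrix p q → Set (c ⊔ ℓ₁)
  RowsIndependent {p} A =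
    ∀ (x : Fin p → Carrier) → (∀ j → sum (λ i → x i * A i j) ≈ 0#) → ∀ i → x i ≈ 0#

  -- Full rank of a square matrix: row rank and column rank both equal the size.
  FullRank : ∀ {n} → Matrix n n → Set (c ⊔ ℓ₁)
  FullRank A = RowsIndependent A × RowsIndependent (λ i j → A j i)

  VectorSpace : (v ℓ : Level) → Set (c ⊔ ℓ₁ ⊔ lsuc (v ⊔ ℓ))
  VectorSpace = Module commutativeRing

module _ {c ℓ₁ ℓ₂} (K : OrderedField c ℓ₁ ℓ₂) {v ℓ} (W : VectorSpace K v ℓ) where
  open OrderedField K
  open Module W using (Carrierᴹ; _≈ᴹ_; _*ₗ_; 0ᴹ; +ᴹ-rawMonoid)
  open RawMonoidDefs +ᴹ-rawMonoid using () renaming (sum to sumᴹ)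

  LinearlyIndependent : ∀ {p} → (Fin p → Carrierᴹ) → Set (c ⊔ ℓ₁ ⊔ ℓ)
  LinearlyIndependent {p} B =
    ∀ (x : Fin p → Carrier) → sumᴹ (λ i → x i *ₗ B i) ≈ᴹ 0ᴹ → ∀ i → x i ≈ 0#

module Plane {c ℓ₁ ℓ₂} (K : OrderedField c ℓ₁ ℓ₂) where
  open OrderedField K
  open RingProperties ring using (-‿+-comm; -‿involutive; -0#≈0#; x[y-z]≈xy-xz)

  Point : Set c
  Point = Carrier × Carrier

  infix  4 _≈ₚ_
  infixl 6 _+ₚ_ _-ₚ_
  infixl 7 _*ₚ_

  _≈ₚ_ : Rel Point ℓ₁
  (x , y) ≈ₚ (x′ , y′) = x ≈ x′ × y ≈ y′

  0ₚ : Point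
  0ₚ = 0# , 0#

  _+ₚ_ _-ₚ_ : Point → Point → Point
  (x , y) +ₚ (x′ , y′) = (x + x′) , (y + y′)
  (x , y) -ₚ (x′ , y′) = (x - x′) , (y - y′)

  _*ₚ_ : Carrier → Point → Point
  t *ₚ (x , y) = (t * x) , (t * y)

  cross : Point → Point → Carrier
  cross (x , y) (x′ , y′) = x * y′ - y * x′

  orientation : Point → Point → ℤ
  orientation a b with compare 0# (cross a b)
  ... | tri< _ _ _ = 1ℤ
  ... | tri≈ _ _ _ = 0ℤ
  ... | tri> _ _ _ = -1ℤ

  onSegment : Point → Point → Carrier → Point
  onSegment p q t = p +ₚ t *ₚ (q -ₚ p)

  InUnit : Carrier → Set (ℓ₁ ⊔ ℓ₂)
  InUnit t = 0# ≤ t × t ≤ 1#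

  -- The parameters of the intersection point of two non-parallel lines are
  -- given by Cramer's rule, so crossing? only has to test one candidate.
  private
    shift : ∀ {a p x y} → a + x ≈ p + y → x ≈ (p - a) + y
    shift {a} {p} {x} {y} eq = begin
      x              ≈⟨ +-identityˡ x ⟨
      0# + x         ≈⟨ +-congʳ (-‿inverseˡ a) ⟨
      - a + a + x    ≈⟨ +-assoc (- a) a x ⟩
      - a + (a + x)  ≈⟨ +-congˡ eq ⟩
      - a + (p + y)  ≈⟨ +-assoc (- a) p y ⟨
      - a + p + y    ≈⟨ +-congʳ (+-comm (- a) p) ⟩
      p - a + y      ∎
      where open SetoidReasoning setoid

    cancel : ∀ x y z → (x + z) - (y + z) ≈ x - y
    cancel x y z = begin
      (x + z) - (y + z)      ≈⟨ +-congˡ (-‿+-comm y z) ⟨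
      (x + z) + (- y - z)    ≈⟨ +-congˡ (+-comm (- y) (- z)) ⟩
      (x + z) + (- z - y)    ≈⟨ +-assoc (x + z) (- z) (- y) ⟨
      (x + z) - z - y        ≈⟨ +-congʳ (+-assoc x z (- z)) ⟩
      x + (z - z) - y        ≈⟨ +-congʳ (+-congˡ (-‿inverseʳ z)) ⟩
      x + 0# - y             ≈⟨ +-congʳ (+-identityʳ x) ⟩
      x - y                  ∎
      where open SetoidReasoning setoid

    cramer : ∀ (a p u d : Point) t s → a +ₚ t *ₚ u ≈ₚ p +ₚ s *ₚ d →
             t * cross u d ≈ cross (p -ₚ a) d
    cramer (a₁ , a₂) (p₁ , p₂) (u₁ , u₂) (d₁ , d₂) t s (eq₁ , eq₂) = begin
      t * (u₁ * d₂ - u₂ * d₁)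
        ≈⟨ x[y-z]≈xy-xz t (u₁ * d₂) (u₂ * d₁) ⟩
      t * (u₁ * d₂) - t * (u₂ * d₁)
        ≈⟨ +-cong (*-assoc t u₁ d₂) (-‿cong (*-assoc t u₂ d₁)) ⟨
      t * u₁ * d₂ - t * u₂ * d₁
        ≈⟨ +-cong (*-congʳ (shift eq₁)) (-‿cong (*-congʳ (shift eq₂))) ⟩
      (p₁ - a₁ + s * d₁) * d₂ - (p₂ - a₂ + s * d₂) * d₁
        ≈⟨ +-cong (distribʳ d₂ (p₁ - a₁) (s * d₁))
                  (-‿cong (distribʳ d₁ (p₂ - a₂) (s * d₂))) ⟩
      ((p₁ - a₁) * d₂ + s * d₁ * d₂) - ((p₂ - a₂) * d₁ + s * d₂ * d₁)
        ≈⟨ +-congˡ (-‿cong (+-congˡ swap)) ⟩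
      ((p₁ - a₁) * d₂ + s * d₁ * d₂) - ((p₂ - a₂) * d₁ + s * d₁ * d₂)
        ≈⟨ cancel _ _ _ ⟩
      (p₁ - a₁) * d₂ - (p₂ - a₂) * d₁ ∎
      where
      open SetoidReasoning setoid
      swap : s * d₂ * d₁ ≈ s * d₁ * d₂
      swap = trans (*-assoc s d₂ d₁)
               (trans (*-congˡ (*-comm d₂ d₁)) (sym (*-assoc s d₁ d₂)))

    divide : ∀ {t x y k} → x * k ≈ 1# → t * x ≈ y → t ≈ y * k
    divide {t} {x} {y} {k} inv eq = begin
      t            ≈⟨ *-identityʳ t ⟨
      t * 1#       ≈⟨ *-congˡ inv ⟨
      t * (x * k)  ≈⟨ *-assoc t x k ⟨
      t * x * k    ≈⟨ *-congʳ eq ⟩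
      y * k        ∎
      where open SetoidReasoning setoid

    cross-swap : ∀ u d → cross d u ≈ 0# → cross u d ≈ 0#
    cross-swap (u₁ , u₂) (d₁ , d₂) eq = begin
      u₁ * d₂ - u₂ * d₁      ≈⟨ +-cong (*-comm u₁ d₂) (-‿cong (*-comm u₂ d₁)) ⟩
      d₂ * u₁ - d₁ * u₂      ≈⟨ +-congʳ (-‿involutive (d₂ * u₁)) ⟨
      - - (d₂ * u₁) - d₁ * u₂   ≈⟨ +-comm _ _ ⟩
      - (d₁ * u₂) - - (d₂ * u₁) ≈⟨ -‿+-comm (d₁ * u₂) (- (d₂ * u₁)) ⟩
      - (d₁ * u₂ - d₂ * u₁)  ≈⟨ -‿cong eq ⟩
      - 0#                   ≈⟨ -0#≈0# ⟩
      0#                     ∎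
      where open SetoidReasoning setoid

  crossing? : ∀ a p u d → ¬ cross u d ≈ 0# →
              Dec (∃₂ λ t s → 0# < t × InUnit s × a +ₚ t *ₚ u ≈ₚ p +ₚ s *ₚ d)
  crossing? a p u d u∦d = decide
    where
    inv-t = inverse (cross u d) u∦d
    inv-s = inverse (cross d u) (λ eq → u∦d (cross-swap u d eq))
    t₀ = cross (p -ₚ a) d * proj₁ inv-t
    s₀ = cross (a -ₚ p) u * proj₁ inv-s

    ≤-resp : ∀ {x x′ y y′} → x ≈ x′ → y ≈ y′ → x ≤ y → x′ ≤ y′
    ≤-resp x≈ y≈ (inj₁ x<y) = inj₁ (proj₁ <-resp-≈ y≈ (proj₂ <-resp-≈ x≈ x<y))
    ≤-resp x≈ y≈ (inj₂ x≈y) = inj₂ (trans (sym x≈) (trans x≈y y≈))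

    P₀? : Dec (0# < t₀ × (0# ≤ s₀ × s₀ ≤ 1#) × a +ₚ t₀ *ₚ u ≈ₚ p +ₚ s₀ *ₚ d)
    P₀? = (0# <? t₀) ×-dec ((0# ≤? s₀) ×-dec (s₀ ≤? 1#)) ×-dec
          ((_ ≟ _) ×-dec (_ ≟ _))

    decide : Dec (∃₂ λ t s → 0# < t × InUnit s × a +ₚ t *ₚ u ≈ₚ p +ₚ s *ₚ d)
    decide with P₀?
    ... | yes q = yes (t₀ , s₀ , q)
    ... | no ¬q = no λ (t , s , 0<t , (0≤s , s≤1) , eq₁ , eq₂) →
      let t≈t₀ = divide (proj₂ inv-t) (cramer a p u d t s (eq₁ , eq₂))
          s≈s₀ = divide (proj₂ inv-s) (cramer p a d u s t (sym eq₁ , sym eq₂))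
          move : ∀ {x y z w} → x + t * y ≈ z + s * w → x + t₀ * y ≈ z + s₀ * w
          move eq = trans (+-congˡ (*-congʳ (sym t≈t₀)))
                      (trans eq (+-congˡ (*-congʳ s≈s₀)))
      in ¬q ( proj₁ <-resp-≈ t≈t₀ 0<t
            , (≤-resp refl s≈s₀ 0≤s , ≤-resp s≈s₀ refl s≤1)
            , (move eq₁ , move eq₂))

  -- The open square with centre p and side 2ε; these squares generate the
  -- usual topology of the plane.
  Box : Point → Carrier → Pred Point ℓ₂
  Box (x , y) ε (x′ , y′) =
    (x - ε < x′ × x′ < x + ε) × (y - ε < y′ × y′ < y + ε)

  module _ {d} (D : Pred Point d) where
    Interior : Pred Point (c ⊔ ℓ₂ ⊔ d)
    Interior p = ∃ λ ε → 0# < ε × (∀ q → Box p ε q → D q)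

    Closed : Set (c ⊔ ℓ₂ ⊔ d)
    Closed = ∀ p → (∀ ε → 0# < ε → ∃ λ q → Box p ε q × D q) → D p

    Bounded : Set (c ⊔ ℓ₂ ⊔ d)
    Bounded = ∃ λ r → ∀ p → D p → Box 0ₚ r p

    Convex : Set (c ⊔ ℓ₁ ⊔ ℓ₂ ⊔ d)
    Convex = ∀ p q t → D p → D q → InUnit t → D (onSegment p q t)

  -- Over the reals, the compact convex sets with nonempty interior are
  -- exactly the closed convex sets homeomorphic to a disk.
  record ConvexDisk (d : Level) : Set (c ⊔ ℓ₁ ⊔ ℓ₂ ⊔ lsuc d) where
    field
      D         : Pred Point d
      resp      : ∀ {p q} → p ≈ₚ q → D p → D q
      closed    : Closed D
      bounded   : Bounded D
      convex    : Convex D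
      interior  : ∃ (Interior D)
      P Q       : Point
      P≉Q       : ¬ P ≈ₚ Q
      PQ⊆D      : ∀ t → InUnit t → D (onSegment P Q t)
      PQ⊆∂D     : ∀ t → InUnit t → ¬ Interior D (onSegment P Q t)

data Colour : Set where
  white black : Colour

-- A vertex is an element of Fin #b ⊎ Fin #i.
pattern boundary i = inj₁ i
pattern internal v = inj₂ v

module _ {c ℓ₁ ℓ₂} (K : OrderedField c ℓ₁ ℓ₂) where
  open OrderedField K
  open Plane K

  record PlabicGraph (d : Level) : Set (c ⊔ ℓ₁ ⊔ ℓ₂ ⊔ lsuc d) where
    field
      disk     : ConvexDisk d
      #b #i #e : ℕ

    open ConvexDisk disk public

    Edge : Set
    Edge = Fin #e

    Vertex : Set
    Vertex = Fin #b ⊎ Fin #i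

    field
      src tgt : Edge → Vertex
      pos     : Vertex → Point
      colour  : Fin #i → Colour

    _≟ᵥ_ : DecidableEquality Vertex
    _≟ᵥ_ = Sum.≡-dec Fin._≟_ Fin._≟_

    inEdges : Vertex → List Edge
    inEdges v = filter (λ e → tgt e ≟ᵥ v) (allFin #e)

    outEdges : Vertex → List Edge
    outEdges v = filter (λ e → src e ≟ᵥ v) (allFin #e)

    degree : Vertex → ℕ
    degree v = length (inEdges v) ℕ.+ length (outEdges v)

    Incident : Vertex → Edge → Set
    Incident v e = src e ≡ v ⊎ tgt e ≡ v

    direction : Edge → Point
    direction e = pos (tgt e) -ₚ pos (src e)

    pointOn : Edge → Carrier → Point
    pointOn e = onSegment (pos (src e)) (pos (tgt e))

    field
      no-loops      : ∀ e → src e ≢ tgt e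
      pos-injective : Injective _≡_ _≈ₚ_ pos
      planar        : ∀ {e f} → e ≢ f → ∀ s t → InUnit s → InUnit t →
                      pointOn e s ≈ₚ pointOn f t →
                      ∃ λ v → Incident v e × Incident v f × pointOn e s ≈ₚ pos v

      on-segment    : ∀ i → ∃ λ t → InUnit t × pos (boundary i) ≈ₚ onSegment P Q t
      -- Walking along the boundary of D clockwise keeps D on the right.
      clockwise     : ∀ {i j} → i Fin.< j → ∀ x → Interior D x →
                      cross (pos (boundary j) -ₚ pos (boundary i))
                            (x -ₚ pos (boundary i)) < 0#
      inside-D      : ∀ v → Interior D (pos (internal v))

      boundary-degree : ∀ i → degree (boundary i) ≡ 1
      internal-degree : ∀ v → degree (internal v) ≡ 2 ⊎ degree (internal v) ≡ 3
      white-perfect   : ∀ v → colour v ≡ white → length (inEdges  (internal v)) ≡ 1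
      black-perfect   : ∀ v → colour v ≡ black → length (outEdges (internal v)) ≡ 1

      not-isolated    : ∀ v → ∃ λ i →
                        EqClosure (λ x y → ∃ λ e → src e ≡ x × tgt e ≡ y) v (boundary i)

    Source Sink : Pred (Fin #b) 0ℓ
    Source i = ∃ λ e → src e ≡ boundary i
    Sink   i = ¬ Source i

    source? : Decidable Source
    source? i = Fin.any? λ e → src e ≟ᵥ boundary i

    sink? : Decidable Sink
    sink? i = ¬? (source? i)

    sources sinks : List (Fin #b)
    sources = filter source? (allFin #b)
    sinks   = filter sink? (allFin #b)

    EndsAtSink : Pred Edge 0ℓ
    EndsAtSink e = ∃ λ j → Sink j × tgt e ≡ boundary j

    endsAtSink? : Decidable EndsAtSink
    endsAtSink? e = Fin.any? λ j → sink? j ×-dec tgt e ≟ᵥ boundary j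

    unknowns : List Edge
    unknowns = filter (λ e → ¬? (endsAtSink? e)) (allFin #e)

  record PlabicNetwork (d : Level) : Set (c ⊔ ℓ₁ ⊔ ℓ₂ ⊔ lsuc d) where
    field
      graph : PlabicGraph d
    open PlabicGraph graph public
    field
      weight     : Edge → Carrier
      weight-pos : ∀ e → 0# < weight e

module _ {c ℓ₁ ℓ₂ d} {K : OrderedField c ℓ₁ ℓ₂} (G : PlabicGraph K d) where
  open OrderedField K
  open Plane K
  open PlabicGraph G

  record GaugeDirection : Set (c ⊔ ℓ₁ ⊔ ℓ₂ ⊔ d) where
    field
      𝔩            : Point
      nonzero      : ¬ 𝔩 ≈ₚ 0ₚ
      not-parallel : ∀ e → ¬ cross 𝔩 (direction e) ≈ 0#

    ray : Fin #b → Carrier → Point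
    ray i t = pos (boundary i) +ₚ t *ₚ 𝔩

    field
      points-inside : ∀ i → ∃ λ t → 0# < t × Interior D (ray i t)
      avoids        : ∀ i v t → 0# ≤ t → ¬ ray i t ≈ₚ pos (internal v)

    -- t > 0 discards the base point of the ray.
    Meets : Fin #b → Edge → Set (c ⊔ ℓ₁ ⊔ ℓ₂)
    Meets i e = ∃₂ λ t s → 0# < t × InUnit s × ray i t ≈ₚ pointOn e s

    meets? : ∀ i e → Dec (Meets i e)
    meets? i e =
      crossing? (pos (boundary i)) (pos (src e)) 𝔩 (direction e) (not-parallel e)

    -- 𝔩 is not parallel to e, so every ray meets e at most once; distinct
    -- rays are disjoint.  Hence points of intersection can be counted by rays.
    int : Edge → ℕ
    int e = length (filter (λ i → meets? i e) sources)

    wind : Edge → Edge → ℤ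
    wind e f = combine (orientation (direction e) (direction f))
                       (orientation (direction e) 𝔩)
                       (orientation 𝔩 (direction f))
      where
      combine : ℤ → ℤ → ℤ → ℤ
      combine (+ 1)    (+ 1)    (+ 1)    = 1ℤ
      combine -[1+ 0 ] -[1+ 0 ] -[1+ 0 ] = -1ℤ
      combine _        _        _        = 0ℤ

module _ {c ℓ₁ ℓ₂ d} {K : OrderedField c ℓ₁ ℓ₂}
         (N : PlabicNetwork K d) (𝔤 : GaugeDirection (PlabicNetwork.graph N)) where
  open OrderedField K
  open PlabicNetwork N
  open GaugeDirection 𝔤

  -- The equation  E_lhs = Σ a E_f,  summed over the pairs (a , f) in rhs.
  record Equation : Set c where
    constructor _:=_
    field
      lhs : Edge
      rhs : List (Carrier × Edge)
  open Equation public

  coefficient : Edge → Edge → Carrier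
  coefficient e f = [-1]^ (+ int e ℤ.+ wind e f) * weight e

  -- The arguments are the incoming and the outgoing edges of an internal
  -- vertex, which is then bivalent, trivalent black or trivalent white
  -- respectively; perfectness rules out all other shapes.
  vertexEquations : List Edge → List Edge → List Equation
  vertexEquations (e ∷ []) (f ∷ []) =
    (e := ((coefficient e f , f) ∷ [])) ∷ []
  vertexEquations (e₂ ∷ e₃ ∷ []) (e₁ ∷ []) =
    (e₂ := ((coefficient e₂ e₁ , e₁) ∷ [])) ∷
    (e₃ := ((coefficient e₃ e₁ , e₁) ∷ [])) ∷ []
  vertexEquations (e₃ ∷ []) (e₁ ∷ e₂ ∷ []) =
    (e₃ := ((coefficient e₃ e₁ , e₁) ∷ (coefficient e₃ e₂ , e₂) ∷ [])) ∷ []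
  vertexEquations _ _ = []

  system : List Equation
  system = concatMap
    (λ v → vertexEquations (inEdges (internal v)) (outEdges (internal v))) (allFin #i)

  -- Coefficient of E_f once every unknown is on the left-hand side.
  leftCoefficient : Equation → Edge → Carrier
  leftCoefficient (e := ts) f = δ e - ∑ (List.map (λ (a , g) → a * δ g) ts)
    where
    δ : Edge → Carrier
    δ g = if does (g Fin.≟ f) then 1# else 0#

  record ProperOrdering : Set c where
    field
      size       : ℕ
      equation   : Fin size → Equation
      unknown    : Fin size → Edge
      equations↭ : tabulate equation ↭ system
      unknowns↭  : tabulate unknown ↭ unknowns
      aligned    : ∀ i → lhs (equation i) ≡ unknown i

    M : Matrix K size size
    M i j = leftCoefficient (equation i) (unknown j)

  module _ {v ℓ} (W : VectorSpace K v ℓ)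
           (B : Fin (length sinks) → Module.Carrierᴹ W) where
    open Module W using (Carrierᴹ; _≈ᴹ_; _+ᴹ_; _*ₗ_; 0ᴹ)

    Holds : (Edge → Carrierᴹ) → Equation → Set ℓ
    Holds E (e := ts) = E e ≈ᴹ List.foldr (λ (a , f) y → a *ₗ E f +ᴹ y) 0ᴹ ts

    IsEdgeVectorSystem : (Edge → Carrierᴹ) → Set (c ⊔ ℓ)
    IsEdgeVectorSystem E =
      (∀ j e → tgt e ≡ boundary (lookup sinks j) →
         E e ≈ᴹ ([-1]^ (+ int e) * weight e) *ₗ B j) ×
      All (Holds E) system

allSubsets : ∀ n → List (Subset n)
allSubsets zero    = [] ∷ []
allSubsets (suc n) =
  List.map (outside ∷_) (allSubsets n) ++ List.map (inside ∷_) (allSubsets n)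

module _ {c ℓ₁ ℓ₂ d} {K : OrderedField c ℓ₁ ℓ₂} (N : PlabicNetwork K d) where
  open OrderedField K
  open PlabicNetwork N

  ConservativeFlow : Pred (Subset #e) 0ℓ
  ConservativeFlow C =
    (∀ e → e ∈ C → ∀ i → ¬ Incident (boundary i) e) ×
    (∀ v → length (filter (_∈? C) (inEdges  (internal v)))
         ≡ length (filter (_∈? C) (outEdges (internal v))))

  conservativeFlow? : Decidable ConservativeFlow
  conservativeFlow? C =
    (Fin.all? λ e → (e ∈? C) →-dec
       Fin.all? λ i → ¬? ((src e ≟ᵥ boundary i) ⊎-dec (tgt e ≟ᵥ boundary i))) ×-dec
    (Fin.all? λ v → length (filter (_∈? C) (inEdges  (internal v)))
              ℕ.≟ length (filter (_∈? C) (outEdges (internal v))))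

  conservativeFlows : List (Subset #e)
  conservativeFlows = filter conservativeFlow? (allSubsets #e)

  flowWeight : Subset #e → Carrier
  flowWeight C = product λ e → if does (e ∈? C) then weight e else 1#

{-# OPTIONS --safe #-}
module Submission where

-- Write M = 1 - A, where A is supported on pairs of consecutive edges.  The edges
-- moved by a permutation with nonzero term in the Leibniz formula for det M form
-- a conservative flow, and as every internal vertex has a single incoming or a
-- single outgoing edge, each flow arises from exactly one permutation.  Its term
-- is the weight of the flow, up to the parity of
--   (sign of the permutation) + (number of moved edges) + Σ int + Σ wind.
-- The line through a gauge ray is crossed an even number of times by the flow,
-- and only on the ray itself: a point of the line behind the base point b cannot
-- be interior to the convex set D, as b would then be interior, too.  So Σ int is
-- even.  The rest is even by Hopf's Umlaufsatz, in a form that needs no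
-- decomposition of the flow into cycles: the sign of the permutation counts the
-- pairs of edges whose order it reverses, where the order of two edges is the
-- side of 𝔩 to which the secant between their sources points, and moving all
-- secants one step along the flow compares these reversals with Σ wind.
-- As the trivial flow has weight 1 and all weights are positive, det M > 0, and
-- the system has a unique solution.

open import Algebra.Bundles using (CommutativeMonoid; CommutativeRing)
open import Algebra.Bundles.Raw using (RawRing)
open import Algebra.Module.Bundles using (Module)
import Algebra.Properties.CommutativeMonoid.Sum as MonoidSum
import Algebra.Properties.CommutativeSemigroup as CommutativeSemigroupProperties
import Algebra.Properties.Group as GroupProperties
import Algebra.Properties.Ring as RingProperties
import Algebra.Properties.Semiring.Mult as SemiringMult
import Algebra.Properties.Semiring.Sum as SemiringSum
import Algebra.Solver.Ring as RingSolver
import Algebra.Solver.Ring.AlmostCommutativeRing as ACR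
open import Data.Bool.Base using (Bool; true; false; not; _∧_; _xor_; if_then_else_)
import Data.Bool.Properties as Bool
open import Data.Bool.Solver using (module xor-∧-Solver)
open import Data.Fin.Base using (Fin; zero; suc; toℕ; punchIn; punchOut)
import Data.Fin.Permutation.Components as Fin
import Data.Fin.Properties as Fin
open import Data.Fin.Subset as Subset using (Subset; inside; outside) renaming (_∈_ to _∈ₛ_)
import Data.Fin.Subset.Properties as Subset
open import Data.Integer.Base as ℤ using (ℤ; +_; -[1+_]; 0ℤ; 1ℤ; -1ℤ; ∣_∣; _⊖_)
import Data.Integer.Properties as ℤ
open import Data.List.Base
  using (List; []; _∷_; _++_; allFin; cartesianProduct; concatMap; filter; foldr; length; lookup; map; tabulate)
open import Data.List.Membership.Propositional using (_∈_)
import Data.List.Membership.Propositional.Properties as ∈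
open import Data.List.Membership.Propositional.Properties.WithK using (unique∧set⇒bag)
import Data.List.Properties as List
open import Data.List.Relation.Binary.BagAndSetEquality using (∼bag⇒↭)
open import Data.List.Relation.Binary.Disjoint.Propositional using (Disjoint)
open import Data.List.Relation.Binary.Permutation.Propositional as ↭ using (_↭_)
import Data.List.Relation.Binary.Permutation.Propositional.Properties as ↭
import Data.List.Relation.Binary.Permutation.Setoid.Properties as Permutationₛ
open import Data.List.Relation.Unary.All as All using (All; []; _∷_)
import Data.List.Relation.Unary.All.Properties as All
import Data.List.Relation.Unary.AllPairs as AllPairs
import Data.List.Relation.Unary.AllPairs.Properties as AllPairs
open import Data.List.Relation.Unary.Any as Any using (here; there)
import Data.List.Relation.Unary.Any.Properties as Any
open import Data.List.Relation.Unary.Unique.Propositional using (Unique)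
import Data.List.Relation.Unary.Unique.Propositional.Properties as Unique
open import Data.Maybe.Base using (Maybe; just; nothing)
open import Data.Nat.Base as ℕ using (ℕ; zero; suc)
import Data.Nat.Properties as ℕ
open import Data.Product.Base using (∃; ∃₂; _×_; _,_; proj₁; proj₂)
open import Data.Sum.Base using (_⊎_; inj₁; inj₂)
open import Data.Unit.Base using (⊤; tt)
import Data.Vec.Base as Vec
import Data.Vec.Properties as Vec
open import Function.Base using (_∘_; id)
open import Function.Bundles using (mk⇔)
open import Function.Definitions using (Injective)
open import Level using (Level; 0ℓ; _⊔_)
open import Relation.Binary.Definitions using (tri<; tri≈; tri>)
open import Relation.Binary.PropositionalEquality
  using (_≡_; _≢_; _≗_; cong; cong₂; subst; subst₂; module ≡-Reasoning)
import Relation.Binary.PropositionalEquality as ≡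
import Relation.Binary.Reasoning.Setoid as SetoidReasoning
open import Relation.Binary.Structures using (IsStrictTotalOrder)
open import Relation.Nullary using (¬_; Dec; yes; no; contradiction; does)
open import Relation.Nullary.Decidable
  using (_×-dec_; _⊎-dec_; ¬?; dec-false; dec-true; decidable-stable; does-⇔)
open import Relation.Unary using (Pred; Decidable)
open import Defs

-- Hopf's argument moves secants continuously and follows their angle. An arbitrary ordered field
-- offers neither angle nor continuity, so the angle is replaced by a bit: whether the short
-- rotation from one vector to the next passes `𝔩`. These bits add up along three vectors as soon as
-- 0 is not in their convex hull. For the secants met when first the end and then the start moves
-- along its edge, a point of this hull is the difference of a point of one edge and a point of the
-- other, so planarity is what keeps 0 out of it. The only exception is a pair where the moving end
-- would arrive at the start of the secant. These pairs are split off, and they are the ones that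
-- yield the turns between consecutive edges, hence the winding numbers. Counting over all pairs of
-- edges treats secants within a cycle and between cycles alike, so nested cycles need no case of
-- their own. Signs are kept as Booleans with `_xor_` as addition.

private module 𝔽₂ = CommutativeRing Bool.xor-∧-commutativeRing
open SemiringSum 𝔽₂.semiring using ()
  renaming (sum to ⨁; ∑-comm to ⨁-comm; ∑-distrib-+ to ⨁-distrib-xor; *-distribˡ-sum to ∧-distribˡ-⨁;
            sum-cong-≗ to ⨁-cong; sum-replicate-zero to ⨁-replicate-false)
open xor-∧-Solver using ()
  renaming (solve to solveᵇ; _:=_ to _⊜ᵇ_; _:+_ to _⊕_; _:*_ to _⊗_; con to bit)

-- Permutations, their signs, and parities of sums

Code : ℕ → Set
Code zero    = ⊤
Code (suc n) = Fin (suc n) × Code n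

-- The permutation with a given Lehmer code, which also records the path
-- through the Laplace expansion.
⟦_⟧ : ∀ {n} → Code n → Fin n → Fin n
⟦_⟧ {suc n} (j , c) zero    = j
⟦_⟧ {suc n} (j , c) (suc i) = punchIn j (⟦ c ⟧ i)

⟦⟧-injective : ∀ {n} (c : Code n) → Injective _≡_ _≡_ ⟦ c ⟧
⟦⟧-injective {suc n} (j , c) {zero}  {zero}  eq = ≡.refl
⟦⟧-injective {suc n} (j , c) {zero}  {suc y} eq = contradiction (≡.sym eq) (Fin.punchInᵢ≢i j _)
⟦⟧-injective {suc n} (j , c) {suc x} {zero}  eq = contradiction eq (Fin.punchInᵢ≢i j _)
⟦⟧-injective {suc n} (j , c) {suc x} {suc y} eq =
  cong suc (⟦⟧-injective c (Fin.punchIn-injective j _ _ eq))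

⟦⟧-surjective : ∀ {n} (c : Code n) (i : Fin n) → ∃ λ k → ⟦ c ⟧ k ≡ i
⟦⟧-surjective {suc n} (j , c) i with j Fin.≟ i
... | yes j≡i = zero , j≡i
... | no  j≢i with k , eq ← ⟦⟧-surjective c (punchOut j≢i) =
  suc k , ≡.trans (cong (punchIn j) eq) (Fin.punchIn-punchOut j≢i)

-- Permutations given as functions agree only pointwise, whereas codes can be compared by `_≡_`; the
-- duplicate-free lists of permutations below rely on this.
⟦⟧-faithful : ∀ {n} (c c′ : Code n) → ⟦ c ⟧ ≗ ⟦ c′ ⟧ → c ≡ c′
⟦⟧-faithful {zero}  _       _        _  = ≡.refl
⟦⟧-faithful {suc n} (j , c) (j′ , c′) eq with ≡.refl ← eq zero =
  cong (j ,_) (⟦⟧-faithful c c′ λ i → Fin.punchIn-injective j _ _ (eq (suc i)))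

encode : ∀ {n} (f : Fin n → Fin n) → Injective _≡_ _≡_ f → ∃ λ c → ⟦ c ⟧ ≗ f
encode {zero}  f inj = tt , λ ()
encode {suc n} f inj = (f zero , proj₁ rest) , λ where
    zero    → ≡.refl
    (suc i) → ≡.trans (cong (punchIn (f zero)) (proj₂ rest i)) (Fin.punchIn-punchOut (f0≢ i))
  where
  f0≢ : ∀ i → f zero ≢ f (suc i)
  f0≢ i eq with () ← inj eq
  rest = encode (λ i → punchOut (f0≢ i))
    (λ {x} {y} eq → Fin.suc-injective (inj (Fin.punchOut-injective (f0≢ x) (f0≢ y) eq)))

converse : ∀ {n} → Code n → Code n
converse c = proj₁ (encode (proj₁ ∘ ⟦⟧-surjective c)
  λ {x} {y} eq → ≡.trans (≡.sym (proj₂ (⟦⟧-surjective c x)))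
                   (≡.trans (cong ⟦ c ⟧ eq) (proj₂ (⟦⟧-surjective c y))))

⟦⟧-converseʳ : ∀ {n} (c : Code n) i → ⟦ c ⟧ (⟦ converse c ⟧ i) ≡ i
⟦⟧-converseʳ c i = ≡.trans (cong ⟦ c ⟧ (proj₂ (encode (proj₁ ∘ ⟦⟧-surjective c) _) i))
                        (proj₂ (⟦⟧-surjective c i))

⟦⟧-converseˡ : ∀ {n} (c : Code n) i → ⟦ converse c ⟧ (⟦ c ⟧ i) ≡ i
⟦⟧-converseˡ c i = ⟦⟧-injective c (⟦⟧-converseʳ c (⟦ c ⟧ i))

converse-involutive : ∀ {n} (c : Code n) → converse (converse c) ≡ c
converse-involutive c = ⟦⟧-faithful _ c λ i → ⟦⟧-injective (converse c)
  (≡.trans (⟦⟧-converseʳ (converse c) i) (≡.sym (⟦⟧-converseˡ c i)))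

codes : ∀ n → List (Code n)
codes zero    = tt ∷ []
codes (suc n) = cartesianProduct (allFin (suc n)) (codes n)

codes-unique : ∀ n → Unique (codes n)
codes-unique zero    = All.[] AllPairs.∷ AllPairs.[]
codes-unique (suc n) = Unique.cartesianProduct⁺ (Unique.allFin⁺ (suc n)) (codes-unique n)

∈-codes : ∀ {n} (c : Code n) → c ∈ codes n
∈-codes {zero}  _       = here ≡.refl
∈-codes {suc n} (j , c) = ∈.∈-cartesianProduct⁺ (∈.∈-allFin j) (∈-codes c)

module _ {a ℓ} (A : CommutativeMonoid a ℓ) where
  open CommutativeMonoid A renaming (refl to ≈-refl; sym to ≈-sym; trans to ≈-trans)
  open MonoidSum A using (sum; sum-remove)

  sum-reindex : ∀ {n} (c : Code n) (h : Fin n → Carrier) → sum (h ∘ ⟦ c ⟧) ≈ sum h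
  sum-reindex {zero}  c       h = ≈-refl
  sum-reindex {suc n} (j , c) h = ≈-trans (∙-congˡ (sum-reindex c (h ∘ punchIn j)))
    (≈-sym (sum-remove {i = j} h))

odd : ℕ → Bool
odd zero    = false
odd (suc n) = not (odd n)

⨁-zero : ∀ {n} {f : Fin n → Bool} → (∀ i → f i ≡ false) → ⨁ f ≡ false
⨁-zero {n} eq = ≡.trans (⨁-cong eq) (⨁-replicate-false n)

⨁-reindex : ∀ {n} (c : Code n) (h : Fin n → Bool) → ⨁ (h ∘ ⟦ c ⟧) ≡ ⨁ h
⨁-reindex = sum-reindex 𝔽₂.+-commutativeMonoid

⨁⨁ : ∀ {m n} → (Fin m → Fin n → Bool) → Bool
⨁⨁ F = ⨁ λ i → ⨁ (F i)

⨁⨁-cong : ∀ {m n} {F G : Fin m → Fin n → Bool} → (∀ i j → F i j ≡ G i j) → ⨁⨁ F ≡ ⨁⨁ G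
⨁⨁-cong eq = ⨁-cong λ i → ⨁-cong (eq i)

⨁⨁-distrib-xor : ∀ {m n} (F G : Fin m → Fin n → Bool) →
  ⨁⨁ (λ i j → F i j xor G i j) ≡ ⨁⨁ F xor ⨁⨁ G
⨁⨁-distrib-xor F G = ≡.trans (⨁-cong λ i → ⨁-distrib-xor (F i) (G i)) (⨁-distrib-xor (⨁ ∘ F) (⨁ ∘ G))

⨁⨁-reindex : ∀ {n} (c : Code n) (F : Fin n → Fin n → Bool) →
  ⨁⨁ (λ i j → F (⟦ c ⟧ i) (⟦ c ⟧ j)) ≡ ⨁⨁ F
⨁⨁-reindex c F = ≡.trans (⨁-reindex c (λ i → ⨁ (F i ∘ ⟦ c ⟧))) (⨁-cong λ i → ⨁-reindex c (F i))

-- Modulo 2, the entries at (i, j) and (j, i) cancel.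
⨁⨁-symmetric : ∀ {n} (F : Fin n → Fin n → Bool) → (∀ i → F i i ≡ false) →
  (∀ i j → F i j ≡ F j i) → ⨁⨁ F ≡ false
⨁⨁-symmetric {zero}  F diag symm = ≡.refl
⨁⨁-symmetric {suc n} F diag symm = begin
  (F zero zero xor row) xor ⨁ (λ i → F (suc i) zero xor ⨁ (λ j → F (suc i) (suc j)))
    ≡⟨ cong₂ (λ x y → (x xor row) xor y) (diag zero)
         (≡.trans (⨁-distrib-xor (λ i → F (suc i) zero) _)
                (cong₂ _xor_ (⨁-cong λ i → symm (suc i) zero)
                   (⨁⨁-symmetric (λ i j → F (suc i) (suc j)) (λ i → diag (suc i))
                      λ i j → symm (suc i) (suc j)))) ⟩
  row xor (row xor false)
    ≡⟨ solveᵇ 1 (λ x → x ⊕ (x ⊕ bit false) ⊜ᵇ bit false) ≡.refl row ⟩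
  false ∎
  where
  open ≡-Reasoning
  row = ⨁ λ j → F zero (suc j)

infix 4 _<ᵇ_

_<ᵇ_ : ∀ {n} → Fin n → Fin n → Bool
zero  <ᵇ zero  = false
zero  <ᵇ suc j = true
suc i <ᵇ zero  = false
suc i <ᵇ suc j = i <ᵇ j

<ᵇ-irrefl : ∀ {n} (i : Fin n) → (i <ᵇ i) ≡ false
<ᵇ-irrefl zero    = ≡.refl
<ᵇ-irrefl (suc i) = <ᵇ-irrefl i

Tournament : ∀ {n} → (Fin n → Fin n → Bool) → Set
Tournament U = ∀ {i j} → i ≢ j → U j i ≡ not (U i j)

<ᵇ-tournament : ∀ {n} → Tournament (_<ᵇ_ {n})
<ᵇ-tournament {i = zero}  {zero}  i≢j = contradiction ≡.refl i≢j
<ᵇ-tournament {i = zero}  {suc j} i≢j = ≡.refl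
<ᵇ-tournament {i = suc i} {zero}  i≢j = ≡.refl
<ᵇ-tournament {i = suc i} {suc j} i≢j = <ᵇ-tournament (i≢j ∘ cong suc)

punchIn-<ᵇ : ∀ {n} (j : Fin (suc n)) (a b : Fin n) → (punchIn j a <ᵇ punchIn j b) ≡ (a <ᵇ b)
punchIn-<ᵇ zero    a       b       = ≡.refl
punchIn-<ᵇ (suc j) zero    zero    = ≡.refl
punchIn-<ᵇ (suc j) zero    (suc b) = ≡.refl
punchIn-<ᵇ (suc j) (suc a) zero    = ≡.refl
punchIn-<ᵇ (suc j) (suc a) (suc b) = punchIn-<ᵇ j a b

-- `punchIn j` skips only j, so `toℕ j` of its values lie below j. These are the inversions in which
-- the first index takes part.
⨁-punchIn-<ᵇ : ∀ {n} (j : Fin (suc n)) → ⨁ (λ k → punchIn j k <ᵇ j) ≡ odd (toℕ j)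
⨁-punchIn-<ᵇ {n} zero = ⨁-zero {n} λ _ → ≡.refl
⨁-punchIn-<ᵇ {suc n} (suc j) = cong not (⨁-punchIn-<ᵇ j)

-- The parity of the digit sum of the code: each digit supplies the sign of one step of the
-- expansion along the first row.
isOdd : ∀ {n} → Code n → Bool
isOdd {zero}  _       = false
isOdd {suc n} (j , c) = odd (toℕ j) xor isOdd c

isOdd-inversions : ∀ {n} (c : Code n) →
  isOdd c ≡ ⨁⨁ (λ i j → (i <ᵇ j) ∧ (⟦ c ⟧ j <ᵇ ⟦ c ⟧ i))
isOdd-inversions {zero}  c       = ≡.refl
isOdd-inversions {suc n} (j , c) = ≡.sym (cong₂ _xor_
  (≡.trans (⨁-reindex c (λ k → punchIn j k <ᵇ j)) (⨁-punchIn-<ᵇ j))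
  (≡.trans (⨁⨁-cong λ a b → cong ((a <ᵇ b) ∧_) (punchIn-<ᵇ j (⟦ c ⟧ b) (⟦ c ⟧ a)))
         (≡.sym (isOdd-inversions c))))

ordered-cong : ∀ {n} {F G : Fin n → Fin n → Bool} → (∀ {i j} → i ≢ j → F i j ≡ G i j) →
  ∀ i j → (i <ᵇ j) ∧ F i j ≡ (i <ᵇ j) ∧ G i j
ordered-cong eq i j with i Fin.≟ j
... | yes ≡.refl = ≡.trans (cong (_∧ _) (<ᵇ-irrefl i)) (≡.sym (cong (_∧ _) (<ᵇ-irrefl i)))
... | no i≢j   = cong ((i <ᵇ j) ∧_) (eq i≢j)

-- A symmetric function has a sum over unordered pairs, which a permutation preserves.
⨁⨁-reindex-unordered : ∀ {n} (c : Code n) (Y : Fin n → Fin n → Bool) →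
  (∀ {i j} → i ≢ j → Y i j ≡ Y j i) →
  ⨁⨁ (λ i j → (i <ᵇ j) ∧ Y i j) ≡ ⨁⨁ (λ i j → (i <ᵇ j) ∧ Y (⟦ c ⟧ i) (⟦ c ⟧ j))
⨁⨁-reindex-unordered {n} c Y Y-sym = begin
  ⨁⨁ (λ i j → (i <ᵇ j) ∧ Y i j)
    ≡⟨ ⨁⨁-reindex c _ ⟨
  ⨁⨁ (λ i j → (f i <ᵇ f j) ∧ Y (f i) (f j))
    ≡⟨ ⨁⨁-cong (λ i j → solveᵇ 3 (λ t t′ y → t ⊗ y ⊜ᵇ t′ ⊗ y ⊕ (t ⊕ t′) ⊗ y) ≡.refl
         (f i <ᵇ f j) (i <ᵇ j) (Y (f i) (f j))) ⟩
  ⨁⨁ (λ i j → ((i <ᵇ j) ∧ Y (f i) (f j)) xor (((f i <ᵇ f j) xor (i <ᵇ j)) ∧ Y (f i) (f j)))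
    ≡⟨ ⨁⨁-distrib-xor {n} {n} _ _ ⟩
  ⨁⨁ (λ i j → (i <ᵇ j) ∧ Y (f i) (f j)) xor
  ⨁⨁ (λ i j → ((f i <ᵇ f j) xor (i <ᵇ j)) ∧ Y (f i) (f j))
    ≡⟨ cong (⨁⨁ (λ i j → (i <ᵇ j) ∧ Y (f i) (f j)) xor_) (⨁⨁-symmetric _ diag symm) ⟩
  ⨁⨁ (λ i j → (i <ᵇ j) ∧ Y (f i) (f j)) xor false
    ≡⟨ Bool.xor-identityʳ _ ⟩
  ⨁⨁ (λ i j → (i <ᵇ j) ∧ Y (f i) (f j)) ∎
  where
  open ≡-Reasoning
  f = ⟦ c ⟧
  diag : ∀ i → ((f i <ᵇ f i) xor (i <ᵇ i)) ∧ Y (f i) (f i) ≡ false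
  diag i rewrite <ᵇ-irrefl (f i) | <ᵇ-irrefl i = ≡.refl
  symm : ∀ i j → ((f i <ᵇ f j) xor (i <ᵇ j)) ∧ Y (f i) (f j) ≡
                 ((f j <ᵇ f i) xor (j <ᵇ i)) ∧ Y (f j) (f i)
  symm i j with i Fin.≟ j
  ... | yes ≡.refl = ≡.refl
  ... | no i≢j = cong₂ _∧_
    (≡.sym (≡.trans (cong₂ _xor_ (<ᵇ-tournament fi≢fj) (<ᵇ-tournament i≢j))
                (Bool.xor-annihilates-not (f i <ᵇ f j) (i <ᵇ j))))
    (Y-sym fi≢fj)
    where
    fi≢fj : f i ≢ f j
    fi≢fj eq = i≢j (⟦⟧-injective c eq)

-- The sign of a permutation counts the pairs whose order it reverses, with
-- respect to any tournament whatsoever.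
isOdd-tournament : ∀ {n} (c : Code n) (U : Fin n → Fin n → Bool) → Tournament U →
  isOdd c ≡ ⨁⨁ (λ i j → (i <ᵇ j) ∧ (U i j xor U (⟦ c ⟧ i) (⟦ c ⟧ j)))
isOdd-tournament {n} c U tour = begin
  isOdd c
    ≡⟨ isOdd-inversions c ⟩
  ⨁⨁ (λ i j → (i <ᵇ j) ∧ (f j <ᵇ f i))
    ≡⟨ ⨁⨁-cong (λ i j → ≡.trans
         (ordered-cong (λ i≢j → <ᵇ-tournament (λ eq → i≢j (⟦⟧-injective c eq))) i j)
         (split (i <ᵇ j) (U i j) (f i <ᵇ f j) (U (f i) (f j)))) ⟩
  ⨁⨁ (λ i j → ((i <ᵇ j) ∧ (U i j xor U (f i) (f j))) xor
               (((i <ᵇ j) ∧ Y i j) xor ((i <ᵇ j) ∧ Y (f i) (f j))))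
    ≡⟨ ≡.trans (⨁⨁-distrib-xor {n} {n} _ _) (cong (reversed xor_) (⨁⨁-distrib-xor {n} {n} _ _)) ⟩
  reversed xor (⨁⨁ (λ i j → (i <ᵇ j) ∧ Y i j) xor ⨁⨁ (λ i j → (i <ᵇ j) ∧ Y (f i) (f j)))
    ≡⟨ cong (λ z → reversed xor (z xor rest)) (⨁⨁-reindex-unordered c Y Y-sym) ⟩
  reversed xor (rest xor rest)
    ≡⟨ solveᵇ 2 (λ x y → x ⊕ (y ⊕ y) ⊜ᵇ x) ≡.refl reversed rest ⟩
  reversed ∎
  where
  open ≡-Reasoning
  f = ⟦ c ⟧
  -- `Y` marks the pairs on which `U` and the standard order disagree. It is symmetric because both
  -- are tournaments. Replacing one order by the other changes the count of reversals by the sum of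
  -- `Y` before and after the permutation, and these two sums are equal.
  Y : Fin _ → Fin _ → Bool
  Y i j = (i <ᵇ j) xor U i j
  Y-sym : ∀ {i j} → i ≢ j → Y i j ≡ Y j i
  Y-sym {i} {j} i≢j = ≡.sym (≡.trans (cong₂ _xor_ (<ᵇ-tournament i≢j) (tour i≢j))
                                 (Bool.xor-annihilates-not (i <ᵇ j) (U i j)))
  reversed = ⨁⨁ (λ i j → (i <ᵇ j) ∧ (U i j xor U (f i) (f j)))
  rest = ⨁⨁ (λ i j → (i <ᵇ j) ∧ Y (f i) (f j))
  split : ∀ t u t′ u′ → t ∧ not t′ ≡
    (t ∧ (u xor u′)) xor ((t ∧ (t xor u)) xor (t ∧ (t′ xor u′)))
  split true  u t′ u′ =
    solveᵇ 3 (λ u t′ u′ → bit true ⊕ t′ ⊜ᵇ (u ⊕ u′) ⊕ ((bit true ⊕ u) ⊕ (t′ ⊕ u′)))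
      ≡.refl u t′ u′
  split false u t′ u′ = ≡.refl

-- Written as a sum of the two strict comparisons, so that a sum over ordered pairs splits into the
-- halves i < j and j < i.
_≠ᵇ_ : ∀ {n} → Fin n → Fin n → Bool
i ≠ᵇ j = (i <ᵇ j) xor (j <ᵇ i)

≠ᵇ-irrefl : ∀ {n} (i : Fin n) → (i ≠ᵇ i) ≡ false
≠ᵇ-irrefl i = Bool.xor-same (i <ᵇ i)

≠ᵇ-sym : ∀ {n} (i j : Fin n) → (i ≠ᵇ j) ≡ (j ≠ᵇ i)
≠ᵇ-sym i j = Bool.xor-comm (i <ᵇ j) (j <ᵇ i)

≢⇒≠ᵇ : ∀ {n} {i j : Fin n} → i ≢ j → (i ≠ᵇ j) ≡ true
≢⇒≠ᵇ {i = i} {j} i≢j = ≡.trans (cong ((i <ᵇ j) xor_) (<ᵇ-tournament i≢j)) (Bool.xor-inverseʳ (i <ᵇ j))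

≠ᵇ⇒≢ : ∀ {n} {i j : Fin n} → (i ≠ᵇ j) ≡ true → i ≢ j
≠ᵇ⇒≢ {i = i} eq ≡.refl with () ← ≡.trans (≡.sym eq) (≠ᵇ-irrefl i)

≠ᵇ-⟦⟧ : ∀ {n} (c : Code n) i j → (⟦ c ⟧ i ≠ᵇ ⟦ c ⟧ j) ≡ (i ≠ᵇ j)
≠ᵇ-⟦⟧ c i j with i Fin.≟ j
... | yes ≡.refl = ≡.trans (≠ᵇ-irrefl (⟦ c ⟧ i)) (≡.sym (≠ᵇ-irrefl i))
... | no i≢j   = ≡.trans (≢⇒≠ᵇ (λ eq → i≢j (⟦⟧-injective c eq))) (≡.sym (≢⇒≠ᵇ i≢j))

⨁-sift : ∀ {n} (k : Fin n) (h : Fin n → Bool) → ⨁ (λ i → not (i ≠ᵇ k) ∧ h i) ≡ h k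
⨁-sift {suc n} zero    h = ≡.trans (cong (h zero xor_) (⨁-zero {n} λ _ → ≡.refl)) (Bool.xor-identityʳ _)
⨁-sift {suc n} (suc k) h = ⨁-sift k (h ∘ suc)

⨁⨁-sift : ∀ {m n} (g : Fin m → Fin n) (F : Fin n → Fin m → Bool) →
  ⨁⨁ (λ i j → not (i ≠ᵇ g j) ∧ F i j) ≡ ⨁ (λ j → F (g j) j)
⨁⨁-sift {m} {n} g F = ≡.trans (⨁-comm {n} {m} _) (⨁-cong λ j → ⨁-sift (g j) λ i → F i j)

-- The combinatorial core of Hopf's Umlaufsatz, for a disjoint union of closed
-- polygons with vertices p i and edges p i → p (f i).  Here X i j is the side of
-- the secant p j - p i, and χ i j k l tells whether turning from p j - p i to
-- p l - p k the short way crosses the gauge direction.  Splitting the motion of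
-- the secants p j - p i ↦ p (f j) - p (f i) into moves of one end at a time, all
-- contributions cancel except those of secants which become edges.
module Umlaufsatz {n} (c : Code n) where

  private f = ⟦ c ⟧

  moves : Fin n → Bool
  moves i = f i ≠ᵇ i

  module _
    (X : Fin n → Fin n → Bool) (χ : Fin n → Fin n → Fin n → Fin n → Bool)
    (X-anti : ∀ {i j} → f i ≢ i → f j ≢ j → i ≢ j → X j i ≡ not (X i j))
    (χ-neg : ∀ {i j} → f i ≢ i → f j ≢ j → i ≢ j →
      χ i j (f i) (f j) xor χ j i (f j) (f i) ≡ X i j xor X (f i) (f j))
    -- For i = f j the intermediate secant from i to f j would be zero; hence the condition i ≢ f j
    -- here and in `χ-neg₁`.
    (χ-split : ∀ {i j} → f i ≢ i → f j ≢ j → i ≢ j → i ≢ f j →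
      χ i j (f i) (f j) ≡ χ i j i (f j) xor χ i (f j) (f i) (f j))
    (χ-neg₁ : ∀ {i j} → f i ≢ i → f j ≢ j → i ≢ j → i ≢ f j →
      χ i j i (f j) xor χ j i (f j) i ≡ X i j xor X i (f j))
    where

    private
      s = moves

      s-f : ∀ i → s (f i) ≡ s i
      s-f i = ≠ᵇ-⟦⟧ c (f i) i

      fixed : ∀ {i} → s i ≡ false → f i ≡ i
      fixed {i} eq with f i Fin.≟ i
      ... | yes fi≡i = fi≡i
      ... | no  fi≢i with () ← ≡.trans (≡.sym (≢⇒≠ᵇ fi≢i)) eq

      when : ∀ i {A B} → (f i ≢ i → A ≡ B) → s i ∧ A ≡ s i ∧ B
      when i eq with s i in si
      ... | false = ≡.refl
      ... | true  = eq (≠ᵇ⇒≢ si)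

      ≠-when : ∀ (i j : Fin n) {A B} → (i ≢ j → A ≡ B) → (i ≠ᵇ j) ∧ A ≡ (i ≠ᵇ j) ∧ B
      ≠-when i j eq with i Fin.≟ j
      ... | yes ≡.refl rewrite ≠ᵇ-irrefl i = ≡.refl
      ... | no i≢j = cong ((i ≠ᵇ j) ∧_) (eq i≢j)

      m : Fin n → Fin n → Bool
      m i j = s i ∧ s j

      when₂ : ∀ i j {A B} → (f i ≢ i → f j ≢ j → A ≡ B) → m i j ∧ A ≡ m i j ∧ B
      when₂ i j {A} {B} eq = ≡.trans (Bool.∧-assoc (s i) (s j) A)
        (≡.trans (when i λ fi → when j λ fj → eq fi fj) (≡.sym (Bool.∧-assoc (s i) (s j) B)))

      -- `X` is meaningful only between moved indices. Letting every moved index beat every fixed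
      -- one, and ordering the fixed ones as usual, completes it to a tournament in which a pair
      -- with a fixed index is never reversed.
      U : Fin n → Fin n → Bool
      U i j = if s i then (if s j then X i j else true) else (if s j then false else (i <ᵇ j))

      U-tournament : Tournament U
      U-tournament {i} {j} i≢j with s i in si | s j in sj
      ... | true  | true  = X-anti (≠ᵇ⇒≢ si) (≠ᵇ⇒≢ sj) i≢j
      ... | true  | false = ≡.refl
      ... | false | true  = ≡.refl
      ... | false | false = <ᵇ-tournament i≢j

      U-moves : ∀ i j → U i j xor U (f i) (f j) ≡ m i j ∧ (X i j xor X (f i) (f j))
      U-moves i j rewrite s-f i | s-f j with s i in si | s j in sj
      ... | true  | true  = ≡.refl
      ... | true  | false = ≡.refl
      ... | false | true  = ≡.refl
      ... | false | false rewrite fixed si | fixed sj = Bool.xor-same (i <ᵇ j)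

      -- The full move of a secant, the move of its end alone, and the subsequent move of its start.
      D A B : Fin n → Fin n → Bool
      D i j = χ i j (f i) (f j)
      A i j = χ i j i (f j)
      B i j = χ i (f j) (f i) (f j)

      -- Secants from j to i are the negatives of those from i to j.
      A′ : Fin n → Fin n → Bool
      A′ i j = χ j i (f j) i

      n₁ n₂ : Fin n → Fin n → Bool
      n₁ i j = (i ≠ᵇ j) ∧ m i j
      n₂ i j = (i ≠ᵇ f j) ∧ n₁ i j

      open ≡-Reasoning

      -- By `χ-neg`, whether a pair is reversed is the sum of the contributions of its secant and of
      -- the negative secant. The sum over i < j thereby becomes one over all ordered pairs.
      isOdd≡D : isOdd c ≡ ⨁⨁ (λ i j → n₁ i j ∧ D i j)
      isOdd≡D = begin
        isOdd c
          ≡⟨ isOdd-tournament c U U-tournament ⟩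
        ⨁⨁ (λ i j → (i <ᵇ j) ∧ (U i j xor U (f i) (f j)))
          ≡⟨ ⨁⨁-cong (ordered-cong λ {i} {j} i≢j → ≡.trans (U-moves i j)
               (when₂ i j λ fi fj → ≡.sym (χ-neg fi fj i≢j))) ⟩
        ⨁⨁ (λ i j → (i <ᵇ j) ∧ (m i j ∧ (D i j xor D j i)))
          ≡⟨ ⨁⨁-cong (λ i j → solveᵇ 4 (λ t m x y → t ⊗ (m ⊗ (x ⊕ y)) ⊜ᵇ
               t ⊗ (m ⊗ x) ⊕ t ⊗ (m ⊗ y)) ≡.refl (i <ᵇ j) (m i j) (D i j) (D j i)) ⟩
        ⨁⨁ (λ i j → ((i <ᵇ j) ∧ (m i j ∧ D i j)) xor ((i <ᵇ j) ∧ (m i j ∧ D j i)))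
          ≡⟨ ⨁⨁-distrib-xor {n} {n} _ _ ⟩
        ⨁⨁ (λ i j → (i <ᵇ j) ∧ (m i j ∧ D i j)) xor ⨁⨁ (λ i j → (i <ᵇ j) ∧ (m i j ∧ D j i))
          ≡⟨ cong (⨁⨁ (λ i j → (i <ᵇ j) ∧ (m i j ∧ D i j)) xor_) (⨁-comm {n} {n} _) ⟩
        ⨁⨁ (λ i j → (i <ᵇ j) ∧ (m i j ∧ D i j)) xor ⨁⨁ (λ i j → (j <ᵇ i) ∧ (m j i ∧ D i j))
          ≡⟨ ⨁⨁-distrib-xor {n} {n} _ _ ⟨
        ⨁⨁ (λ i j → ((i <ᵇ j) ∧ (m i j ∧ D i j)) xor ((j <ᵇ i) ∧ (m j i ∧ D i j)))
          ≡⟨ ⨁⨁-cong (λ i j → solveᵇ 5 (λ t t′ x y d →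
               t ⊗ ((x ⊗ y) ⊗ d) ⊕ t′ ⊗ ((y ⊗ x) ⊗ d) ⊜ᵇ ((t ⊕ t′) ⊗ (x ⊗ y)) ⊗ d)
               ≡.refl (i <ᵇ j) (j <ᵇ i) (s i) (s j) (D i j)) ⟩
        ⨁⨁ (λ i j → n₁ i j ∧ D i j) ∎

      D-split : ∀ i j → n₁ i j ∧ D i j ≡
        ((n₂ i j ∧ A i j) xor (n₂ i j ∧ B i j)) xor (not (i ≠ᵇ f j) ∧ (n₁ i j ∧ D i j))
      D-split i j = ≡.trans
        (solveᵇ 4 (λ p q w d → (q ⊗ w) ⊗ d ⊜ᵇ
           p ⊗ (q ⊗ (w ⊗ d)) ⊕ (bit true ⊕ p) ⊗ ((q ⊗ w) ⊗ d)) ≡.refl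
           (i ≠ᵇ f j) (i ≠ᵇ j) (m i j) (D i j))
        (cong (_xor (not (i ≠ᵇ f j) ∧ (n₁ i j ∧ D i j))) (≡.trans
          (≠-when i (f j) λ i≢fj → ≠-when i j λ i≢j → when₂ i j λ fi fj → χ-split fi fj i≢j i≢fj)
          (solveᵇ 5 (λ p q w a b → p ⊗ (q ⊗ (w ⊗ (a ⊕ b))) ⊜ᵇ
             (p ⊗ (q ⊗ w)) ⊗ a ⊕ (p ⊗ (q ⊗ w)) ⊗ b) ≡.refl
             (i ≠ᵇ f j) (i ≠ᵇ j) (m i j) (A i j) (B i j))))

      -- `B i j` is `A′ (f j) i` by definition, so the substitution of (f j, i) for (i, j) matches
      -- the two sums; the set of admissible pairs is invariant under it.
      ∑B≡∑A′ : ⨁⨁ (λ i j → n₂ i j ∧ B i j) ≡ ⨁⨁ (λ i j → n₂ i j ∧ A′ i j)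
      ∑B≡∑A′ = begin
        ⨁⨁ (λ i j → n₂ i j ∧ B i j)
          ≡⟨ ⨁⨁-cong (λ i j → cong (_∧ B i j) (n₂-swap i j)) ⟩
        ⨁⨁ (λ i j → n₂ (f j) i ∧ A′ (f j) i)
          ≡⟨ ⨁-cong (λ i → ⨁-reindex c λ k → n₂ k i ∧ A′ k i) ⟩
        ⨁⨁ (λ i k → n₂ k i ∧ A′ k i)
          ≡⟨ ⨁-comm {n} {n} _ ⟩
        ⨁⨁ (λ i j → n₂ i j ∧ A′ i j) ∎
        where
        n₂-swap : ∀ i j → n₂ i j ≡ n₂ (f j) i
        n₂-swap i j rewrite ≠ᵇ-⟦⟧ c j i | s-f j | ≠ᵇ-sym i (f j) | ≠ᵇ-sym i j =
          solveᵇ 4 (λ p q x y → p ⊗ (q ⊗ (x ⊗ y)) ⊜ᵇ q ⊗ (p ⊗ (y ⊗ x))) ≡.refl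
            (f j ≠ᵇ i) (j ≠ᵇ i) (s i) (s j)

      -- The diagonal values of `X` belong to zero secants. Setting them to false allows sums over
      -- all pairs, which can be reindexed by `f`.
      X° : Fin n → Fin n → Bool
      X° i j = (i ≠ᵇ j) ∧ X i j

      ∑s = ⨁ s

      AA′-split : ∀ i j → (n₂ i j ∧ A i j) xor (n₂ i j ∧ A′ i j) ≡
        ((m i j ∧ X° i j) xor (m i j ∧ X° i (f j))) xor
        ((not (i ≠ᵇ f j) ∧ (m i j ∧ X° i j)) xor (not (i ≠ᵇ j) ∧ (m i j ∧ X° i (f j))))
      AA′-split i j = ≡.trans
        (solveᵇ 5 (λ p q w a a′ → p ⊗ (q ⊗ w) ⊗ a ⊕ p ⊗ (q ⊗ w) ⊗ a′ ⊜ᵇ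
           p ⊗ (q ⊗ (w ⊗ (a ⊕ a′)))) ≡.refl (i ≠ᵇ f j) (i ≠ᵇ j) (m i j) (A i j) (A′ i j))
        (≡.trans (≠-when i (f j) λ i≢fj → ≠-when i j λ i≢j → when₂ i j λ fi fj → χ-neg₁ fi fj i≢j i≢fj)
        (solveᵇ 5 (λ p q w x y → p ⊗ (q ⊗ (w ⊗ (x ⊕ y))) ⊜ᵇ
           ((w ⊗ (q ⊗ x)) ⊕ (w ⊗ (p ⊗ y))) ⊕
           (((bit true ⊕ p) ⊗ (w ⊗ (q ⊗ x))) ⊕ ((bit true ⊕ q) ⊗ (w ⊗ (p ⊗ y))))) ≡.refl
           (i ≠ᵇ f j) (i ≠ᵇ j) (m i j) (X i j) (X i (f j))))

      -- Over all pairs, the sums of `X° i j` and of `X° i (f j)` cancel by reindexing j. What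
      -- remains comes from the pairs missing in `n₂`, namely i = f j and i = j: the two secants
      -- along one edge, in both directions. They lie on opposite sides, so each moved edge
      -- contributes 1.
      ∑AA′ : ⨁⨁ (λ i j → n₂ i j ∧ A i j) xor ⨁⨁ (λ i j → n₂ i j ∧ A′ i j) ≡ ∑s
      ∑AA′ = begin
        ⨁⨁ (λ i j → n₂ i j ∧ A i j) xor ⨁⨁ (λ i j → n₂ i j ∧ A′ i j)
          ≡⟨ ⨁⨁-distrib-xor {n} {n} _ _ ⟨
        ⨁⨁ (λ i j → (n₂ i j ∧ A i j) xor (n₂ i j ∧ A′ i j))
          ≡⟨ ⨁⨁-cong AA′-split ⟩
        ⨁⨁ (λ i j → (F i j xor G i j) xor (F′ i j xor G′ i j))
          ≡⟨ ≡.trans (⨁⨁-distrib-xor {n} {n} _ _)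
               (cong₂ _xor_ (⨁⨁-distrib-xor {n} {n} F G) (⨁⨁-distrib-xor {n} {n} F′ G′)) ⟩
        (⨁⨁ F xor ⨁⨁ G) xor (⨁⨁ F′ xor ⨁⨁ G′)
          ≡⟨ cong₂ _xor_ (≡.trans (cong (⨁⨁ F xor_) G≡F) (Bool.xor-same (⨁⨁ F)))
               (cong₂ _xor_ (⨁⨁-sift f F) (⨁⨁-sift id λ i j → m i j ∧ X° i (f j))) ⟩
        ⨁ (λ j → m (f j) j ∧ X° (f j) j) xor ⨁ (λ j → m j j ∧ X° j (f j))
          ≡⟨ ⨁-distrib-xor {n} _ _ ⟨
        ⨁ (λ j → (m (f j) j ∧ X° (f j) j) xor (m j j ∧ X° j (f j)))
          ≡⟨ ⨁-cong closing ⟩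
        ∑s ∎
        where
        F G F′ G′ : Fin n → Fin n → Bool
        F i j = m i j ∧ X° i j
        G i j = m i j ∧ X° i (f j)
        F′ i j = not (i ≠ᵇ f j) ∧ (m i j ∧ X° i j)
        G′ i j = not (i ≠ᵇ j) ∧ (m i j ∧ X° i (f j))
        G≡F : ⨁⨁ G ≡ ⨁⨁ F
        G≡F = ≡.trans
          (⨁⨁-cong λ i j → cong (λ z → (s i ∧ z) ∧ X° i (f j)) (≡.sym (s-f j)))
          (⨁-cong λ i → ⨁-reindex c (F i))
        closing : ∀ j → (m (f j) j ∧ X° (f j) j) xor (m j j ∧ X° j (f j)) ≡ s j
        closing j rewrite s-f j | ≠ᵇ-sym j (f j) with s j in sj
        ... | false = ≡.refl
        ... | true = ≡.trans (cong (X (f j) j xor_) (X-anti ffj≢ fj≢ fj≢)) (Bool.xor-inverseʳ (X (f j) j))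
          where
          fj≢ = ≠ᵇ⇒≢ sj
          ffj≢ = λ eq → fj≢ (⟦⟧-injective c eq)

      -- The pairs split off carry the reversed edges. Restoring the directions costs the sum of `X`
      -- at two successive edges, and these costs cancel along the permutation.
      ∑D-neg : ⨁ (λ j → s j ∧ D (f j) j) ≡ ⨁ (λ j → s j ∧ D j (f j))
      ∑D-neg = begin
        ⨁ (λ j → s j ∧ D (f j) j)
          ≡⟨ ⨁-cong (λ j → ≡.trans (when j λ fj≢ → turn j fj≢)
               (solveᵇ 4 (λ s d x y → s ⊗ (d ⊕ (x ⊕ y)) ⊜ᵇ s ⊗ d ⊕ (s ⊗ x ⊕ s ⊗ y))
                  ≡.refl (s j) (D j (f j)) (X j (f j)) (X (f j) (f (f j))))) ⟩
        ⨁ (λ j → (s j ∧ D j (f j)) xor ((s j ∧ X j (f j)) xor (s j ∧ X (f j) (f (f j)))))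
          ≡⟨ ≡.trans (⨁-distrib-xor {n} _ _) (cong (⨁ (λ j → s j ∧ D j (f j)) xor_) (⨁-distrib-xor {n} _ _)) ⟩
        ⨁ (λ j → s j ∧ D j (f j)) xor (x xor ⨁ (λ j → s j ∧ X (f j) (f (f j))))
          ≡⟨ cong (λ z → ⨁ (λ j → s j ∧ D j (f j)) xor (x xor z)) (≡.trans
               (⨁-cong λ j → cong (_∧ X (f j) (f (f j))) (≡.sym (s-f j)))
               (⨁-reindex c λ k → s k ∧ X k (f k))) ⟩
        ⨁ (λ j → s j ∧ D j (f j)) xor (x xor x)
          ≡⟨ solveᵇ 2 (λ d x → d ⊕ (x ⊕ x) ⊜ᵇ d) ≡.refl (⨁ (λ j → s j ∧ D j (f j))) x ⟩
        ⨁ (λ j → s j ∧ D j (f j)) ∎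
        where
        x = ⨁ λ j → s j ∧ X j (f j)
        turn : ∀ j → f j ≢ j → D (f j) j ≡ D j (f j) xor (X j (f j) xor X (f j) (f (f j)))
        turn j fj≢ = ≡.trans
          (solveᵇ 2 (λ d d′ → d′ ⊜ᵇ d ⊕ (d ⊕ d′)) ≡.refl (D j (f j)) (D (f j) j))
          (cong (D j (f j) xor_)
            (χ-neg fj≢ (λ eq → fj≢ (⟦⟧-injective c eq)) (λ eq → fj≢ (≡.sym eq))))

    -- For a single cycle of m moved edges, `isOdd c` is the parity of m - 1 and the right-hand side
    -- that of m plus the number of turns past the gauge direction. So that number is odd: the form
    -- modulo 2 of the statement that a simple closed polygon has rotation number 1 or -1.
    umlaufsatz : isOdd c ≡ ⨁ (λ j → moves j ∧ not (χ j (f j) (f j) (f (f j))))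
    umlaufsatz = begin
      isOdd c
        ≡⟨ isOdd≡D ⟩
      ⨁⨁ (λ i j → n₁ i j ∧ D i j)
        ≡⟨ ≡.trans (⨁⨁-cong D-split) (≡.trans (⨁⨁-distrib-xor {n} {n} _ _)
             (cong₂ _xor_ (⨁⨁-distrib-xor {n} {n} _ _) (⨁⨁-sift f λ i j → n₁ i j ∧ D i j))) ⟩
      (⨁⨁ (λ i j → n₂ i j ∧ A i j) xor ⨁⨁ (λ i j → n₂ i j ∧ B i j)) xor
      ⨁ (λ j → n₁ (f j) j ∧ D (f j) j)
        ≡⟨ cong₂ _xor_ (≡.trans (cong (⨁⨁ (λ i j → n₂ i j ∧ A i j) xor_) ∑B≡∑A′) ∑AA′)
             (≡.trans (⨁-cong λ j → cong (_∧ D (f j) j) (n₁-f j)) ∑D-neg) ⟩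
      ∑s xor ⨁ (λ j → s j ∧ D j (f j))
        ≡⟨ ⨁-distrib-xor {n} _ _ ⟨
      ⨁ (λ j → s j xor (s j ∧ D j (f j)))
        ≡⟨ ⨁-cong (λ j → solveᵇ 2 (λ s d → s ⊕ s ⊗ d ⊜ᵇ s ⊗ (bit true ⊕ d)) ≡.refl
             (s j) (D j (f j))) ⟩
      ⨁ (λ j → moves j ∧ not (χ j (f j) (f j) (f (f j)))) ∎
      where
      n₁-f : ∀ j → n₁ (f j) j ≡ s j
      n₁-f j rewrite s-f j = ≡.trans (cong (s j ∧_) (Bool.∧-idem (s j))) (Bool.∧-idem (s j))

-- Composites, inverses and transpositions

_·_ : ∀ {n} → Code n → Code n → Code n
c · d = proj₁ (encode (⟦ c ⟧ ∘ ⟦ d ⟧) (⟦⟧-injective d ∘ ⟦⟧-injective c))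

⟦⟧-· : ∀ {n} (c d : Code n) i → ⟦ c · d ⟧ i ≡ ⟦ c ⟧ (⟦ d ⟧ i)
⟦⟧-· c d = proj₂ (encode (⟦ c ⟧ ∘ ⟦ d ⟧) (⟦⟧-injective d ∘ ⟦⟧-injective c))

-- Modulo 2, the pairs reversed by the composite are those reversed by `d` plus those whose images
-- under `d` are reversed by `c`. Being reversed is a symmetric relation, so the latter may be
-- counted over the original pairs.
isOdd-· : ∀ {n} (c d : Code n) → isOdd (c · d) ≡ isOdd c xor isOdd d
isOdd-· {n} c d = begin
  isOdd (c · d)
    ≡⟨ isOdd-tournament (c · d) _<ᵇ_ <ᵇ-tournament ⟩
  ⨁⨁ (λ i j → (i <ᵇ j) ∧ ((i <ᵇ j) xor (⟦ c · d ⟧ i <ᵇ ⟦ c · d ⟧ j)))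
    ≡⟨ ⨁⨁-cong (λ i j → ≡.trans
         (cong (λ z → (i <ᵇ j) ∧ ((i <ᵇ j) xor z)) (cong₂ _<ᵇ_ (⟦⟧-· c d i) (⟦⟧-· c d j)))
         (solveᵇ 3 (λ t t′ t″ → t ⊗ (t ⊕ t″) ⊜ᵇ t ⊗ (t′ ⊕ t″) ⊕ t ⊗ (t ⊕ t′)) ≡.refl
            (i <ᵇ j) (⟦ d ⟧ i <ᵇ ⟦ d ⟧ j) (⟦ c ⟧ (⟦ d ⟧ i) <ᵇ ⟦ c ⟧ (⟦ d ⟧ j)))) ⟩
  ⨁⨁ (λ i j → ((i <ᵇ j) ∧ Y (⟦ d ⟧ i) (⟦ d ⟧ j)) xor
               ((i <ᵇ j) ∧ ((i <ᵇ j) xor (⟦ d ⟧ i <ᵇ ⟦ d ⟧ j))))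
    ≡⟨ ⨁⨁-distrib-xor {n} {n} _ _ ⟩
  ⨁⨁ (λ i j → (i <ᵇ j) ∧ Y (⟦ d ⟧ i) (⟦ d ⟧ j)) xor
  ⨁⨁ (λ i j → (i <ᵇ j) ∧ ((i <ᵇ j) xor (⟦ d ⟧ i <ᵇ ⟦ d ⟧ j)))
    ≡⟨ cong₂ _xor_ (≡.trans (≡.sym (⨁⨁-reindex-unordered d Y Y-sym))
                            (≡.sym (isOdd-tournament c _<ᵇ_ <ᵇ-tournament)))
                   (≡.sym (isOdd-tournament d _<ᵇ_ <ᵇ-tournament)) ⟩
  isOdd c xor isOdd d ∎
  where
  open ≡-Reasoning
  Y : Fin n → Fin n → Bool
  Y i j = (i <ᵇ j) xor (⟦ c ⟧ i <ᵇ ⟦ c ⟧ j)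
  Y-sym : ∀ {i j} → i ≢ j → Y i j ≡ Y j i
  Y-sym {i} {j} i≢j = ≡.sym (≡.trans
    (cong₂ _xor_ (<ᵇ-tournament i≢j) (<ᵇ-tournament (i≢j ∘ ⟦⟧-injective c)))
    (Bool.xor-annihilates-not (i <ᵇ j) _))

⟦⟧-id-even : ∀ {n} (c : Code n) → (∀ i → ⟦ c ⟧ i ≡ i) → isOdd c ≡ false
⟦⟧-id-even {n} c eq = ≡.trans (isOdd-tournament c _<ᵇ_ <ᵇ-tournament)
  (⨁-zero {n} λ i → ⨁-zero {n} λ j → ≡.trans
    (cong (λ z → (i <ᵇ j) ∧ ((i <ᵇ j) xor z)) (cong₂ _<ᵇ_ (eq i) (eq j)))
    (≡.trans (cong ((i <ᵇ j) ∧_) (Bool.xor-same (i <ᵇ j))) (Bool.∧-zeroʳ (i <ᵇ j))))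

isOdd-converse : ∀ {n} (c : Code n) → isOdd (converse c) ≡ isOdd c
isOdd-converse c = begin
  isOdd (converse c)                                 ≡⟨ solveᵇ 2 (λ x y → x ⊜ᵇ y ⊕ (y ⊕ x)) ≡.refl (isOdd (converse c)) (isOdd c) ⟩
  isOdd c xor (isOdd c xor isOdd (converse c))       ≡⟨ cong (isOdd c xor_) (isOdd-· c (converse c)) ⟨
  isOdd c xor isOdd (c · converse c)                 ≡⟨ cong (isOdd c xor_) (⟦⟧-id-even (c · converse c) λ i →
                                                         ≡.trans (⟦⟧-· c (converse c) i) (⟦⟧-converseʳ c i)) ⟩
  isOdd c xor false                                 ≡⟨ Bool.xor-identityʳ (isOdd c) ⟩
  isOdd c                                           ∎
  where
  open ≡-Reasoning

module _ {n} {k l : Fin n} (k≢l : k ≢ l) where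

  private
    τ = Fin.transpose k l

    data Position (i : Fin n) : Set where
      first  : i ≡ k → τ i ≡ l → Position i
      second : i ≡ l → τ i ≡ k → Position i
      other  : i ≢ k → i ≢ l → τ i ≡ i → Position i

    position : ∀ i → Position i
    position i with i Fin.≟ k in eq
    ... | yes i≡k = first i≡k τi≡l
      where
      τi≡l : τ i ≡ l
      τi≡l rewrite eq = ≡.refl
    ... | no i≢k with i Fin.≟ l in eq′
    ...   | yes i≡l = second i≡l τi≡k
      where
      τi≡k : τ i ≡ k
      τi≡k rewrite eq | eq′ = ≡.refl
    ...   | no i≢l = other i≢k i≢l τi≡i
      where
      τi≡i : τ i ≡ i
      τi≡i rewrite eq | eq′ = ≡.refl

  transposition-involutive : ∀ i → τ (τ i) ≡ i
  transposition-involutive i with position i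
  ... | first i≡k τi≡l with position (τ i)
  ...   | first τi≡k _  = contradiction (≡.trans (≡.sym τi≡k) τi≡l) k≢l
  ...   | second _ eq   = ≡.trans eq (≡.sym i≡k)
  ...   | other _ τi≢l _ = contradiction τi≡l τi≢l
  transposition-involutive i | second i≡l τi≡k with position (τ i)
  ...   | first _ eq     = ≡.trans eq (≡.sym i≡l)
  ...   | second τi≡l _  = contradiction (≡.trans (≡.sym τi≡k) τi≡l) k≢l
  ...   | other τi≢k _ _ = contradiction τi≡k τi≢k
  transposition-involutive i | other _ _ eq = ≡.trans (cong τ eq) eq

  private
    encodedτ = encode τ λ {x} {y} eq → ≡.trans (≡.sym (transposition-involutive x))
      (≡.trans (cong τ eq) (transposition-involutive y))

  transposition : Code n
  transposition = proj₁ encodedτ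

  ⟦⟧-transposition : ∀ i → ⟦ transposition ⟧ i ≡ τ i
  ⟦⟧-transposition = proj₂ encodedτ

  -- With respect to a tournament in which k and l beat everyone else, only the
  -- pair {k , l} is reversed.
  isOdd-transposition : isOdd transposition ≡ true
  isOdd-transposition = begin
    isOdd transposition
      ≡⟨ isOdd-tournament transposition U U-tournament ⟩
    ⨁⨁ (λ i j → (i <ᵇ j) ∧ (U i j xor U (⟦ transposition ⟧ i) (⟦ transposition ⟧ j)))
      ≡⟨ ⨁⨁-cong (λ i j → ≡.trans (cong (λ z → (i <ᵇ j) ∧ (U i j xor z))
           (cong₂ U (⟦⟧-transposition i) (⟦⟧-transposition j))) (reversed i j)) ⟩
    ⨁⨁ (λ i j → (not (i ≠ᵇ k) ∧ (not (j ≠ᵇ l) ∧ (k <ᵇ l))) xor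
                 (not (i ≠ᵇ l) ∧ (not (j ≠ᵇ k) ∧ (l <ᵇ k))))
      ≡⟨ ⨁⨁-distrib-xor {n} {n} _ _ ⟩
    ⨁⨁ (λ i j → not (i ≠ᵇ k) ∧ (not (j ≠ᵇ l) ∧ (k <ᵇ l))) xor
    ⨁⨁ (λ i j → not (i ≠ᵇ l) ∧ (not (j ≠ᵇ k) ∧ (l <ᵇ k)))
      ≡⟨ cong₂ _xor_ (single k l (k <ᵇ l)) (single l k (l <ᵇ k)) ⟩
    (k <ᵇ l) xor (l <ᵇ k)
      ≡⟨ ≢⇒≠ᵇ k≢l ⟩
    true ∎
    where
    open ≡-Reasoning

    single : ∀ a b x → ⨁⨁ (λ i j → not (i ≠ᵇ a) ∧ (not (j ≠ᵇ b) ∧ x)) ≡ x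
    single a b x = ≡.trans (⨁-cong λ i → ≡.sym (∧-distribˡ-⨁ (not (i ≠ᵇ a)) λ j → not (j ≠ᵇ b) ∧ x))
      (≡.trans (⨁-sift a λ _ → ⨁ (λ j → not (j ≠ᵇ b) ∧ x)) (⨁-sift b λ _ → x))

    U : Fin n → Fin n → Bool
    U i j = if does (i Fin.≟ k) then (i ≠ᵇ j) else (if does (j Fin.≟ k) then false else
           (if does (i Fin.≟ l) then (i ≠ᵇ j) else (if does (j Fin.≟ l) then false else (i <ᵇ j))))

    U-tournament : Tournament U
    U-tournament {i} {j} i≢j with i Fin.≟ k | j Fin.≟ k | i Fin.≟ l | j Fin.≟ l
    ... | yes p | yes q | _     | _     = contradiction (≡.trans p (≡.sym q)) i≢j
    ... | yes p | no  q | _     | _     = cong not (≡.sym (≢⇒≠ᵇ i≢j))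
    ... | no  p | yes q | _     | _     = ≢⇒≠ᵇ (i≢j ∘ ≡.sym)
    ... | no  p | no  q | yes r | yes s = contradiction (≡.trans r (≡.sym s)) i≢j
    ... | no  p | no  q | yes r | no  s = cong not (≡.sym (≢⇒≠ᵇ i≢j))
    ... | no  p | no  q | no  r | yes s = ≢⇒≠ᵇ (i≢j ∘ ≡.sym)
    ... | no  p | no  q | no  r | no  s = <ᵇ-tournament i≢j

    l≢k : l ≢ k
    l≢k = k≢l ∘ ≡.sym

    Ukj : ∀ j → U k j ≡ (k ≠ᵇ j)
    Ukj j rewrite dec-true (k Fin.≟ k) ≡.refl = ≡.refl

    Uik : ∀ {i} → i ≢ k → U i k ≡ false
    Uik {i} i≢k rewrite dec-false (i Fin.≟ k) i≢k | dec-true (k Fin.≟ k) ≡.refl = ≡.refl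

    Ulj : ∀ {j} → j ≢ k → U l j ≡ (l ≠ᵇ j)
    Ulj {j} j≢k rewrite dec-false (l Fin.≟ k) l≢k | dec-false (j Fin.≟ k) j≢k
                      | dec-true (l Fin.≟ l) ≡.refl = ≡.refl

    Uil : ∀ {i} → i ≢ k → i ≢ l → U i l ≡ false
    Uil {i} i≢k i≢l rewrite dec-false (i Fin.≟ k) i≢k | dec-false (l Fin.≟ k) l≢k
                          | dec-false (i Fin.≟ l) i≢l | dec-true (l Fin.≟ l) ≡.refl = ≡.refl

    reversed : ∀ i j → (i <ᵇ j) ∧ (U i j xor U (τ i) (τ j)) ≡
      (not (i ≠ᵇ k) ∧ (not (j ≠ᵇ l) ∧ (k <ᵇ l))) xor (not (i ≠ᵇ l) ∧ (not (j ≠ᵇ k) ∧ (l <ᵇ k)))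
    reversed i j with position i | position j
    ... | first ≡.refl eq | first ≡.refl _
      rewrite <ᵇ-irrefl k | ≢⇒≠ᵇ k≢l = ≡.refl
    ... | first ≡.refl eq | second ≡.refl eq′
      rewrite eq | eq′ | Ukj l | Uik l≢k | ≢⇒≠ᵇ k≢l | ≠ᵇ-irrefl k | ≠ᵇ-irrefl l
      with k <ᵇ l
    ...   | true  = ≡.refl
    ...   | false = ≡.refl
    reversed i j | first ≡.refl eq | other j≢k j≢l eq′
      rewrite eq | eq′ | Ukj j | Ulj j≢k | ≢⇒≠ᵇ (j≢k ∘ ≡.sym) | ≢⇒≠ᵇ (j≢l ∘ ≡.sym) | ≢⇒≠ᵇ k≢l
            | ≢⇒≠ᵇ j≢l | ≠ᵇ-irrefl k with k <ᵇ j
    ...   | true  = ≡.refl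
    ...   | false = ≡.refl
    reversed i j | second ≡.refl eq | first ≡.refl eq′
      rewrite eq | eq′ | Ukj l | Uik l≢k | ≢⇒≠ᵇ k≢l | ≢⇒≠ᵇ l≢k | ≠ᵇ-irrefl k | ≠ᵇ-irrefl l
      with l <ᵇ k
    ...   | true  = ≡.refl
    ...   | false = ≡.refl
    reversed i j | second ≡.refl eq | second ≡.refl _
      rewrite <ᵇ-irrefl l | ≢⇒≠ᵇ l≢k = ≡.refl
    reversed i j | second ≡.refl eq | other j≢k j≢l eq′
      rewrite eq | eq′ | Ulj j≢k | Ukj j | ≢⇒≠ᵇ (j≢k ∘ ≡.sym) | ≢⇒≠ᵇ (j≢l ∘ ≡.sym) | ≢⇒≠ᵇ l≢k
            | ≢⇒≠ᵇ j≢k | ≠ᵇ-irrefl l with l <ᵇ j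
    ...   | true  = ≡.refl
    ...   | false = ≡.refl
    reversed i j | other i≢k i≢l eq | first ≡.refl eq′
      rewrite eq | eq′ | Uik i≢k | Uil i≢k i≢l | ≢⇒≠ᵇ i≢k | ≢⇒≠ᵇ i≢l with i <ᵇ k
    ...   | true  = ≡.refl
    ...   | false = ≡.refl
    reversed i j | other i≢k i≢l eq | second ≡.refl eq′
      rewrite eq | eq′ | Uik i≢k | Uil i≢k i≢l | ≢⇒≠ᵇ i≢k | ≢⇒≠ᵇ i≢l with i <ᵇ l
    ...   | true  = ≡.refl
    ...   | false = ≡.refl
    reversed i j | other i≢k i≢l eq | other j≢k j≢l eq′
      rewrite eq | eq′ | Bool.xor-same (U i j) | ≢⇒≠ᵇ i≢k | ≢⇒≠ᵇ i≢l with i <ᵇ j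
    ...   | true  = ≡.refl
    ...   | false = ≡.refl

-- The solver's coefficients are formal differences of natural numbers, so that
-- it can decide which of them vanish.
module CommutativeRingSolver {c ℓ} (R : CommutativeRing c ℓ) where
  open CommutativeRing R
  open CommutativeSemigroupProperties +-commutativeSemigroup using (interchange)
  open SemiringMult semiring using (×-homo-+; ×1-homo-*) renaming (_×_ to _⊠_)
  open RingProperties ring using (-‿+-comm; -0#≈0#; -‿involutive; -‿distribˡ-*; -‿distribʳ-*)
  open SetoidReasoning setoid

  private
    differences : RawRing 0ℓ 0ℓ
    differences = record
      { Carrier = ℕ × ℕ
      ; _≈_ = _≡_
      ; _+_ = λ (a , b) (c , d) → a ℕ.+ c , b ℕ.+ d
      ; _*_ = λ (a , b) (c , d) → a ℕ.* c ℕ.+ b ℕ.* d , a ℕ.* d ℕ.+ b ℕ.* c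
      ; -_  = λ (a , b) → b , a
      ; 0#  = 0 , 0
      ; 1#  = 1 , 0
      }

    value : ℕ × ℕ → Carrier
    value (a , b) = a ⊠ 1# - b ⊠ 1#

    sub-sub : ∀ a b c d → (a + b) - (c + d) ≈ (a - c) + (b - d)
    sub-sub a b c d = trans (+-congˡ (sym (-‿+-comm c d))) (interchange a b (- c) (- d))

    product : ∀ a b c d → (a * c + b * d) - (a * d + b * c) ≈ (a - b) * (c - d)
    product a b c d = sym (begin
      (a - b) * (c - d)
        ≈⟨ distribʳ (c - d) a (- b) ⟩
      a * (c - d) + - b * (c - d)
        ≈⟨ +-cong (distribˡ a c (- d)) (distribˡ (- b) c (- d)) ⟩
      (a * c + a * - d) + (- b * c + - b * - d)
        ≈⟨ +-congˡ (+-cong (sym (-‿distribˡ-* b c)) (begin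
             - b * - d    ≈⟨ -‿distribˡ-* b (- d) ⟨
             - (b * - d)  ≈⟨ -‿cong (-‿distribʳ-* b d) ⟨
             - - (b * d)  ≈⟨ -‿involutive (b * d) ⟩
             b * d        ∎)) ⟩
      (a * c + a * - d) + (- (b * c) + b * d)
        ≈⟨ +-cong (+-congˡ (sym (-‿distribʳ-* a d))) (+-comm (- (b * c)) (b * d)) ⟩
      (a * c - a * d) + (b * d - b * c)
        ≈⟨ sub-sub (a * c) (b * d) (a * d) (b * c) ⟨
      (a * c + b * d) - (a * d + b * c) ∎)

    morphism : differences ACR.-Raw-AlmostCommutative⟶ ACR.fromCommutativeRing R
    morphism = record
      { ⟦_⟧    = value
      ; +-homo = λ (a , b) (c , d) → trans
          (+-cong (×-homo-+ 1# a c) (-‿cong (×-homo-+ 1# b d))) (sub-sub _ _ _ _)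
      ; *-homo = λ (a , b) (c , d) → trans
          (+-cong (trans (×-homo-+ 1# (a ℕ.* c) (b ℕ.* d)) (+-cong (×1-homo-* a c) (×1-homo-* b d)))
            (-‿cong (trans (×-homo-+ 1# (a ℕ.* d) (b ℕ.* c)) (+-cong (×1-homo-* a d) (×1-homo-* b c)))))
          (product _ _ _ _)
      ; -‿homo = λ (a , b) → trans (+-comm (b ⊠ 1#) (- (a ⊠ 1#)))
          (trans (+-congˡ (sym (-‿involutive (b ⊠ 1#)))) (-‿+-comm (a ⊠ 1#) (- (b ⊠ 1#))))
      ; 0-homo = -‿inverseʳ 0#
      ; 1-homo = trans (+-congˡ -0#≈0#) (trans (+-identityʳ _) (+-identityʳ 1#))
      }

    cancel : ∀ {a b c d} → a + d ≈ c + b → a - b ≈ c - d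
    cancel {a} {b} {c} {d} eq = begin
      a - b              ≈⟨ +-identityʳ (a - b) ⟨
      a - b + 0#         ≈⟨ +-congˡ (-‿inverseʳ d) ⟨
      (a - b) + (d - d)  ≈⟨ interchange a (- b) d (- d) ⟩
      (a + d) + (- b - d) ≈⟨ +-congʳ eq ⟩
      (c + b) + (- b - d) ≈⟨ +-assoc c b (- b - d) ⟩
      c + (b + (- b - d)) ≈⟨ +-congˡ (+-assoc b (- b) (- d)) ⟨
      c + (b - b - d)     ≈⟨ +-congˡ (+-congʳ (-‿inverseʳ b)) ⟩
      c + (0# - d)        ≈⟨ +-congˡ (+-identityˡ (- d)) ⟩
      c - d               ∎

    decide : ∀ x y → Maybe (value x ≈ value y)
    decide (a , b) (c , d) with a ℕ.+ d ℕ.≟ c ℕ.+ b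
    ... | yes eq = just (cancel (trans (sym (×-homo-+ 1# a d))
                     (trans (reflexive (cong (_⊠ 1#) eq)) (×-homo-+ 1# c b))))
    ... | no _   = nothing

  open RingSolver differences (ACR.fromCommutativeRing R) morphism decide public
    using (solve; _:+_; _:*_; _:-_; :-_) renaming (_:=_ to _⊜_)

-- Sums over lists and determinants

module ListSum {a ℓ} (A : CommutativeMonoid a ℓ) where
  open CommutativeMonoid A
  open MonoidSum A using (sum)
  open SetoidReasoning setoid

  ∑ₗ : List Carrier → Carrier
  ∑ₗ = foldr _∙_ ε

  ∑ₗ-↭ : ∀ {xs ys} → xs ↭ ys → ∑ₗ xs ≈ ∑ₗ ys
  ∑ₗ-↭ ↭.refl         = refl
  ∑ₗ-↭ (↭.prep x p)   = ∙-congˡ (∑ₗ-↭ p)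
  ∑ₗ-↭ (↭.swap x y p) = trans (sym (assoc x y _))
    (trans (∙-cong (comm x y) (∑ₗ-↭ p)) (assoc y x _))
  ∑ₗ-↭ (↭.trans p q)  = trans (∑ₗ-↭ p) (∑ₗ-↭ q)

  ∑ₗ-++ : ∀ xs ys → ∑ₗ (xs ++ ys) ≈ ∑ₗ xs ∙ ∑ₗ ys
  ∑ₗ-++ []       ys = sym (identityˡ _)
  ∑ₗ-++ (x ∷ xs) ys = trans (∙-congˡ (∑ₗ-++ xs ys)) (sym (assoc x _ _))

  ∑ₗ-tabulate : ∀ {n} (f : Fin n → Carrier) → ∑ₗ (tabulate f) ≡ sum f
  ∑ₗ-tabulate {zero}  f = ≡.refl
  ∑ₗ-tabulate {suc n} f = cong (f zero ∙_) (∑ₗ-tabulate (f ∘ suc))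

  module _ {b} {B : Set b} where

    ∑ₗ-cong : ∀ {f g : B → Carrier} xs → (∀ {x} → x ∈ xs → f x ≈ g x) →
              ∑ₗ (map f xs) ≈ ∑ₗ (map g xs)
    ∑ₗ-cong []       eq = refl
    ∑ₗ-cong (x ∷ xs) eq = ∙-cong (eq (here ≡.refl)) (∑ₗ-cong xs (eq ∘ there))

    ∑ₗ-filter : ∀ {p} {P : Pred B p} (P? : Decidable P) (f : B → Carrier) xs →
                (∀ x → ¬ P x → f x ≈ ε) → ∑ₗ (map f (filter P? xs)) ≈ ∑ₗ (map f xs)
    ∑ₗ-filter P? f []       eq = refl
    ∑ₗ-filter P? f (x ∷ xs) eq with P? x
    ... | yes _  = ∙-congˡ (∑ₗ-filter P? f xs eq)
    ... | no ¬Px = trans (∑ₗ-filter P? f xs eq) (trans (sym (identityˡ _)) (∙-congʳ (sym (eq x ¬Px))))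

    ∑ₗ-allFin : ∀ {n} (f : Fin n → Carrier) → ∑ₗ (map f (allFin n)) ≡ sum f
    ∑ₗ-allFin f = ≡.trans (cong ∑ₗ (List.map-tabulate id f)) (∑ₗ-tabulate f)

  ∑ₗ-cartesianProduct : ∀ {b d} {B : Set b} {D : Set d} (f : B × D → Carrier) xs ys →
    ∑ₗ (map f (cartesianProduct xs ys)) ≈ ∑ₗ (map (λ x → ∑ₗ (map (λ y → f (x , y)) ys)) xs)
  ∑ₗ-cartesianProduct f []       ys = refl
  ∑ₗ-cartesianProduct f (x ∷ xs) ys = begin
    ∑ₗ (map f (map (x ,_) ys ++ cartesianProduct xs ys))
      ≡⟨ cong ∑ₗ (List.map-++ f (map (x ,_) ys) _) ⟩
    ∑ₗ (map f (map (x ,_) ys) ++ map f (cartesianProduct xs ys))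
      ≈⟨ ∑ₗ-++ (map f (map (x ,_) ys)) _ ⟩
    ∑ₗ (map f (map (x ,_) ys)) ∙ ∑ₗ (map f (cartesianProduct xs ys))
      ≈⟨ ∙-cong (reflexive (cong ∑ₗ (≡.sym (List.map-∘ ys)))) (∑ₗ-cartesianProduct f xs ys) ⟩
    ∑ₗ (map (λ y → f (x , y)) ys) ∙ ∑ₗ (map (λ x → ∑ₗ (map (λ y → f (x , y)) ys)) xs) ∎

-- Through this lemma bijections of index sets become equalities of sums: only membership has to be
-- checked, and no rearrangement is exhibited.
unique-↭ : ∀ {a} {A : Set a} {xs ys : List A} → Unique xs → Unique ys →
           (∀ {x} → x ∈ xs → x ∈ ys) → (∀ {x} → x ∈ ys → x ∈ xs) → xs ↭ ys
unique-↭ ux uy to from = ∼bag⇒↭ (unique∧set⇒bag ux uy (mk⇔ to from))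

codes-↭ : ∀ {n} (ρ : Code n → Code n) → (∀ c → ρ (ρ c) ≡ c) → map ρ (codes n) ↭ codes n
codes-↭ {n} ρ invol = unique-↭
  (Unique.map⁺ (λ {x} {y} eq → ≡.trans (≡.sym (invol x)) (≡.trans (cong ρ eq) (invol y)))
     (codes-unique n))
  (codes-unique n) (λ _ → ∈-codes _)
  λ {c} _ → subst (_∈ map ρ (codes n)) (invol c) (∈.∈-map⁺ ρ (∈-codes (ρ c)))

module OrderedFieldProperties {c ℓ₁ ℓ₂} (K : OrderedField c ℓ₁ ℓ₂) where
  open OrderedField K
  open IsStrictTotalOrder isStrictTotalOrder public
    using () renaming (irrefl to <-irrefl; trans to <-trans; <-respˡ-≈ to <-respˡ; <-respʳ-≈ to <-respʳ)

  -- The order excludes characteristic 2.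
  x+x≈0⇒x≈0 : ∀ {x} → x + x ≈ 0# → x ≈ 0#
  x+x≈0⇒x≈0 {x} eq with compare 0# x
  ... | tri≈ _ 0≈x _ = sym 0≈x
  ... | tri< 0<x _ _ = contradiction (<-trans 0<x (<-respˡ (+-identityʳ x) (<-respʳ eq (+-monoʳ-< x 0<x))))
                         (<-irrefl refl)
  ... | tri> _ _ x<0 = contradiction (<-trans (<-respˡ eq (<-respʳ (+-identityʳ x) (+-monoʳ-< x x<0))) x<0)
                         (<-irrefl refl)

module Determinant {c ℓ₁ ℓ₂} (K : OrderedField c ℓ₁ ℓ₂) where
  open OrderedField K
  open OrderedFieldProperties K
  open RingProperties ring using (-‿distribˡ-*; -‿involutive; -1*x≈-x; -0#≈0#)
  open SemiringSum semiring
    using (sum-cong-≋; *-distribˡ-sum; *-distribʳ-sum; ∑-comm; ∑-distrib-+; sum-replicate-zero; sum-remove)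
  open ListSum +-commutativeMonoid
  module ∏ = MonoidSum *-commutativeMonoid
  open CommutativeRingSolver commutativeRing
  open SetoidReasoning setoid

  sgn : Bool → Carrier
  sgn b = if b then - 1# else 1#

  sgn-not : ∀ b → sgn (not b) ≈ - sgn b
  sgn-not true  = sym (-‿involutive 1#)
  sgn-not false = refl

  sgn-xor : ∀ b b′ → sgn (b xor b′) ≈ sgn b * sgn b′
  sgn-xor false b′ = sym (*-identityˡ _)
  sgn-xor true  b′ = trans (sgn-not b′) (sym (-1*x≈-x (sgn b′)))

  sgn-odd : ∀ n → (- 1#) ^ n ≈ sgn (odd n)
  sgn-odd zero    = refl
  sgn-odd (suc n) = trans (*-congˡ (sgn-odd n)) (trans (-1*x≈-x _) (sym (sgn-not (odd n))))

  term : ∀ {n} → Matrix K n n → Code n → Carrier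
  term A c = sgn (isOdd c) * product (λ i → A i (⟦ c ⟧ i))

  ∑-codes : ∀ {n} → (Code n → Carrier) → Carrier
  ∑-codes {n} F = ∑ (map F (codes n))

  ∑ₗ-*ˡ : ∀ {b} {B : Set b} x (f : B → Carrier) xs → ∑ (map (λ y → x * f y) xs) ≈ x * ∑ (map f xs)
  ∑ₗ-*ˡ x f []       = sym (zeroʳ x)
  ∑ₗ-*ˡ x f (y ∷ xs) = trans (+-congˡ (∑ₗ-*ˡ x f xs)) (sym (distribˡ x _ _))

  leibniz : ∀ {n} (A : Matrix K n n) → det K A ≈ ∑-codes (term A)
  leibniz {zero}  A = sym (trans (+-identityʳ _) (*-identityˡ 1#))
  leibniz {suc n} A = sym (begin
    ∑-codes (term A)
      ≈⟨ ∑ₗ-cartesianProduct (term A) (allFin (suc n)) (codes n) ⟩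
    ∑ (map (λ j → ∑ (map (λ c → term A (j , c)) (codes n))) (allFin (suc n)))
      ≡⟨ ∑ₗ-allFin {B = Fin (suc n)} (λ j → ∑ (map (λ c → term A (j , c)) (codes n))) ⟩
    sum (λ j → ∑ (map (λ c → term A (j , c)) (codes n)))
      ≈⟨ sum-cong-≋ (λ j → trans
           (trans (∑ₗ-cong (codes n) λ {c} _ → step j c) (∑ₗ-*ˡ (sgn (odd (toℕ j)) * A zero j) (term (minor j)) (codes n)))
           (trans (*-assoc _ _ _) (*-cong (sym (sgn-odd (toℕ j))) (*-congˡ (sym (leibniz (minor j))))))) ⟩
    det K A ∎)
    where
    minor : Fin (suc n) → Matrix K n n
    minor j i k = A (suc i) (punchIn j k)
    step : ∀ j c → term A (j , c) ≈ (sgn (odd (toℕ j)) * A zero j) * term (minor j) c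
    step j c = trans (*-congʳ (sgn-xor (odd (toℕ j)) (isOdd c)))
      (solve 4 (λ s t a p → (s :* t) :* (a :* p) ⊜ (s :* a) :* (t :* p)) refl
         (sgn (odd (toℕ j))) (sgn (isOdd c)) (A zero j) (product λ i → minor j i (⟦ c ⟧ i)))

  ∑-codes-cong : ∀ {n} {F G : Code n → Carrier} → (∀ c → F c ≈ G c) → ∑-codes F ≈ ∑-codes G
  ∑-codes-cong {n} eq = ∑ₗ-cong (codes n) λ {c} _ → eq c

  ∑-codes-involution : ∀ {n} (ρ : Code n → Code n) → (∀ c → ρ (ρ c) ≡ c) → (F : Code n → Carrier) →
    ∑-codes (F ∘ ρ) ≈ ∑-codes F
  ∑-codes-involution {n} ρ invol F = trans
    (reflexive (cong ∑ (List.map-∘ (codes n))))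
    (∑ₗ-↭ (↭.map⁺ F (codes-↭ ρ invol)))

  ∏-reindex : ∀ {n} (c : Code n) (h : Fin n → Carrier) → product (h ∘ ⟦ c ⟧) ≈ product h
  ∏-reindex = sum-reindex *-commutativeMonoid

  ∏-cong : ∀ {n} {f g : Fin n → Carrier} → (∀ i → f i ≈ g i) → product f ≈ product g
  ∏-cong = ∏.sum-cong-≋

  det-cong : ∀ {n} {A B : Matrix K n n} → (∀ i j → A i j ≈ B i j) → det K A ≈ det K B
  det-cong {A = A} {B} eq = trans (leibniz A) (trans
    (∑-codes-cong λ c → *-congˡ (∏-cong λ i → eq i (⟦ c ⟧ i))) (sym (leibniz B)))

  _ᵀ : ∀ {m n} → Matrix K m n → Matrix K n m
  (A ᵀ) i j = A j i

  -- Inverting the permutation exchanges rows and columns in its Leibniz term and keeps the sign.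
  det-ᵀ : ∀ {n} (A : Matrix K n n) → det K (A ᵀ) ≈ det K A
  det-ᵀ A = begin
    det K (A ᵀ)                    ≈⟨ leibniz (A ᵀ) ⟩
    ∑-codes (term (A ᵀ))           ≈⟨ ∑-codes-involution converse converse-involutive (term (A ᵀ)) ⟨
    ∑-codes (term (A ᵀ) ∘ converse) ≈⟨ ∑-codes-cong step ⟩
    ∑-codes (term A)               ≈⟨ leibniz A ⟨
    det K A                        ∎
    where
    step : ∀ c → term (A ᵀ) (converse c) ≈ term A c
    step c = *-cong (reflexive (cong sgn (isOdd-converse c))) (begin
      product (λ i → A (⟦ converse c ⟧ i) i)
        ≈⟨ ∏-reindex c (λ i → A (⟦ converse c ⟧ i) i) ⟨
      product (λ i → A (⟦ converse c ⟧ (⟦ c ⟧ i)) (⟦ c ⟧ i))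
        ≈⟨ ∏-cong (λ i → reflexive (cong (λ k → A k (⟦ c ⟧ i)) (⟦⟧-converseˡ c i))) ⟩
      product (λ i → A i (⟦ c ⟧ i)) ∎)

  -- Composition with the transposition of k and l is an involution of the permutations which
  -- negates every Leibniz term, so the determinant equals its own negative.
  det-alternating : ∀ {n} (A : Matrix K n n) {k l} → k ≢ l → (∀ j → A k j ≈ A l j) → det K A ≈ 0#
  det-alternating {n} A {k} {l} k≢l eq = trans (leibniz A) (x+x≈0⇒x≈0 (begin
    ∑-codes (term A) + ∑-codes (term A)
      ≈⟨ +-congˡ (trans (sym (∑-codes-involution ρ ρ-involutive (term A))) (trans (∑-codes-cong step) (∑ₗ-neg (term A) (codes n)))) ⟩
    ∑-codes (term A) - ∑-codes (term A)
      ≈⟨ -‿inverseʳ _ ⟩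
    0# ∎))
    where
    τ = transposition k≢l
    ρ : Code n → Code n
    ρ c = c · τ
    τ-involutive : ∀ i → ⟦ τ ⟧ (⟦ τ ⟧ i) ≡ i
    τ-involutive i = ≡.trans (≡.trans (cong ⟦ τ ⟧ (⟦⟧-transposition k≢l i)) (⟦⟧-transposition k≢l _))
                             (transposition-involutive k≢l i)
    ρ-involutive : ∀ c → ρ (ρ c) ≡ c
    ρ-involutive c = ⟦⟧-faithful _ c λ i → ≡.trans (⟦⟧-· (c · τ) τ i)
      (≡.trans (⟦⟧-· c τ (⟦ τ ⟧ i)) (cong ⟦ c ⟧ (τ-involutive i)))
    row : ∀ i j → A i j ≈ A (⟦ τ ⟧ i) j
    row i j rewrite ⟦⟧-transposition k≢l i with i Fin.≟ k
    ... | yes ≡.refl = eq j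
    ... | no _ with i Fin.≟ l
    ...   | yes ≡.refl = sym (eq j)
    ...   | no _ = refl
    step : ∀ c → term A (ρ c) ≈ - term A c
    step c = begin
      sgn (isOdd (c · τ)) * product (λ i → A i (⟦ c · τ ⟧ i))
        ≈⟨ *-cong (reflexive (cong sgn (≡.trans (isOdd-· c τ) (≡.trans (cong (isOdd c xor_) (isOdd-transposition k≢l)) (Bool.xor-comm (isOdd c) true)))))
             (∏-cong λ i → trans (reflexive (cong (A i) (⟦⟧-· c τ i))) (row i _)) ⟩
      sgn (not (isOdd c)) * product (λ i → A (⟦ τ ⟧ i) (⟦ c ⟧ (⟦ τ ⟧ i)))
        ≈⟨ *-cong (sgn-not (isOdd c)) (∏-reindex τ λ i → A i (⟦ c ⟧ i)) ⟩
      - sgn (isOdd c) * product (λ i → A i (⟦ c ⟧ i))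
        ≈⟨ -‿distribˡ-* _ _ ⟨
      - term A c ∎
    ∑ₗ-neg : ∀ {b} {B : Set b} (f : B → Carrier) xs → ∑ (map (λ y → - f y) xs) ≈ - ∑ (map f xs)
    ∑ₗ-neg f []       = sym -0#≈0#
    ∑ₗ-neg f (y ∷ xs) = trans (+-congˡ (∑ₗ-neg f xs)) (solve 2 (λ a b → :- a :- b ⊜ :- (a :+ b)) refl (f y) _)

  infixl 8 _[_]≔_

  _[_]≔_ : ∀ {m n} → Matrix K m n → Fin m → (Fin n → Carrier) → Matrix K m n
  (A [ i ]≔ v) k = if does (k Fin.≟ i) then v else A k

  []≔-updates : ∀ {m n} (A : Matrix K m n) i v → (A [ i ]≔ v) i ≡ v
  []≔-updates A i v rewrite dec-true (i Fin.≟ i) ≡.refl = ≡.refl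

  []≔-minimal : ∀ {m n} (A : Matrix K m n) {i k} v → k ≢ i → (A [ i ]≔ v) k ≡ A k
  []≔-minimal A {i} {k} v k≢i rewrite dec-false (k Fin.≟ i) k≢i = ≡.refl

  δ : ∀ {n} → Fin n → Fin n → Carrier
  δ i j = if does (i Fin.≟ j) then 1# else 0#

  δ-same : ∀ {n} (i : Fin n) → δ i i ≡ 1#
  δ-same i rewrite dec-true (i Fin.≟ i) ≡.refl = ≡.refl

  δ-distinct : ∀ {n} {i j : Fin n} → i ≢ j → δ i j ≡ 0#
  δ-distinct {i = i} {j} i≢j rewrite dec-false (i Fin.≟ j) i≢j = ≡.refl

  sum-δ : ∀ {n} (v : Fin n → Carrier) k → sum (λ j → v j * δ j k) ≈ v k
  sum-δ {suc n} v k = begin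
    sum (λ j → v j * δ j k)
      ≈⟨ sum-remove {i = k} (λ j → v j * δ j k) ⟩
    v k * δ k k + sum (λ i → v (punchIn k i) * δ (punchIn k i) k)
      ≈⟨ +-cong (trans (*-congˡ (reflexive (δ-same k))) (*-identityʳ _))
           (sum-cong-≋ λ i → trans (*-congˡ (reflexive (δ-distinct (Fin.punchInᵢ≢i k i)))) (zeroʳ _)) ⟩
    v k + sum {n} (λ _ → 0#)
      ≈⟨ trans (+-congˡ (sum-replicate-zero n)) (+-identityʳ _) ⟩
    v k ∎

  -- Overwriting a row by a unit vector, instead of deleting a row and a column, avoids a separate
  -- sign.
  cofactor : ∀ {n} → Matrix K n n → Matrix K n n
  cofactor A i j = det K (A [ i ]≔ δ j)

  -- The product over all rows except row i is written as one in which row i is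
  -- constantly 1.
  product-[]≔ : ∀ {m n} (A : Matrix K m n) i v (f : Fin m → Fin n) →
    product (λ k → (A [ i ]≔ v) k (f k)) ≈
    v (f i) * product (λ k → (A [ i ]≔ (λ _ → 1#)) k (f k))
  product-[]≔ {suc m} A i v f = begin
    product (λ k → (A [ i ]≔ v) k (f k))
      ≈⟨ split v ⟩
    v (f i) * others v
      ≈⟨ *-congˡ (∏-cong λ k → reflexive (≡.trans (same v k) (≡.sym (same (λ _ → 1#) k)))) ⟩
    v (f i) * others (λ _ → 1#)
      ≈⟨ *-congˡ (trans (split (λ _ → 1#)) (*-identityˡ _)) ⟨
    v (f i) * product (λ k → (A [ i ]≔ (λ _ → 1#)) k (f k)) ∎
    where
    others : (Fin _ → Carrier) → Carrier
    others w = product (λ k → (A [ i ]≔ w) (punchIn i k) (f (punchIn i k)))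
    same : ∀ w k → (A [ i ]≔ w) (punchIn i k) (f (punchIn i k)) ≡ A (punchIn i k) (f (punchIn i k))
    same w k = cong (λ r → r (f (punchIn i k))) ([]≔-minimal A w (Fin.punchInᵢ≢i i k))
    split : ∀ w → product (λ k → (A [ i ]≔ w) k (f k)) ≈ w (f i) * others w
    split w = trans (∏.sum-remove {i = i} (λ k → (A [ i ]≔ w) k (f k)))
      (*-congʳ (reflexive (cong (λ r → r (f i)) ([]≔-updates A i w))))

  ∑ₗ-sum-comm : ∀ {b n} {B : Set b} (F : B → Fin n → Carrier) xs →
    ∑ (map (λ x → sum (F x)) xs) ≈ sum (λ j → ∑ (map (λ x → F x j) xs))
  ∑ₗ-sum-comm {n = n} F []       = sym (sum-replicate-zero n)
  ∑ₗ-sum-comm F (x ∷ xs) = trans (+-congˡ (∑ₗ-sum-comm F xs)) (sym (∑-distrib-+ (F x) _))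

  -- Each Leibniz term contains exactly one entry of row i and is therefore linear in that row.
  cofactor-expansion : ∀ {n} (A : Matrix K n n) i v →
    sum (λ j → v j * cofactor A i j) ≈ det K (A [ i ]≔ v)
  cofactor-expansion {n} A i v = begin
    sum (λ j → v j * cofactor A i j)
      ≈⟨ sum-cong-≋ (λ j → trans (*-congˡ (leibniz (A [ i ]≔ δ j)))
           (sym (∑ₗ-*ˡ (v j) (term (A [ i ]≔ δ j)) (codes n)))) ⟩
    sum (λ j → ∑ (map (λ c → v j * term (A [ i ]≔ δ j) c) (codes n)))
      ≈⟨ ∑ₗ-sum-comm (λ c j → v j * term (A [ i ]≔ δ j) c) (codes n) ⟨
    ∑-codes (λ c → sum (λ j → v j * term (A [ i ]≔ δ j) c))
      ≈⟨ ∑-codes-cong step ⟩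
    ∑-codes (term (A [ i ]≔ v))
      ≈⟨ leibniz (A [ i ]≔ v) ⟨
    det K (A [ i ]≔ v) ∎
    where
    step : ∀ c → sum (λ j → v j * term (A [ i ]≔ δ j) c) ≈ term (A [ i ]≔ v) c
    step c = begin
      sum (λ j → v j * term (A [ i ]≔ δ j) c)
        ≈⟨ sum-cong-≋ (λ j → trans (*-congˡ (*-congˡ (product-[]≔ A i (δ j) ⟦ c ⟧)))
             (solve 4 (λ v s d p → v :* (s :* (d :* p)) ⊜ (v :* d) :* (s :* p)) refl
                (v j) s (δ j (⟦ c ⟧ i)) p)) ⟩
      sum (λ j → (v j * δ j (⟦ c ⟧ i)) * (s * p))
        ≈⟨ *-distribʳ-sum (s * p) (λ j → v j * δ j (⟦ c ⟧ i)) ⟨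
      sum (λ j → v j * δ j (⟦ c ⟧ i)) * (s * p)
        ≈⟨ *-congʳ (sum-δ v (⟦ c ⟧ i)) ⟩
      v (⟦ c ⟧ i) * (s * p)
        ≈⟨ solve 3 (λ v s p → v :* (s :* p) ⊜ s :* (v :* p)) refl (v (⟦ c ⟧ i)) s p ⟩
      s * (v (⟦ c ⟧ i) * p)
        ≈⟨ *-congˡ (product-[]≔ A i v ⟦ c ⟧) ⟨
      term (A [ i ]≔ v) c ∎
      where
      s = sgn (isOdd c)
      p = product (λ k → (A [ i ]≔ (λ _ → 1#)) k (⟦ c ⟧ k))

  -- Expanding row i against the cofactors of row k gives the determinant of A with row k
  -- overwritten by row i. For i = k this is det A; otherwise two rows coincide.
  rightInverse : ∀ {n} (A : Matrix K n n) → ¬ det K A ≈ 0# →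
    ∃ λ B → ∀ i k → sum (λ j → A i j * B j k) ≈ δ i k
  rightInverse A det≉0 = (λ j k → cofactor A k j * d) , λ i k → begin
    sum (λ j → A i j * (cofactor A k j * d))
      ≈⟨ sum-cong-≋ (λ j → sym (*-assoc (A i j) (cofactor A k j) d)) ⟩
    sum (λ j → A i j * cofactor A k j * d)
      ≈⟨ *-distribʳ-sum d (λ j → A i j * cofactor A k j) ⟨
    sum (λ j → A i j * cofactor A k j) * d
      ≈⟨ *-congʳ (cofactor-expansion A k (A i)) ⟩
    det K (A [ k ]≔ A i) * d
      ≈⟨ entry i k ⟩
    δ i k ∎
    where
    d = proj₁ (inverse (det K A) det≉0)
    same : ∀ k i j → (A [ k ]≔ A k) i j ≈ A i j
    same k i j with i Fin.≟ k
    ... | yes ≡.refl = refl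
    ... | no _       = refl
    entry : ∀ i k → det K (A [ k ]≔ A i) * d ≈ δ i k
    entry i k with i Fin.≟ k
    ... | yes ≡.refl = trans (*-congʳ (det-cong (same i))) (proj₂ (inverse (det K A) det≉0))
    ... | no i≢k = trans (*-congʳ (det-alternating (A [ k ]≔ A i) i≢k λ j → reflexive
      (≡.trans (cong (λ r → r j) ([]≔-minimal A (A i) i≢k))
               (cong (λ r → r j) (≡.sym ([]≔-updates A k (A i)))))))
      (zeroˡ d)

  rowsIndependent : ∀ {n} (A : Matrix K n n) → ¬ det K A ≈ 0# → RowsIndependent K A
  rowsIndependent {n} A det≉0 x xA≈0 i = begin
    x i
      ≈⟨ sum-δ x i ⟨
    sum (λ k → x k * δ k i)
      ≈⟨ sum-cong-≋ (λ k → *-congˡ (sym (proj₂ B k i))) ⟩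
    sum (λ k → x k * sum (λ j → A k j * proj₁ B j i))
      ≈⟨ sum-cong-≋ (λ k → trans (*-distribˡ-sum (x k) (λ j → A k j * proj₁ B j i))
           (sum-cong-≋ λ j → sym (*-assoc (x k) (A k j) (proj₁ B j i)))) ⟩
    sum (λ k → sum (λ j → x k * A k j * proj₁ B j i))
      ≈⟨ ∑-comm (λ k j → x k * A k j * proj₁ B j i) ⟩
    sum (λ j → sum (λ k → x k * A k j * proj₁ B j i))
      ≈⟨ sum-cong-≋ (λ j → trans (sym (*-distribʳ-sum (proj₁ B j i) (λ k → x k * A k j)))
           (trans (*-congʳ (xA≈0 j)) (zeroˡ _))) ⟩
    sum {n} (λ _ → 0#)
      ≈⟨ sum-replicate-zero n ⟩
    0# ∎
    where B = rightInverse A det≉0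

  fullRank : ∀ {n} (A : Matrix K n n) → ¬ det K A ≈ 0# → FullRank K A
  fullRank A det≉0 =
    rowsIndependent A det≉0 , rowsIndependent (A ᵀ) λ eq → det≉0 (trans (sym (det-ᵀ A)) eq)

-- The ordered plane

module OrderProperties {c ℓ₁ ℓ₂} (K : OrderedField c ℓ₁ ℓ₂) where
  open OrderedField K
  open Plane K
  open OrderedFieldProperties K
  open RingProperties ring using (-0#≈0#; -‿involutive; -‿distribʳ-*)
  open CommutativeRingSolver commutativeRing
  open SetoidReasoning setoid

  ≈ₚ-sym : ∀ {a b} → a ≈ₚ b → b ≈ₚ a
  ≈ₚ-sym (p , q) = sym p , sym q

  ≈ₚ-trans : ∀ {a b d} → a ≈ₚ b → b ≈ₚ d → a ≈ₚ d
  ≈ₚ-trans (p , q) (p′ , q′) = trans p p′ , trans q q′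

  positive-resp : ∀ {x y} → x ≈ y → 0# < x → 0# < y
  positive-resp = <-respʳ

  <⇒0<- : ∀ {x y} → x < y → 0# < y - x
  <⇒0<- {x} {y} x<y = <-respˡ (-‿inverseˡ x) (<-respʳ (+-comm (- x) y) (+-monoʳ-< (- x) x<y))

  0<-⇒< : ∀ {x y} → 0# < y - x → x < y
  0<-⇒< {x} {y} 0<y-x = <-respˡ (+-identityʳ x)
    (<-respʳ (solve 2 (λ x y → x :+ (y :- x) ⊜ y) refl x y) (+-monoʳ-< x 0<y-x))

  0<-x⇒x<0 : ∀ {x} → 0# < - x → x < 0#
  0<-x⇒x<0 0<-x = 0<-⇒< (positive-resp (sym (+-identityˡ _)) 0<-x)

  x<0⇒0<-x : ∀ {x} → x < 0# → 0# < - x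
  x<0⇒0<-x x<0 = positive-resp (+-identityˡ _) (<⇒0<- x<0)

  0<⇒≉0 : ∀ {x} → 0# < x → ¬ x ≈ 0#
  0<⇒≉0 0<x x≈0 = <-irrefl (sym x≈0) 0<x

  positive-asym : ∀ {x} → 0# < x → ¬ 0# < - x
  positive-asym 0<x 0<-x = <-irrefl refl (<-trans 0<x (0<-x⇒x<0 0<-x))

  data Sign (x : Carrier) : Set (c ⊔ ℓ₁ ⊔ ℓ₂) where
    plus  : 0# < x   → Sign x
    null  : x ≈ 0#   → Sign x
    minus : 0# < - x → Sign x

  sign : ∀ x → Sign x
  sign x with compare 0# x
  ... | tri< 0<x _ _ = plus 0<x
  ... | tri≈ _ 0≈x _ = null (sym 0≈x)
  ... | tri> _ _ x<0 = minus (x<0⇒0<-x x<0)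

  +-positive : ∀ {x y} → 0# < x → 0# < y → 0# < x + y
  +-positive {x} 0<x 0<y = <-trans 0<x (<-respˡ (+-identityʳ x) (+-monoʳ-< x 0<y))

  +-positive-≤ : ∀ {x y} → 0# < x → 0# ≤ y → 0# < x + y
  +-positive-≤ 0<x (inj₁ 0<y) = +-positive 0<x 0<y
  +-positive-≤ 0<x (inj₂ 0≈y) = positive-resp (trans (sym (+-identityʳ _)) (+-congˡ 0≈y)) 0<x

  ≤-resp : ∀ {x x′ y y′} → x ≈ x′ → y ≈ y′ → x ≤ y → x′ ≤ y′
  ≤-resp x≈ y≈ (inj₁ x<y) = inj₁ (<-respˡ x≈ (<-respʳ y≈ x<y))
  ≤-resp x≈ y≈ (inj₂ x≈y) = inj₂ (trans (sym x≈) (trans x≈y y≈))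

  +-nonneg : ∀ {x y} → 0# ≤ x → 0# ≤ y → 0# ≤ x + y
  +-nonneg (inj₁ 0<x) 0≤y = inj₁ (+-positive-≤ 0<x 0≤y)
  +-nonneg (inj₂ 0≈x) 0≤y = ≤-resp refl (trans (sym (+-identityˡ _)) (+-congʳ 0≈x)) 0≤y

  *-nonneg : ∀ {x y} → 0# ≤ x → 0# ≤ y → 0# ≤ x * y
  *-nonneg (inj₁ 0<x) (inj₁ 0<y) = inj₁ (*-pos 0<x 0<y)
  *-nonneg (inj₁ 0<x) (inj₂ 0≈y) = inj₂ (trans (sym (zeroʳ _)) (*-congˡ 0≈y))
  *-nonneg (inj₂ 0≈x) 0≤y        = inj₂ (trans (sym (zeroˡ _)) (*-congʳ 0≈x))

  ≤⇒0≤- : ∀ {x y} → x ≤ y → 0# ≤ y - x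
  ≤⇒0≤- (inj₁ x<y) = inj₁ (<⇒0<- x<y)
  ≤⇒0≤- {x} (inj₂ x≈y) = inj₂ (trans (sym (-‿inverseʳ x)) (+-congʳ x≈y))

  0≤-⇒≤ : ∀ {x y} → 0# ≤ y - x → x ≤ y
  0≤-⇒≤ (inj₁ 0<y-x) = inj₁ (0<-⇒< 0<y-x)
  0≤-⇒≤ {x} {y} (inj₂ 0≈y-x) = inj₂ (begin
    x            ≈⟨ +-identityʳ x ⟨
    x + 0#       ≈⟨ +-congˡ 0≈y-x ⟩
    x + (y - x)  ≈⟨ solve 2 (λ x y → x :+ (y :- x) ⊜ y) refl x y ⟩
    y            ∎)

  positive-inverse : ∀ {x} → 0# < x → ∃ λ y → 0# < y × x * y ≈ 1#
  positive-inverse {x} 0<x with inverse x (0<⇒≉0 0<x)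
  ... | y , xy≈1 with sign y
  ...   | plus 0<y   = y , 0<y , xy≈1
  ...   | null y≈0  = contradiction (trans (sym xy≈1) (trans (*-congˡ y≈0) (zeroʳ x))) (0<⇒≉0 0<1)
  ...   | minus 0<-y  = contradiction
    (positive-resp (trans (sym (-‿distribʳ-* x y)) (-‿cong xy≈1)) (*-pos 0<x 0<-y)) (positive-asym 0<1)

  *-cancel-0 : ∀ {x y} → ¬ x ≈ 0# → x * y ≈ 0# → y ≈ 0#
  *-cancel-0 {x} {y} x≉0 xy≈0 with x⁻¹ , eq ← inverse x x≉0 = begin
    y             ≈⟨ *-identityˡ y ⟨
    1# * y        ≈⟨ *-congʳ eq ⟨
    x * x⁻¹ * y   ≈⟨ solve 3 (λ x x⁻¹ y → x :* x⁻¹ :* y ⊜ x⁻¹ :* (x :* y)) refl x x⁻¹ y ⟩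
    x⁻¹ * (x * y) ≈⟨ trans (*-congˡ xy≈0) (zeroʳ x⁻¹) ⟩
    0#            ∎

  positive? : Carrier → Bool
  positive? x = does (0# <? x)

  positive?-true : ∀ {x} → 0# < x → positive? x ≡ true
  positive?-true {x} = dec-true (0# <? x)

  positive?-false : ∀ {x} → ¬ 0# < x → positive? x ≡ false
  positive?-false {x} = dec-false (0# <? x)

  positive?-cong : ∀ {x y} → x ≈ y → positive? x ≡ positive? y
  positive?-cong {x} {y} x≈y =
    does-⇔ (mk⇔ (positive-resp x≈y) (positive-resp (sym x≈y))) (0# <? x) (0# <? y)

  positive?-neg : ∀ {x} → ¬ x ≈ 0# → positive? (- x) ≡ not (positive? x)
  positive?-neg {x} x≉0 with sign x
  ... | plus 0<x  = ≡.trans (positive?-false (positive-asym 0<x)) (cong not (≡.sym (positive?-true 0<x)))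
  ... | null x≈0 = contradiction x≈0 x≉0
  ... | minus 0<-x = ≡.trans (positive?-true 0<-x)
                     (cong not (≡.sym (positive?-false λ 0<x → positive-asym 0<x 0<-x)))

  data SameSign (x y : Carrier) : Set (c ⊔ ℓ₁ ⊔ ℓ₂) where
    both-pos : 0# < x → 0# < y → SameSign x y
    both-neg : 0# < - x → 0# < - y → SameSign x y

  x≈0⇒0≤-x : ∀ {x} → x ≈ 0# → 0# ≤ - x
  x≈0⇒0≤-x x≈0 = inj₂ (trans (sym -0#≈0#) (-‿cong (sym x≈0)))

  sameSign : ∀ {x y} → ¬ (0# ≤ x × 0# ≤ - y) → ¬ (0# ≤ y × 0# ≤ - x) → SameSign x y
  sameSign {x} {y} ¬xy ¬yx with sign x | sign y
  ... | plus 0<x  | plus 0<y  = both-pos 0<x 0<y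
  ... | plus 0<x  | null y≈0 = contradiction (inj₁ 0<x , x≈0⇒0≤-x y≈0) ¬xy
  ... | plus 0<x  | minus 0<-y = contradiction (inj₁ 0<x , inj₁ 0<-y) ¬xy
  ... | null x≈0 | plus 0<y  = contradiction (inj₁ 0<y , x≈0⇒0≤-x x≈0) ¬yx
  ... | null x≈0 | null y≈0 = contradiction (inj₂ (sym x≈0) , x≈0⇒0≤-x y≈0) ¬xy
  ... | null x≈0 | minus 0<-y = contradiction (inj₂ (sym x≈0) , inj₁ 0<-y) ¬xy
  ... | minus 0<-x | plus 0<y  = contradiction (inj₁ 0<y , inj₁ 0<-x) ¬yx
  ... | minus 0<-x | null y≈0 = contradiction (inj₂ (sym y≈0) , inj₁ 0<-x) ¬yx
  ... | minus 0<-x | minus 0<-y = both-neg 0<-x 0<-y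

  SameSign-positive? : ∀ {x y} → SameSign x y → positive? x ≡ positive? y
  SameSign-positive? (both-pos 0<x 0<y) = ≡.trans (positive?-true 0<x) (≡.sym (positive?-true 0<y))
  SameSign-positive? (both-neg 0<-x 0<-y) = ≡.trans (positive?-false λ 0<x → positive-asym 0<x 0<-x)
    (≡.sym (positive?-false λ 0<y → positive-asym 0<y 0<-y))

  SameSign-resp : ∀ {x x′ y y′} → x ≈ x′ → y ≈ y′ → SameSign x y → SameSign x′ y′
  SameSign-resp x≈ y≈ (both-pos p q) = both-pos (positive-resp x≈ p) (positive-resp y≈ q)
  SameSign-resp x≈ y≈ (both-neg p q) = both-neg (positive-resp (-‿cong x≈) p) (positive-resp (-‿cong y≈) q)

  SameSign-neg : ∀ {x y} → SameSign x y → SameSign (- x) (- y)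
  SameSign-neg (both-pos p q) = both-neg (positive-resp (sym (-‿involutive _)) p) (positive-resp (sym (-‿involutive _)) q)
  SameSign-neg (both-neg p q) = both-pos p q

module Sides {c ℓ₁ ℓ₂} (K : OrderedField c ℓ₁ ℓ₂) (𝔩 : Plane.Point K) where
  open OrderedField K
  open Plane K
  open OrderProperties K
  open RingProperties ring using (-0#≈0#; -‿involutive)
  open CommutativeRingSolver commutativeRing
  open SetoidReasoning setoid

  -ₚ_ : Point → Point
  -ₚ (x , y) = - x , - y

  cross-cong : ∀ {a a′ b b′} → a ≈ₚ a′ → b ≈ₚ b′ → cross a b ≈ cross a′ b′
  cross-cong (p , q) (p′ , q′) = +-cong (*-cong p q′) (-‿cong (*-cong q p′))

  cross-anti : ∀ a b → cross b a ≈ - cross a b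
  cross-anti (a , b) (a′ , b′) =
    solve 4 (λ a b a′ b′ → a′ :* b :- b′ :* a ⊜ :- (a :* b′ :- b :* a′)) refl a b a′ b′

  cross-neg : ∀ a b → cross (-ₚ a) (-ₚ b) ≈ cross a b
  cross-neg (a , b) (a′ , b′) =
    solve 4 (λ a b a′ b′ → (:- a) :* (:- b′) :- (:- b) :* (:- a′) ⊜ a :* b′ :- b :* a′) refl a b a′ b′

  proportional : ∀ a b → ¬ a ≈ₚ 0ₚ → cross a b ≈ 0# → ∃ λ r → b ≈ₚ r *ₚ a
  proportional (x , y) (z , w) a≉0 cross≈0 with x ≟ 0#
  ... | no x≉0 with x⁻¹ , eq ← inverse x x≉0 = z * x⁻¹ , (sym (begin
        z * x⁻¹ * x    ≈⟨ solve 3 (λ z x⁻¹ x → z :* x⁻¹ :* x ⊜ z :* (x :* x⁻¹)) refl z x⁻¹ x ⟩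
        z * (x * x⁻¹)  ≈⟨ trans (*-congˡ eq) (*-identityʳ z) ⟩
        z              ∎)) , sym (begin
        z * x⁻¹ * y
          ≈⟨ solve 5 (λ x y z w x⁻¹ → z :* x⁻¹ :* y ⊜ w :* (x :* x⁻¹) :- x⁻¹ :* (x :* w :- y :* z)) refl x y z w x⁻¹ ⟩
        w * (x * x⁻¹) - x⁻¹ * (x * w - y * z)
          ≈⟨ +-cong (trans (*-congˡ eq) (*-identityʳ w)) (-‿cong (trans (*-congˡ cross≈0) (zeroʳ x⁻¹))) ⟩
        w - 0#
          ≈⟨ trans (+-congˡ -0#≈0#) (+-identityʳ w) ⟩
        w ∎)
  ... | yes x≈0 with y ≟ 0#
  ...   | yes y≈0 = contradiction (x≈0 , y≈0) a≉0
  ...   | no y≉0 with y⁻¹ , eq ← inverse y y≉0 = w * y⁻¹ , sym (begin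
        w * y⁻¹ * x
          ≈⟨ solve 5 (λ x y z w y⁻¹ → w :* y⁻¹ :* x ⊜ z :* (y :* y⁻¹) :+ y⁻¹ :* (x :* w :- y :* z)) refl x y z w y⁻¹ ⟩
        z * (y * y⁻¹) + y⁻¹ * (x * w - y * z)
          ≈⟨ +-cong (trans (*-congˡ eq) (*-identityʳ z)) (trans (*-congˡ cross≈0) (zeroʳ y⁻¹)) ⟩
        z + 0#
          ≈⟨ +-identityʳ z ⟩
        z ∎) , (sym (begin
        w * y⁻¹ * y    ≈⟨ solve 3 (λ w y⁻¹ y → w :* y⁻¹ :* y ⊜ w :* (y :* y⁻¹)) refl w y⁻¹ y ⟩
        w * (y * y⁻¹)  ≈⟨ trans (*-congˡ eq) (*-identityʳ w) ⟩
        w              ∎))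

  -- The right-hand side of 𝔩.  Ties are broken lexicographically, so that
  -- secants parallel to 𝔩 also have a side.
  Right : Point → Set (ℓ₁ ⊔ ℓ₂)
  Right a@(x , y) = 0# < cross a 𝔩 ⊎ cross a 𝔩 ≈ 0# × (0# < x ⊎ x ≈ 0# × 0# < y)

  right? : ∀ a → Dec (Right a)
  right? a@(x , y) = (0# <? cross a 𝔩) ⊎-dec
    ((cross a 𝔩 ≟ 0#) ×-dec ((0# <? x) ⊎-dec ((x ≟ 0#) ×-dec (0# <? y))))

  right-resp : ∀ {a b} → a ≈ₚ b → Right a → Right b
  right-resp a≈b (inj₁ p) = inj₁ (positive-resp (cross-cong a≈b (refl , refl)) p)
  right-resp a≈b@(x≈ , y≈) (inj₂ (p , q)) =
    inj₂ (trans (cross-cong (≈ₚ-sym a≈b) (refl , refl)) p , case q)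
    where
    case : _ → _
    case (inj₁ 0<x) = inj₁ (positive-resp x≈ 0<x)
    case (inj₂ (x≈0 , 0<y)) = inj₂ (trans (sym x≈) x≈0 , positive-resp y≈ 0<y)

  private
    cross-+ : ∀ a b → cross (a +ₚ b) 𝔩 ≈ cross a 𝔩 + cross b 𝔩
    cross-+ (a , b) (a′ , b′) = solve 6 (λ a b a′ b′ l m →
      (a :+ a′) :* m :- (b :+ b′) :* l ⊜ (a :* m :- b :* l) :+ (a′ :* m :- b′ :* l)) refl
      a b a′ b′ (proj₁ 𝔩) (proj₂ 𝔩)

    cross-*ˡ : ∀ t a b → cross (t *ₚ a) b ≈ t * cross a b
    cross-*ˡ t (a , b) (a′ , b′) = solve 5 (λ t a b a′ b′ →
      t :* a :* b′ :- t :* b :* a′ ⊜ t :* (a :* b′ :- b :* a′)) refl t a b a′ b′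

    cross--ˡ : ∀ a b → cross (-ₚ a) b ≈ - cross a b
    cross--ˡ (a , b) (a′ , b′) = solve 4 (λ a b a′ b′ →
      (:- a) :* b′ :- (:- b) :* a′ ⊜ :- (a :* b′ :- b :* a′)) refl a b a′ b′

    pos+null : ∀ {x y} → 0# < x → y ≈ 0# → 0# < x + y
    pos+null 0<x y≈0 = +-positive-≤ 0<x (inj₂ (sym y≈0))

    null+pos : ∀ {x y} → x ≈ 0# → 0# < y → 0# < x + y
    null+pos x≈0 0<y = positive-resp (+-comm _ _) (pos+null 0<y x≈0)

    null+null : ∀ {x y} → x ≈ 0# → y ≈ 0# → x + y ≈ 0#
    null+null x≈0 y≈0 = trans (+-cong x≈0 y≈0) (+-identityʳ 0#)

  -- `Right` is the positive cone of a linear order on the plane compatible with addition: vectors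
  -- are compared lexicographically by `cross _ 𝔩` and the two coordinates.
  right-+ : ∀ {a b} → Right a → Right b → Right (a +ₚ b)
  right-+ {a} {b} p q = combine p q
    where
    combine : Right a → Right b → Right (a +ₚ b)
    combine (inj₁ p) (inj₁ q)       = inj₁ (positive-resp (sym (cross-+ a b)) (+-positive p q))
    combine (inj₁ p) (inj₂ (q , _)) = inj₁ (positive-resp (sym (cross-+ a b)) (pos+null p q))
    combine (inj₂ (p , _)) (inj₁ q) = inj₁ (positive-resp (sym (cross-+ a b)) (null+pos p q))
    combine (inj₂ (p , p′)) (inj₂ (q , q′)) = inj₂ (trans (cross-+ a b) (null+null p q) , ties p′ q′)
      where
      ties : _ → _ → _
      ties (inj₁ p) (inj₁ q)              = inj₁ (+-positive p q)
      ties (inj₁ p) (inj₂ (q , _))        = inj₁ (pos+null p q)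
      ties (inj₂ (p , _)) (inj₁ q)        = inj₁ (null+pos p q)
      ties (inj₂ (p , p′)) (inj₂ (q , q′)) = inj₂ (null+null p q , +-positive p′ q′)

  right-* : ∀ {t a} → 0# < t → Right a → Right (t *ₚ a)
  right-* {t} {a} 0<t (inj₁ p) = inj₁ (positive-resp (sym (cross-*ˡ t a 𝔩)) (*-pos 0<t p))
  right-* {t} {a} 0<t (inj₂ (p , q)) = inj₂ (trans (cross-*ˡ t a 𝔩) (trans (*-congˡ p) (zeroʳ t)) , tie q)
    where
    tie : _ → _
    tie (inj₁ p)       = inj₁ (*-pos 0<t p)
    tie (inj₂ (p , q)) = inj₂ (trans (*-congˡ p) (zeroʳ t) , *-pos 0<t q)

  right-nonzero : ∀ {a} → Right a → ¬ a ≈ₚ 0ₚ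
  right-nonzero {a} (inj₁ p) (x≈0 , y≈0) = 0<⇒≉0 p (trans (+-cong (trans (*-congʳ x≈0) (zeroˡ _))
    (trans (-‿cong (trans (*-congʳ y≈0) (zeroˡ _))) -0#≈0#)) (+-identityʳ 0#))
  right-nonzero (inj₂ (_ , inj₁ p)) (x≈0 , y≈0) = 0<⇒≉0 p x≈0
  right-nonzero (inj₂ (_ , inj₂ (_ , p))) (x≈0 , y≈0) = 0<⇒≉0 p y≈0

  right-asym : ∀ {a} → Right a → ¬ Right (-ₚ a)
  right-asym {x , y} p q = right-nonzero (right-+ p q) (-‿inverseʳ x , -‿inverseʳ y)

  right-total : ∀ {a} → ¬ a ≈ₚ 0ₚ → Right a ⊎ Right (-ₚ a)
  right-total {a@(x , y)} a≉0 with sign (cross a 𝔩)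
  ... | plus p = inj₁ (inj₁ p)
  ... | minus p = inj₂ (inj₁ (positive-resp (sym (cross--ˡ a 𝔩)) p))
  ... | null p with sign x
  ...   | plus q = inj₁ (inj₂ (p , inj₁ q))
  ...   | minus q = inj₂ (inj₂ (trans (cross--ˡ a 𝔩) (trans (-‿cong p) -0#≈0#) , inj₁ q))
  ...   | null q with sign y
  ...     | plus r = inj₁ (inj₂ (p , inj₂ (q , r)))
  ...     | minus r = inj₂ (inj₂ (trans (cross--ˡ a 𝔩) (trans (-‿cong p) -0#≈0#) , inj₂ (trans (-‿cong q) -0#≈0# , r)))
  ...     | null r = contradiction (q , r) a≉0

  side : Point → Bool
  side a = does (right? a)

  Side : Bool → Point → Set (ℓ₁ ⊔ ℓ₂)
  Side true  a = Right a
  Side false a = Right (-ₚ a)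

  side-Side : ∀ {a} → ¬ a ≈ₚ 0ₚ → Side (side a) a
  side-Side {a} a≉0 = decided (right? a)
    where
    decided : (d : Dec (Right a)) → Side (does d) a
    decided (yes p) = p
    decided (no ¬p) with right-total a≉0
    ... | inj₁ p = contradiction p ¬p
    ... | inj₂ p = p

  Side-side : ∀ {a} σ → Side σ a → side a ≡ σ
  Side-side {a} true  p = dec-true (right? a) p
  Side-side {a} false p = dec-false (right? a) λ q → right-asym q p

  -ₚ-involutive : ∀ a → -ₚ (-ₚ a) ≈ₚ a
  -ₚ-involutive (x , y) = -‿involutive x , -‿involutive y

  Side-neg : ∀ {a} σ → Side σ a → Side (not σ) (-ₚ a)
  Side-neg true  p = right-resp (≈ₚ-sym (-ₚ-involutive _)) p
  Side-neg false p = p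

  side-neg : ∀ {a} → ¬ a ≈ₚ 0ₚ → side (-ₚ a) ≡ not (side a)
  side-neg {a} a≉0 = Side-side (not (side a)) (Side-neg (side a) (side-Side a≉0))

  side-cong : ∀ {a b} → a ≈ₚ b → side a ≡ side b
  side-cong {a} {b} a≈b = does-⇔ (mk⇔ (right-resp a≈b) (right-resp (≈ₚ-sym a≈b))) (right? a) (right? b)

  -- The vector b is a multiple of a, and lying on opposite sides forces a negative factor.
  antiparallel : ∀ {a b} → Right a → Right (-ₚ b) → cross a b ≈ 0# →
    ∃ λ μ → 0# < μ × b +ₚ μ *ₚ a ≈ₚ 0ₚ
  antiparallel {a@(x , y)} {b} p q cross≈0
    with r , b≈ra@(eq , eq′) ← proportional a b (right-nonzero p) cross≈0 | sign r
  ... | plus 0<r = contradiction q (right-asym (right-resp (≈ₚ-sym b≈ra) (right-* 0<r p)))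
  ... | null r≈0 = contradiction (vanish eq , vanish eq′) (right-nonzero q)
    where
    vanish : ∀ {z w} → z ≈ r * w → - z ≈ 0#
    vanish eq = trans (-‿cong (trans eq (trans (*-congʳ r≈0) (zeroˡ _)))) -0#≈0#
  ... | minus 0<-r = - r , 0<-r , vanish eq , vanish eq′
    where
    vanish : ∀ {z w} → z ≈ r * w → z + - r * w ≈ 0#
    vanish {z} {w} eq = trans (+-congʳ eq) (trans (solve 2 (λ r w → r :* w :+ (:- r) :* w ⊜ r :* w :- r :* w) refl r w) (-‿inverseʳ _))

  -- Only a positive sum of the coefficients is required, not the sum 1. By scaling this amounts to
  -- the same, and a combination found in a proof need not be normalised.
  Avoids₂ : Point → Point → Set (c ⊔ ℓ₁ ⊔ ℓ₂)
  Avoids₂ a b = ∀ α β → 0# ≤ α → 0# ≤ β → 0# < α + β → ¬ α *ₚ a +ₚ β *ₚ b ≈ₚ 0ₚ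

  -- 0 is not in the convex hull of a, b and d.
  Avoids₃ : Point → Point → Point → Set (c ⊔ ℓ₁ ⊔ ℓ₂)
  Avoids₃ a b d = ∀ α β γ → 0# ≤ α → 0# ≤ β → 0# ≤ γ → 0# < α + β + γ →
    ¬ α *ₚ a +ₚ β *ₚ b +ₚ γ *ₚ d ≈ₚ 0ₚ

-- Rotations past the gauge direction

module Turning {c ℓ₁ ℓ₂} (K : OrderedField c ℓ₁ ℓ₂) (𝔩 : Plane.Point K) where
  open OrderedField K
  open Plane K
  open OrderProperties K
  open Sides K 𝔩
  open RingProperties ring using (-0#≈0#; -‿involutive; -‿distribʳ-*; x[y-z]≈xy-xz)
  open CommutativeRingSolver commutativeRing
  open SetoidReasoning setoid

  0≤0 : 0# ≤ 0#
  0≤0 = inj₂ refl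

  0≤1 : 0# ≤ 1#
  0≤1 = inj₁ 0<1

  avoids-swap₁₂ : ∀ {a b d} → Avoids₃ a b d → Avoids₃ b a d
  avoids-swap₁₂ av α β γ 0≤α 0≤β 0≤γ 0<sum (eq , eq′) = av β α γ 0≤β 0≤α 0≤γ
    (positive-resp (+-congʳ (+-comm α β)) 0<sum)
    (trans (+-congʳ (+-comm _ _)) eq , trans (+-congʳ (+-comm _ _)) eq′)

  avoids-swap₂₃ : ∀ {a b d} → Avoids₃ a b d → Avoids₃ a d b
  avoids-swap₂₃ av α β γ 0≤α 0≤β 0≤γ 0<sum (eq , eq′) = av α γ β 0≤α 0≤γ 0≤β
    (positive-resp (swap α β γ) 0<sum) (trans (swap _ _ _) eq , trans (swap _ _ _) eq′)
    where
    swap : ∀ x y z → x + y + z ≈ x + z + y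
    swap = solve 3 (λ x y z → x :+ y :+ z ⊜ x :+ z :+ y) refl

  avoids-neg : ∀ {a b d} → Avoids₃ a b d → Avoids₃ (-ₚ a) (-ₚ b) (-ₚ d)
  avoids-neg av α β γ 0≤α 0≤β 0≤γ 0<sum (eq , eq′) = av α β γ 0≤α 0≤β 0≤γ 0<sum
    (negate eq , negate eq′)
    where
    negate : ∀ {x y z} → α * - x + β * - y + γ * - z ≈ 0# → α * x + β * y + γ * z ≈ 0#
    negate {x} {y} {z} eq = trans (sym (-‿involutive _)) (trans (-‿cong (trans
      (solve 3 (λ x y z → :- (x :+ y :+ z) ⊜ (:- x) :+ (:- y) :+ (:- z)) refl (α * x) (β * y) (γ * z))
      (trans (+-cong (+-cong (-‿distribʳ-* α x) (-‿distribʳ-* β y)) (-‿distribʳ-* γ z)) eq))) -0#≈0#)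

  avoids-nonzero : ∀ {a b d} → Avoids₃ a b d → ¬ a ≈ₚ 0ₚ
  avoids-nonzero av (x≈0 , y≈0) = av 1# 0# 0# 0≤1 0≤0 0≤0
    (positive-resp (sym (trans (+-identityʳ _) (+-identityʳ 1#))) 0<1) (vanish x≈0 , vanish y≈0)
    where
    vanish : ∀ {x y z} → x ≈ 0# → 1# * x + 0# * y + 0# * z ≈ 0#
    vanish x≈0 = trans (+-cong (+-cong (trans (*-identityˡ _) x≈0) (zeroˡ _)) (zeroˡ _))
      (trans (+-identityʳ _) (+-identityʳ _))

  -- With these coefficients the components of a and b transverse to d cancel.
  combination-parallel : ∀ a b d → cross ((- cross b d) *ₚ a +ₚ cross a d *ₚ b) d ≈ 0#
  combination-parallel a b d = trans (cross-linear (- cross b d) (cross a d) a b d)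
    (trans (solve 2 (λ x y → (:- y) :* x :+ x :* y ⊜ x :* y :- x :* y) refl (cross a d) (cross b d))
      (-‿inverseʳ _))
    where
    cross-linear : ∀ s t a b d → cross (s *ₚ a +ₚ t *ₚ b) d ≈ s * cross a d + t * cross b d
    cross-linear s t (a₁ , a₂) (b₁ , b₂) (d₁ , d₂) = begin
      (s * a₁ + t * b₁) * d₂ - (s * a₂ + t * b₂) * d₁
        ≈⟨ +-cong (distribute a₁ b₁ d₂) (-‿cong (distribute a₂ b₂ d₁)) ⟩
      (s * (a₁ * d₂) + t * (b₁ * d₂)) - (s * (a₂ * d₁) + t * (b₂ * d₁))
        ≈⟨ solve 4 (λ p q p′ q′ → (p :+ q) :- (p′ :+ q′) ⊜ (p :- p′) :+ (q :- q′)) refl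
             (s * (a₁ * d₂)) (t * (b₁ * d₂)) (s * (a₂ * d₁)) (t * (b₂ * d₁)) ⟩
      (s * (a₁ * d₂) - s * (a₂ * d₁)) + (t * (b₁ * d₂) - t * (b₂ * d₁))
        ≈⟨ +-cong (x[y-z]≈xy-xz s _ _) (x[y-z]≈xy-xz t _ _) ⟨
      s * (a₁ * d₂ - a₂ * d₁) + t * (b₁ * d₂ - b₂ * d₁) ∎
      where
      distribute : ∀ a b d → (s * a + t * b) * d ≈ s * (a * d) + t * (b * d)
      distribute a b d = trans (distribʳ d (s * a) (t * b)) (+-cong (*-assoc s a d) (*-assoc t b d))

  -- If the line of d weakly separated a from b, a nonnegative combination of them would lie on that
  -- line. Being on the right while d is on the left, it would be a negative multiple of d, and 0
  -- would be in the convex hull.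
  ¬straddle : ∀ {a b d} → Right a → Right b → Right (-ₚ d) → Avoids₃ a b d →
    ¬ (0# ≤ cross a d × 0# ≤ - cross b d)
  ¬straddle {a} {b} {d} ra rb rd av (inj₂ 0≈x , _) =
    let μ , 0<μ , eq , eq′ = antiparallel ra rd (sym 0≈x) in
    av μ 0# 1# (inj₁ 0<μ) 0≤0 0≤1 (+-positive (positive-resp (sym (+-identityʳ μ)) 0<μ) 0<1)
      (rearrange eq , rearrange eq′)
    where
    rearrange : ∀ {μ x y z} → z + μ * x ≈ 0# → μ * x + 0# * y + 1# * z ≈ 0#
    rearrange eq = trans (+-cong (trans (+-congˡ (zeroˡ _)) (+-identityʳ _)) (*-identityˡ _))
      (trans (+-comm _ _) eq)
  ¬straddle {a} {b} {d} ra rb rd av (inj₁ _ , inj₂ 0≈-y) =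
    let μ , 0<μ , eq , eq′ = antiparallel rb rd (trans (sym (-‿involutive _)) (trans (-‿cong (sym 0≈-y)) -0#≈0#)) in
    av 0# μ 1# 0≤0 (inj₁ 0<μ) 0≤1 (+-positive (positive-resp (sym (+-identityˡ μ)) 0<μ) 0<1)
      (rearrange eq , rearrange eq′)
    where
    rearrange : ∀ {μ x y z} → z + μ * y ≈ 0# → 0# * x + μ * y + 1# * z ≈ 0#
    rearrange eq = trans (+-cong (trans (+-congʳ (zeroˡ _)) (+-identityˡ _)) (*-identityˡ _))
      (trans (+-comm _ _) eq)
  ¬straddle {a} {b} {d} ra rb rd av (inj₁ 0<x , inj₁ 0<-y) =
    let μ , 0<μ , eq , eq′ = antiparallel (right-+ (right-* 0<-y ra) (right-* 0<x rb)) rd (combination-parallel a b d) in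
    av (μ * - cross b d) (μ * cross a d) 1# (inj₁ (*-pos 0<μ 0<-y)) (inj₁ (*-pos 0<μ 0<x)) 0≤1
      (+-positive (+-positive (*-pos 0<μ 0<-y) (*-pos 0<μ 0<x)) 0<1)
      (rearrange eq , rearrange eq′)
    where
    rearrange : ∀ {μ p q x y z} → z + μ * (p * x + q * y) ≈ 0# → μ * p * x + μ * q * y + 1# * z ≈ 0#
    rearrange {μ} {p} {q} {x} {y} {z} eq = trans
      (+-cong (+-cong (*-assoc μ p x) (*-assoc μ q y)) (*-identityˡ z))
      (trans (+-congʳ (sym (distribˡ μ (p * x) (q * y)))) (trans (+-comm _ z) eq))

  -- `¬straddle`, applied to a and b in both orders, leaves only equal nonzero signs. The left side
  -- reduces to the right one by negating all three vectors.
  opposite-sameSign : ∀ σ {a b d} → Side σ a → Side σ b → Side (not σ) d → Avoids₃ a b d →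
    SameSign (cross a d) (cross b d)
  opposite-sameSign true  sa sb sd av =
    sameSign (¬straddle sa sb sd av) (¬straddle sb sa sd (avoids-swap₁₂ av))
  opposite-sameSign false {a} {b} {d} sa sb sd av = SameSign-resp (cross-neg a d) (cross-neg b d)
    (opposite-sameSign true sa sb (Side-neg true sd) (avoids-neg av))

  -- A rotation from one side to the other passes either `𝔩` or its opposite, and the cross product
  -- tells which: from right to left it passes `𝔩` when it is counterclockwise, from left to right
  -- when it is clockwise.
  turn : Bool → Bool → Carrier → Carrier → Bool
  turn true  false x y = positive? x
  turn false true  x y = positive? y
  turn _     _     x y = false

  -- Does the shortest rotation from a to b pass through the direction 𝔩?
  χ : Point → Point → Bool
  χ a b = turn (side a) (side b) (cross a b) (cross b a)

  turn-cong : ∀ σ σ′ {x x′ y y′} → x ≈ x′ → y ≈ y′ → turn σ σ′ x y ≡ turn σ σ′ x′ y′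
  turn-cong true  true  x≈ y≈ = ≡.refl
  turn-cong true  false x≈ y≈ = positive?-cong x≈
  turn-cong false true  x≈ y≈ = positive?-cong y≈
  turn-cong false false x≈ y≈ = ≡.refl

  χ-cong : ∀ {a a′ b b′} → a ≈ₚ a′ → b ≈ₚ b′ → χ a b ≡ χ a′ b′
  χ-cong {a} {a′} {b} {b′} a≈ b≈ = ≡.trans
    (cong₂ (λ σ σ′ → turn σ σ′ (cross a b) (cross b a)) (side-cong a≈) (side-cong b≈))
    (turn-cong (side a′) (side b′) (cross-cong a≈ b≈) (cross-cong b≈ a≈))

  flip-sign : ∀ a b a′ b′ → SameSign (cross a b) (cross a′ b′) → positive? (cross b a) ≡ positive? (cross b′ a′)
  flip-sign a b a′ b′ same = SameSign-positive?
    (SameSign-resp (sym (cross-anti a b)) (sym (cross-anti a′ b′)) (SameSign-neg same))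

  -- The hypothesis puts the three vectors into an open half-plane, where short rotations compose.
  -- If they are not all on one side of `𝔩`, exactly one of them is alone on its side, and by
  -- `opposite-sameSign` its rotations to the other two have the same sense.
  χ-split : ∀ {a b d} → Avoids₃ a b d → χ a d ≡ χ a b xor χ b d
  χ-split {a} {b} {d} av = cases (side a) (side b) (side d)
    (side-Side (avoids-nonzero av)) (side-Side (avoids-nonzero (avoids-swap₁₂ av)))
    (side-Side (avoids-nonzero (avoids-swap₁₂ (avoids-swap₂₃ av))))
    where
    av-bda : Avoids₃ b d a
    av-bda = avoids-swap₂₃ (avoids-swap₁₂ av)
    cases : ∀ σ₁ σ₂ σ₃ → Side σ₁ a → Side σ₂ b → Side σ₃ d →
      turn σ₁ σ₃ (cross a d) (cross d a) ≡
      turn σ₁ σ₂ (cross a b) (cross b a) xor turn σ₂ σ₃ (cross b d) (cross d b)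
    cases true  true  true  sa sb sd = ≡.refl
    cases false false false sa sb sd = ≡.refl
    cases true  true  false sa sb sd = SameSign-positive? (opposite-sameSign true sa sb sd av)
    cases false false true  sa sb sd = flip-sign a d b d (opposite-sameSign false sa sb sd av)
    cases true  false true  sa sb sd = ≡.sym (≡.trans
      (cong (_xor positive? (cross d b)) (SameSign-positive?
        (opposite-sameSign true sa sd sb (avoids-swap₂₃ av))))
      (Bool.xor-same (positive? (cross d b))))
    cases false true  false sa sb sd = ≡.sym (≡.trans
      (cong (_xor positive? (cross b d)) (flip-sign a b d b
        (opposite-sameSign false sa sd sb (avoids-swap₂₃ av))))
      (Bool.xor-same (positive? (cross b d))))
    cases true  false false sa sb sd = ≡.trans
      (flip-sign d a b a (opposite-sameSign false sd sb sa (avoids-swap₁₂ av-bda)))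
      (≡.sym (Bool.xor-identityʳ _))
    cases false true  true  sa sb sd = ≡.trans
      (SameSign-positive? (opposite-sameSign true sd sb sa (avoids-swap₁₂ av-bda)))
      (≡.sym (Bool.xor-identityʳ _))

  avoids₂-nonzero : ∀ {a b} → Avoids₂ a b → ¬ a ≈ₚ 0ₚ
  avoids₂-nonzero av (x≈0 , y≈0) = av 1# 0# 0≤1 0≤0 (positive-resp (sym (+-identityʳ 1#)) 0<1)
    (vanish x≈0 , vanish y≈0)
    where
    vanish : ∀ {x y} → x ≈ 0# → 1# * x + 0# * y ≈ 0#
    vanish x≈0 = trans (+-cong (trans (*-identityˡ _) x≈0) (zeroˡ _)) (+-identityʳ _)

  avoids₂-swap : ∀ {a b} → Avoids₂ a b → Avoids₂ b a
  avoids₂-swap av α β 0≤α 0≤β 0<sum (eq , eq′) = av β α 0≤β 0≤α (positive-resp (+-comm α β) 0<sum)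
    (trans (+-comm _ _) eq , trans (+-comm _ _) eq′)

  -- Passing `𝔩` on the way from -a to -b means passing its opposite on the way from a to b. Both
  -- bits together thus count the crossings of the whole line, of which there is one exactly when
  -- the sides differ.
  χ-neg : ∀ {a b} → Avoids₂ a b → χ a b xor χ (-ₚ a) (-ₚ b) ≡ side a xor side b
  χ-neg {a} {b} av = ≡.trans
    (cong (χ a b xor_) (cong₂ (λ σ σ′ → turn σ σ′ (cross (-ₚ a) (-ₚ b)) (cross (-ₚ b) (-ₚ a)))
      (side-neg a≉0) (side-neg b≉0)))
    (cases (side a) (side b) (side-Side a≉0) (side-Side b≉0))
    where
    a≉0 = avoids₂-nonzero av
    b≉0 = avoids₂-nonzero (avoids₂-swap av)
    not-parallel : ∀ {a b} → Avoids₂ a b → Right a → Right (-ₚ b) → ¬ cross a b ≈ 0#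
    not-parallel av ra rb eq =
      let μ , 0<μ , eq₁ , eq₂ = antiparallel ra rb eq in
      av μ 1# (inj₁ 0<μ) 0≤1 (+-positive 0<μ 0<1) (rearrange eq₁ , rearrange eq₂)
      where
      rearrange : ∀ {μ x y} → y + μ * x ≈ 0# → μ * x + 1# * y ≈ 0#
      rearrange eq = trans (+-congˡ (*-identityˡ _)) (trans (+-comm _ _) eq)
    exactly-one : ∀ a b → ¬ cross a b ≈ 0# →
      positive? (cross a b) xor positive? (cross (-ₚ b) (-ₚ a)) ≡ true
    exactly-one a b ab≉0 = ≡.trans
      (cong (positive? (cross a b) xor_) (≡.trans
        (positive?-cong (trans (cross-neg b a) (cross-anti a b))) (positive?-neg ab≉0)))
      (Bool.xor-inverseʳ (positive? (cross a b)))
    cases : ∀ σ σ′ → Side σ a → Side σ′ b →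
      turn σ σ′ (cross a b) (cross b a) xor
      turn (not σ) (not σ′) (cross (-ₚ a) (-ₚ b)) (cross (-ₚ b) (-ₚ a)) ≡ σ xor σ′
    cases true  true  sa sb = ≡.refl
    cases false false sa sb = ≡.refl
    cases true  false sa sb = exactly-one a b (not-parallel av sa sb)
    cases false true  sa sb = exactly-one b a (not-parallel (avoids₂-swap av) sb sa)

-- Winding numbers modulo 2

odd-⊖ : ∀ m n → odd ∣ m ⊖ n ∣ ≡ odd m xor odd n
odd-⊖ m       zero    = ≡.sym (Bool.xor-identityʳ (odd m))
odd-⊖ zero    (suc n) = ≡.refl
odd-⊖ (suc m) (suc n) = ≡.trans (cong (odd ∘ ∣_∣) (ℤ.[1+m]⊖[1+n]≡m⊖n m n))
  (≡.trans (odd-⊖ m n) (≡.sym (Bool.xor-annihilates-not (odd m) (odd n))))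

odd-+ : ∀ m n → odd (m ℕ.+ n) ≡ odd m xor odd n
odd-+ zero    n = ≡.refl
odd-+ (suc m) n = ≡.trans (cong not (odd-+ m n)) (≡.sym (Bool.xor-assoc true (odd m) (odd n)))

odd-+ℤ : ∀ m z → odd ∣ + m ℤ.+ z ∣ ≡ odd m xor odd ∣ z ∣
odd-+ℤ m (+ n)    = odd-+ m n
odd-+ℤ m -[1+ n ] = odd-⊖ m (suc n)

module _ {c ℓ₁ ℓ₂ d} {K : OrderedField c ℓ₁ ℓ₂} {G : PlabicGraph K d} (𝔤 : GaugeDirection G) where
  open OrderedField K
  open Plane K
  open PlabicGraph G
  open GaugeDirection 𝔤
  open OrderProperties K
  open Sides K 𝔩
  open Turning K 𝔩
  open RingProperties ring using (-0#≈0#; -‿involutive)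
  open CommutativeRingSolver commutativeRing
  open SetoidReasoning setoid

  data Orientation (a b : Point) : ℤ → Set (c ⊔ ℓ₁ ⊔ ℓ₂) where
    ccw  : 0# < cross a b   → Orientation a b 1ℤ
    flat : cross a b ≈ 0#   → Orientation a b 0ℤ
    cw   : 0# < - cross a b → Orientation a b -1ℤ

  orient : ∀ a b → Orientation a b (orientation a b)
  orient a b with compare 0# (cross a b)
  ... | tri< p _ _ = ccw p
  ... | tri≈ _ p _ = flat (sym p)
  ... | tri> _ _ p = cw (x<0⇒0<-x p)

  private
    wind-value : ℤ → ℤ → ℤ → ℤ
    wind-value (+ 1)    (+ 1)    (+ 1)    = 1ℤ
    wind-value -[1+ 0 ] -[1+ 0 ] -[1+ 0 ] = -1ℤ
    wind-value _        _        _        = 0ℤ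

  wind≡ : ∀ e f → wind e f ≡ wind-value (orientation (direction e) (direction f))
                               (orientation (direction e) 𝔩) (orientation 𝔩 (direction f))
  wind≡ e f with orientation (direction e) (direction f) | orientation (direction e) 𝔩
               | orientation 𝔩 (direction f)
  ... | + 0             | _               | _               = ≡.refl
  ... | + (suc (suc _)) | _               | _               = ≡.refl
  ... | -[1+ suc _ ]    | _               | _               = ≡.refl
  ... | + 1             | + 0             | _               = ≡.refl
  ... | + 1             | + (suc (suc _)) | _               = ≡.refl
  ... | + 1             | -[1+ _ ]        | _               = ≡.refl
  ... | + 1             | + 1             | + 0             = ≡.refl
  ... | + 1             | + 1             | + 1             = ≡.refl
  ... | + 1             | + 1             | + (suc (suc _)) = ≡.refl
  ... | + 1             | + 1             | -[1+ _ ]        = ≡.refl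
  ... | -[1+ 0 ]        | + _             | _               = ≡.refl
  ... | -[1+ 0 ]        | -[1+ suc _ ]    | _               = ≡.refl
  ... | -[1+ 0 ]        | -[1+ 0 ]        | + _             = ≡.refl
  ... | -[1+ 0 ]        | -[1+ 0 ]        | -[1+ suc _ ]    = ≡.refl
  ... | -[1+ 0 ]        | -[1+ 0 ]        | -[1+ 0 ]        = ≡.refl

  -- No edge is parallel to `𝔩`, so the tie-breaking in `Right` never concerns edges, and the three
  -- signs in `wind` decide `χ`.
  odd-wind : ∀ e f → odd ∣ wind e f ∣ ≡ χ (direction e) (direction f)
  odd-wind e f = ≡.trans (cong (odd ∘ ∣_∣) (wind≡ e f)) (case (orient a b) (orient a 𝔩) (orient 𝔩 b))
    where
    a = direction e
    b = direction f

    turning : ∀ σ σ′ → Side σ a → Side σ′ b → turn σ σ′ (cross a b) (cross b a) ≡ χ a b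
    turning σ σ′ sa sb = cong₂ (λ σ σ′ → turn σ σ′ (cross a b) (cross b a))
      (≡.sym (Side-side σ sa)) (≡.sym (Side-side σ′ sb))

    left-of-𝔩 : ∀ d → 0# < cross 𝔩 d → Side false d
    left-of-𝔩 d p = inj₁ (positive-resp (begin
      cross 𝔩 d              ≈⟨ cross-neg 𝔩 d ⟨
      cross (-ₚ 𝔩) (-ₚ d)    ≈⟨ cross-anti (-ₚ d) (-ₚ 𝔩) ⟩
      - cross (-ₚ d) (-ₚ 𝔩)  ≈⟨ -‿cong (cross-neg d 𝔩) ⟩
      - cross d 𝔩            ≈⟨ solve 4 (λ x y l m → :- (x :* m :- y :* l) ⊜ (:- x) :* m :- (:- y) :* l)
                                  refl (proj₁ d) (proj₂ d) (proj₁ 𝔩) (proj₂ 𝔩) ⟩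
      cross (-ₚ d) 𝔩         ∎) p)

    right-of-𝔩 : ∀ d → 0# < - cross 𝔩 d → Side true d
    right-of-𝔩 d p = inj₁ (positive-resp (sym (cross-anti 𝔩 d)) p)

    ahead : 0# < cross a 𝔩 → Side true a
    ahead = inj₁

    behind : 0# < - cross a 𝔩 → Side false a
    behind p = left-of-𝔩 a (positive-resp (sym (cross-anti a 𝔩)) p)

    ≯ : ∀ {x} → 0# < - x → ¬ 0# < x
    ≯ p q = positive-asym q p

    null≯ : ∀ {x} → x ≈ 0# → ¬ 0# < x
    null≯ p q = 0<⇒≉0 q p

    through : ∀ {x} → Side true a → Side false b → x ≡ positive? (cross a b) → x ≡ χ a b
    through sa sb eq = ≡.trans eq (turning true false sa sb)

    back : ∀ {x} → Side false a → Side true b → x ≡ positive? (cross b a) → x ≡ χ a b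
    back sa sb eq = ≡.trans eq (turning false true sa sb)

    case : ∀ {o₁ o₂ o₃} → Orientation a b o₁ → Orientation a 𝔩 o₂ → Orientation 𝔩 b o₃ →
      odd ∣ wind-value o₁ o₂ o₃ ∣ ≡ χ a b
    case _ (flat p) _ = contradiction (trans (cross-anti a 𝔩) (trans (-‿cong p) -0#≈0#)) (not-parallel e)
    case _ _ (flat p) = contradiction p (not-parallel f)
    case (ccw r) (ccw p) (ccw q) = through (ahead p) (left-of-𝔩 b q) (≡.sym (positive?-true r))
    case (flat r) (ccw p) (ccw q) = through (ahead p) (left-of-𝔩 b q) (≡.sym (positive?-false (null≯ r)))
    case (cw r) (ccw p) (ccw q) = through (ahead p) (left-of-𝔩 b q) (≡.sym (positive?-false (≯ r)))
    case (ccw r) (cw p) (cw q) = back (behind p) (right-of-𝔩 b q) (≡.sym (positive?-false (≯ (positive-resp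
      (sym (trans (-‿cong (cross-anti a b)) (-‿involutive _))) r))))
    case (flat r) (cw p) (cw q) = back (behind p) (right-of-𝔩 b q) (≡.sym (positive?-false (null≯
      (trans (cross-anti a b) (trans (-‿cong r) -0#≈0#)))))
    case (cw r) (cw p) (cw q) = back (behind p) (right-of-𝔩 b q)
      (≡.sym (positive?-true (positive-resp (sym (cross-anti a b)) r)))
    case (ccw _) (ccw p) (cw q) = turning true true (ahead p) (right-of-𝔩 b q)
    case (flat _) (ccw p) (cw q) = turning true true (ahead p) (right-of-𝔩 b q)
    case (cw _) (ccw p) (cw q) = turning true true (ahead p) (right-of-𝔩 b q)
    case (ccw _) (cw p) (ccw q) = turning false false (behind p) (left-of-𝔩 b q)
    case (flat _) (cw p) (ccw q) = turning false false (behind p) (left-of-𝔩 b q)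
    case (cw _) (cw p) (ccw q) = turning false false (behind p) (left-of-𝔩 b q)

-- Intersections with the gauge rays

module Interiors {c ℓ₁ ℓ₂} (K : OrderedField c ℓ₁ ℓ₂) where
  open OrderedField K
  open Plane K
  open OrderedFieldProperties K
  open OrderProperties K
  open CommutativeRingSolver commutativeRing
  open SetoidReasoning setoid

  minimum : ∀ {x y} → 0# < x → 0# < y → ∃ λ z → 0# < z × z ≤ x × z ≤ y
  minimum {x} {y} 0<x 0<y with compare x y
  ... | tri< x<y _ _ = x , 0<x , inj₂ refl , inj₁ x<y
  ... | tri≈ _ x≈y _ = x , 0<x , inj₂ refl , inj₂ x≈y
  ... | tri> _ _ y<x = y , 0<y , inj₁ y<x , inj₂ refl

  Near : Carrier → Carrier → Carrier → Set ℓ₂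
  Near x ε x′ = x - ε < x′ × x′ < x + ε

  translate : ∀ {z ε x′} w {ε′} → ε ≤ ε′ → Near z ε x′ → Near w ε′ (w + (x′ - z))
  translate {z} {ε} {x′} w {ε′} ε≤ε′ (lower , upper) =
    0<-⇒< (positive-resp (solve 5 (λ z ε x′ w ε′ → (x′ :- (z :- ε)) :+ (ε′ :- ε) ⊜
             (w :+ (x′ :- z)) :- (w :- ε′)) refl z ε x′ w ε′)
           (+-positive-≤ (<⇒0<- lower) (≤⇒0≤- ε≤ε′))) ,
    0<-⇒< (positive-resp (solve 5 (λ z ε x′ w ε′ → ((z :+ ε) :- x′) :+ (ε′ :- ε) ⊜
             (w :+ ε′) :- (w :+ (x′ :- z))) refl z ε x′ w ε′)
           (+-positive-≤ (<⇒0<- upper) (≤⇒0≤- ε≤ε′)))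

  module _ {d} (disk : ConvexDisk d) where
    open ConvexDisk disk

    interior-resp : ∀ {p q} → p ≈ₚ q → Interior D p → Interior D q
    interior-resp (x≈ , y≈) (ε , 0<ε , h) = ε , 0<ε , λ r (near , near′) →
      h r (move x≈ near , move y≈ near′)
      where
      move : ∀ {x x′ w} → x ≈ x′ → Near x′ ε w → Near x ε w
      move x≈ (lower , upper) = <-respˡ (+-congʳ (sym x≈)) lower , <-respʳ (+-congʳ (sym x≈)) upper

    -- A displacement of the point on the segment is applied to both end points as well; the smaller
    -- of the two radii keeps both displaced ends in D.
    interior-convex : ∀ {p q t} → Interior D p → Interior D q → InUnit t →
                      Interior D (onSegment p q t)
    interior-convex {p@(p₁ , p₂)} {q@(q₁ , q₂)} {t} (ε₁ , 0<ε₁ , h₁) (ε₂ , 0<ε₂ , h₂) t∈ =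
      let ε , 0<ε , ε≤ε₁ , ε≤ε₂ = minimum 0<ε₁ 0<ε₂ in
      ε , 0<ε , λ (x , y) (near , near′) →
        resp (back p₁ q₁ x , back p₂ q₂ y)
          (convex _ _ t (h₁ _ (translate p₁ ε≤ε₁ near , translate p₂ ε≤ε₁ near′))
                        (h₂ _ (translate q₁ ε≤ε₂ near , translate q₂ ε≤ε₂ near′)) t∈)
      where
      back : ∀ p q x → (p + (x - (p + t * (q - p)))) +
        t * ((q + (x - (p + t * (q - p)))) - (p + (x - (p + t * (q - p))))) ≈ x
      back p q x = trans
        (+-congˡ (*-congˡ (solve 3 (λ p q z → (q :+ z) :- (p :+ z) ⊜ q :- p) refl p q (x - (p + t * (q - p))))))
        (solve 3 (λ p s x → (p :+ (x :- (p :+ s))) :+ s ⊜ x) refl p (t * (q - p)) x)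

  convex-positive : ∀ {A B s} → 0# < A → 0# < B → InUnit s → 0# < A + s * (B - A)
  convex-positive {A} {B} {s} 0<A 0<B (0≤s , inj₁ s<1) = positive-resp
    (trans (+-congʳ (trans (distribʳ A 1# (- s)) (+-congʳ (*-identityˡ A))))
      (solve 3 (λ A B s → (A :+ (:- s) :* A) :+ s :* B ⊜ A :+ s :* (B :- A)) refl A B s))
    (+-positive-≤ (*-pos (<⇒0<- s<1) 0<A) (*-nonneg 0≤s (inj₁ 0<B)))
  convex-positive {A} {B} {s} 0<A 0<B (_ , inj₂ s≈1) = positive-resp
    (trans (solve 2 (λ A B → B ⊜ A :+ (B :- A)) refl A B)
      (+-congˡ (sym (trans (*-congʳ s≈1) (*-identityˡ _))))) 0<B

  zero-crossing : ∀ {A B} → 0# < A → 0# < - B → ∃ λ s → InUnit s × A + s * (B - A) ≈ 0#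
  zero-crossing {A} {B} 0<A 0<-B =
    let u⁻¹ , 0<u⁻¹ , eq = positive-inverse (+-positive 0<A 0<-B) in
    -- The affine function with value A at 0 and B at 1 vanishes at A / (A - B).
    A * u⁻¹ ,
    (inj₁ (*-pos 0<A 0<u⁻¹) ,
     inj₁ (0<-⇒< (positive-resp (trans
       (solve 3 (λ A B u⁻¹ → (:- B) :* u⁻¹ ⊜ (A :+ (:- B)) :* u⁻¹ :- A :* u⁻¹) refl A B u⁻¹)
       (+-congʳ eq)) (*-pos 0<-B 0<u⁻¹)))) ,
    (begin
      A + A * u⁻¹ * (B - A)       ≈⟨ solve 3 (λ A B u⁻¹ → A :+ A :* u⁻¹ :* (B :- A) ⊜
                                       A :- A :* ((A :- B) :* u⁻¹)) refl A B u⁻¹ ⟩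
      A - A * ((A - B) * u⁻¹)     ≈⟨ +-congˡ (-‿cong (trans (*-congˡ eq) (*-identityʳ A))) ⟩
      A - A                       ≈⟨ -‿inverseʳ A ⟩
      0#                          ∎)

module RayCrossings {c ℓ₁ ℓ₂ d} {K : OrderedField c ℓ₁ ℓ₂} {G : PlabicGraph K d} (𝔤 : GaugeDirection G) where
  open OrderedField K
  open Plane K
  open PlabicGraph G
  open GaugeDirection 𝔤
  open OrderProperties K
  open Interiors K
  open Sides K 𝔩 using (cross-cong; proportional)
  open RingProperties ring using (-0#≈0#; -‿involutive)
  open CommutativeRingSolver commutativeRing
  open SetoidReasoning setoid

  boundary-not-interior : ∀ r → ¬ Interior D (pos (boundary r))
  boundary-not-interior r int =
    let t , t∈ , eq = on-segment r in PQ⊆∂D t t∈ (interior-resp disk eq int)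

  -- If t ≤ 0, the base point lies between two interior points.
  interior-ray⇒0< : ∀ r t → Interior D (ray r t) → 0# < t
  interior-ray⇒0< r t int with sign t
  ... | plus 0<t  = 0<t
  ... | null t≈0 = contradiction (interior-resp disk (base , base) int) (boundary-not-interior r)
    where
    base : ∀ {x l} → x + t * l ≈ x
    base = trans (+-congˡ (trans (*-congʳ t≈0) (zeroˡ _))) (+-identityʳ _)
  ... | minus 0<-t = contradiction between (boundary-not-interior r)
    where
    t′ = proj₁ (points-inside r)
    0<t′ = proj₁ (proj₂ (points-inside r))
    u = positive-inverse (+-positive 0<t′ 0<-t)
    u⁻¹ = proj₁ u
    -- The base point has parameter 0 on the line of the ray, so it divides the segment from t < 0
    -- to t′ > 0 in the proportion -t / (t′ - t).
    s = - t * u⁻¹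
    0<s : 0# < s
    0<s = *-pos 0<-t (proj₁ (proj₂ u))
    s<1 : s < 1#
    s<1 = 0<-⇒< (positive-resp (trans
      (solve 3 (λ t t′ u⁻¹ → t′ :* u⁻¹ ⊜ (t′ :+ (:- t)) :* u⁻¹ :- (:- t) :* u⁻¹) refl t t′ u⁻¹)
      (+-congʳ (proj₂ (proj₂ u)))) (*-pos 0<t′ (proj₁ (proj₂ u))))
    base : ∀ x l → (x + t * l) + s * ((x + t′ * l) - (x + t * l)) ≈ x
    base x l = begin
      (x + t * l) + s * ((x + t′ * l) - (x + t * l))
        ≈⟨ +-congˡ (*-congˡ (solve 4 (λ x t t′ l → (x :+ t′ :* l) :- (x :+ t :* l) ⊜ (t′ :- t) :* l) refl x t t′ l)) ⟩
      (x + t * l) + - t * u⁻¹ * ((t′ - t) * l)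
        ≈⟨ +-congˡ (solve 4 (λ t u⁻¹ v l → (:- t) :* u⁻¹ :* (v :* l) ⊜ :- (t :* l :* (v :* u⁻¹))) refl t u⁻¹ (t′ - t) l) ⟩
      (x + t * l) - t * l * ((t′ - t) * u⁻¹)
        ≈⟨ +-congˡ (-‿cong (trans (*-congˡ (proj₂ (proj₂ u))) (*-identityʳ _))) ⟩
      (x + t * l) - t * l
        ≈⟨ solve 2 (λ x y → (x :+ y) :- y ⊜ x) refl x (t * l) ⟩
      x ∎
    between : Interior D (pos (boundary r))
    between = interior-resp disk (base _ _ , base _ _)
      (interior-convex disk int (proj₂ (proj₂ (points-inside r))) (inj₁ 0<s , inj₁ s<1))

  -- An affine function vanishing exactly on the line of the ray; its sign tells the side of that
  -- line.
  offset : Fin #b → Point → Carrier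
  offset r q = cross 𝔩 (q -ₚ pos (boundary r))

  on-line : ∀ r q → offset r q ≈ 0# → ∃ λ t → ray r t ≈ₚ q
  on-line r q eq = let t , x≈ , y≈ = proportional 𝔩 (q -ₚ pos (boundary r)) nonzero eq in
    t , back x≈ , back y≈
    where
    back : ∀ {x b l} → x - b ≈ l → b + l ≈ x
    back {x} {b} eq = trans (+-congˡ (sym eq)) (solve 2 (λ x b → b :+ (x :- b) ⊜ x) refl x b)

  -- `avoids` speaks of the ray only, but the line has no interior point of D at or behind the base
  -- point.
  offset-internal : ∀ r v → ¬ offset r (pos (internal v)) ≈ 0#
  offset-internal r v eq =
    let t , ray≈v = on-line r (pos (internal v)) eq in
    avoids r v t (inj₁ (interior-ray⇒0< r t (interior-resp disk (≈ₚ-sym ray≈v) (inside-D v)))) ray≈v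

  offset-onSegment : ∀ r a b s → offset r (onSegment a b s) ≈ offset r a + s * (offset r b - offset r a)
  offset-onSegment r a b s = begin
    l * ((a₂ + s * (b₂ - a₂)) - p₂) - m * ((a₁ + s * (b₁ - a₁)) - p₁)
      ≈⟨ +-cong (linear l a₂ b₂ p₂) (-‿cong (linear m a₁ b₁ p₁)) ⟩
    (l * (a₂ - p₂) + s * (l * (b₂ - p₂) - l * (a₂ - p₂))) - (m * (a₁ - p₁) + s * (m * (b₁ - p₁) - m * (a₁ - p₁)))
      ≈⟨ solve 5 (λ s x y z w → (x :+ s :* (y :- x)) :- (z :+ s :* (w :- z)) ⊜
           (x :- z) :+ s :* ((y :- w) :- (x :- z))) refl
           s (l * (a₂ - p₂)) (l * (b₂ - p₂)) (m * (a₁ - p₁)) (m * (b₁ - p₁)) ⟩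
    offset r a + s * (offset r b - offset r a) ∎
    where
    l = proj₁ 𝔩
    m = proj₂ 𝔩
    a₁ = proj₁ a
    a₂ = proj₂ a
    b₁ = proj₁ b
    b₂ = proj₂ b
    p₁ = proj₁ (pos (boundary r))
    p₂ = proj₂ (pos (boundary r))
    linear : ∀ l a b p → l * ((a + s * (b - a)) - p) ≈ l * (a - p) + s * (l * (b - p) - l * (a - p))
    linear l a b p = trans
      (*-congˡ (solve 4 (λ a b p s → (a :+ s :* (b :- a)) :- p ⊜ (a :- p) :+ s :* ((b :- p) :- (a :- p))) refl a b p s))
      (solve 4 (λ l x y s → l :* (x :+ s :* (y :- x)) ⊜ l :* x :+ s :* (l :* y :- l :* x)) refl l (a - p) (b - p) s)

  offset-ray : ∀ r t → offset r (ray r t) ≈ 0#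
  offset-ray r t = begin
    l * ((p₂ + t * m) - p₂) - m * ((p₁ + t * l) - p₁)
      ≈⟨ +-cong (*-congˡ (cancel p₂ (t * m))) (-‿cong (*-congˡ (cancel p₁ (t * l)))) ⟩
    l * (t * m) - m * (t * l)
      ≈⟨ solve 3 (λ l m t → l :* (t :* m) :- m :* (t :* l) ⊜ l :* (t :* m) :- l :* (t :* m)) refl l m t ⟩
    l * (t * m) - l * (t * m)
      ≈⟨ -‿inverseʳ _ ⟩
    0# ∎
    where
    l = proj₁ 𝔩
    m = proj₂ 𝔩
    p₁ = proj₁ (pos (boundary r))
    p₂ = proj₂ (pos (boundary r))
    cancel : ∀ p x → (p + x) - p ≈ x
    cancel = solve 2 (λ p x → (p :+ x) :- p ⊜ x) refl

  offset-cong : ∀ r {a b} → a ≈ₚ b → offset r a ≈ offset r b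
  offset-cong r (x≈ , y≈) = cross-cong (refl , refl) (+-congʳ x≈ , +-congʳ y≈)

  module _ (r : Fin #b) (e : Edge) {u w} (src≡ : src e ≡ internal u) (tgt≡ : tgt e ≡ internal w) where
    private
      A = offset r (pos (src e))
      B = offset r (pos (tgt e))

      A≉0 : ¬ A ≈ 0#
      A≉0 = subst (λ v → ¬ offset r (pos v) ≈ 0#) (≡.sym src≡) (offset-internal r u)

      B≉0 : ¬ B ≈ 0#
      B≉0 = subst (λ v → ¬ offset r (pos v) ≈ 0#) (≡.sym tgt≡) (offset-internal r w)

      meets⇒zero : Meets r e → ∃ λ s → InUnit s × A + s * (B - A) ≈ 0#
      meets⇒zero (t , s , _ , s∈ , eq) = s , s∈ , trans (sym (offset-onSegment r _ _ s))
        (trans (offset-cong r (≈ₚ-sym eq)) (offset-ray r t))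

      zero⇒meets : ∀ s → InUnit s → A + s * (B - A) ≈ 0# → Meets r e
      zero⇒meets s s∈ eq =
        let t , ray≈ = on-line r (pointOn e s) (trans (offset-onSegment r _ _ s) eq) in
        t , s , interior-ray⇒0< r t (interior-resp disk (≈ₚ-sym ray≈) (interior-convex disk src∈ tgt∈ s∈)) , s∈ , ray≈
        where
        src∈ : Interior D (pos (src e))
        src∈ = subst (Interior D ∘ pos) (≡.sym src≡) (inside-D u)
        tgt∈ : Interior D (pos (tgt e))
        tgt∈ = subst (Interior D ∘ pos) (≡.sym tgt≡) (inside-D w)

      negate : ∀ s → A + s * (B - A) ≈ 0# → - A + s * (- B - - A) ≈ 0#
      negate s eq = trans (solve 3 (λ A B s → :- A :+ s :* (:- B :- (:- A)) ⊜ :- (A :+ s :* (B :- A))) refl A B s)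
        (trans (-‿cong eq) -0#≈0#)

      unnegate : ∀ s → - A + s * (- B - - A) ≈ 0# → A + s * (B - A) ≈ 0#
      unnegate s eq = trans (solve 3 (λ A B s → A :+ s :* (B :- A) ⊜ :- (:- A :+ s :* (:- B :- (:- A)))) refl A B s)
        (trans (-‿cong eq) -0#≈0#)

    -- An affine function with nonzero end values has a zero on the segment exactly when these
    -- values differ in sign. The zero is an interior point of D and thus lies on the ray, not
    -- behind its base point.
    meets-parity : does (meets? r e) ≡ positive? A xor positive? B
    meets-parity = cases (sign A) (sign B)
      where
      cases : Sign A → Sign B → does (meets? r e) ≡ positive? A xor positive? B
      cases (null A≈0) _ = contradiction A≈0 A≉0
      cases (plus _) (null B≈0) = contradiction B≈0 B≉0
      cases (minus _) (null B≈0) = contradiction B≈0 B≉0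
      cases (plus 0<A) (plus 0<B) = ≡.trans
        (dec-false (meets? r e) λ m → let s , s∈ , eq = meets⇒zero m in 0<⇒≉0 (convex-positive 0<A 0<B s∈) eq)
        (≡.sym (cong₂ _xor_ (positive?-true 0<A) (positive?-true 0<B)))
      cases (minus 0<-A) (minus 0<-B) = ≡.trans
        (dec-false (meets? r e) λ m → let s , s∈ , eq = meets⇒zero m in
          0<⇒≉0 (convex-positive 0<-A 0<-B s∈) (negate s eq))
        (≡.sym (cong₂ _xor_ (positive?-false λ p → positive-asym p 0<-A) (positive?-false λ p → positive-asym p 0<-B)))
      cases (plus 0<A) (minus 0<-B) = ≡.trans
        (dec-true (meets? r e) (let s , s∈ , eq = zero-crossing 0<A 0<-B in zero⇒meets s s∈ eq))
        (≡.sym (cong₂ _xor_ (positive?-true 0<A) (positive?-false λ p → positive-asym p 0<-B)))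
      cases (minus 0<-A) (plus 0<B) = ≡.trans
        (dec-true (meets? r e) (let s , s∈ , eq = zero-crossing 0<-A (positive-resp (sym (-‿involutive B)) 0<B) in
          zero⇒meets s s∈ (unnegate s eq)))
        (≡.sym (cong₂ _xor_ (positive?-false λ p → positive-asym p 0<-A) (positive?-true 0<B)))

-- The linear system and its matrix

Unique-resp-↭ : ∀ {a} {A : Set a} {xs ys : List A} → xs ↭ ys → Unique xs → Unique ys
Unique-resp-↭ {A = A} p = Permutationₛ.AllPairs-resp-↭ (≡.setoid A) (λ x≢y → x≢y ∘ ≡.sym)
  ((λ { ≡.refl → id }) , (λ { ≡.refl → id })) (↭.↭⇒↭ₛ p)

Unique-map : ∀ {a b} {A : Set a} {B : Set b} (f : A → B) {xs} →
  (∀ {x y} → x ∈ xs → y ∈ xs → f x ≡ f y → x ≡ y) → Unique xs → Unique (map f xs)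
Unique-map f inj AllPairs.[] = AllPairs.[]
Unique-map f {x ∷ xs} inj (x∉ AllPairs.∷ uxs) =
  All.map⁺ (All.tabulate λ {y} y∈ eq → All.lookup x∉ y∈ (inj (here ≡.refl) (there y∈) eq))
  AllPairs.∷ Unique-map f (λ x∈ y∈ → inj (there x∈) (there y∈)) uxs

tabulate-injective : ∀ {a} {A : Set a} {n} (f : Fin n → A) → Unique (tabulate f) → Injective _≡_ _≡_ f
tabulate-injective {n = suc n} f (f0∉ AllPairs.∷ u) {zero}  {zero}  eq = ≡.refl
tabulate-injective {n = suc n} f (f0∉ AllPairs.∷ u) {zero}  {suc y} eq =
  contradiction eq (All.lookup f0∉ (∈.∈-tabulate⁺ y))
tabulate-injective {n = suc n} f (f0∉ AllPairs.∷ u) {suc x} {zero}  eq =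
  contradiction (≡.sym eq) (All.lookup f0∉ (∈.∈-tabulate⁺ x))
tabulate-injective {n = suc n} f (f0∉ AllPairs.∷ u) {suc x} {suc y} eq =
  cong suc (tabulate-injective (f ∘ suc) u eq)

length≥2 : ∀ {a} {A : Set a} {x y : A} {xs} → x ∈ xs → y ∈ xs → x ≢ y → 2 ℕ.≤ length xs
length≥2 (here ≡.refl) (here ≡.refl) x≢y = contradiction ≡.refl x≢y
length≥2 (here ≡.refl) (there y∈)    x≢y = ℕ.s≤s (∈.∈-length y∈)
length≥2 (there x∈)    (here ≡.refl) x≢y = ℕ.s≤s (∈.∈-length x∈)
length≥2 (there x∈)    (there y∈)    x≢y = ℕ.m≤n⇒m≤1+n (length≥2 x∈ y∈ x≢y)

two-members : ∀ {a} {A : Set a} {xs : List A} → Unique xs → 2 ℕ.≤ length xs →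
  ∃₂ λ x y → x ∈ xs × y ∈ xs × x ≢ y
two-members {xs = x ∷ y ∷ _} ((x≢y ∷ _) AllPairs.∷ _) _ = x , y , here ≡.refl , there (here ≡.refl) , x≢y
two-members {xs = _ ∷ []} _ (ℕ.s≤s ())

some-member : ∀ {a} {A : Set a} {xs : List A} → 1 ℕ.≤ length xs → ∃ λ x → x ∈ xs
some-member {xs = x ∷ _} _ = x , here ≡.refl

-- Degree and perfectness exclude `no-input` for internal vertices. It is kept rather than refuted,
-- since without incoming edges there are no equations to compare.
data VertexShape {a} {A : Set a} : List A → List A → Set a where
  no-input       : ∀ {outs} → VertexShape [] outs
  bivalent       : ∀ {e f} → VertexShape (e ∷ []) (f ∷ [])
  trivalentBlack : ∀ {e e′ f} → VertexShape (e ∷ e′ ∷ []) (f ∷ [])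
  trivalentWhite : ∀ {e f f′} → VertexShape (e ∷ []) (f ∷ f′ ∷ [])

vertexShape : ∀ {a} {A : Set a} (ins outs : List A) → length ins ≡ 1 ⊎ length outs ≡ 1 →
  length ins ℕ.+ length outs ≡ 2 ⊎ length ins ℕ.+ length outs ≡ 3 → VertexShape ins outs
vertexShape []               _               _ _ = no-input
vertexShape (_ ∷ [])         (_ ∷ [])        _ _ = bivalent
vertexShape (_ ∷ _ ∷ [])     (_ ∷ [])        _ _ = trivalentBlack
vertexShape (_ ∷ [])         (_ ∷ _ ∷ [])    _ _ = trivalentWhite
vertexShape (_ ∷ [])         []              _ (inj₁ ())
vertexShape (_ ∷ [])         []              _ (inj₂ ())
vertexShape (_ ∷ [])         (_ ∷ _ ∷ _ ∷ _) _ (inj₁ ())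
vertexShape (_ ∷ [])         (_ ∷ _ ∷ _ ∷ _) _ (inj₂ ())
vertexShape (_ ∷ _ ∷ _)      []              (inj₁ ()) _
vertexShape (_ ∷ _ ∷ _)      []              (inj₂ ()) _
vertexShape (_ ∷ _ ∷ _)      (_ ∷ _ ∷ _)     (inj₁ ()) _
vertexShape (_ ∷ _ ∷ _)      (_ ∷ _ ∷ _)     (inj₂ ()) _
vertexShape (_ ∷ _ ∷ _ ∷ []) (_ ∷ [])        _ (inj₁ ())
vertexShape (_ ∷ _ ∷ _ ∷ []) (_ ∷ [])        _ (inj₂ ())
vertexShape (_ ∷ _ ∷ _ ∷ _ ∷ _) (_ ∷ [])     _ (inj₁ ())
vertexShape (_ ∷ _ ∷ _ ∷ _ ∷ _) (_ ∷ [])     _ (inj₂ ())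

module Incidence {c ℓ₁ ℓ₂ d} {K : OrderedField c ℓ₁ ℓ₂} (G : PlabicGraph K d) where
  open PlabicGraph G

  ∈-inEdges⁺ : ∀ {v e} → tgt e ≡ v → e ∈ inEdges v
  ∈-inEdges⁺ {v} {e} = ∈.∈-filter⁺ (λ e → tgt e ≟ᵥ v) (∈.∈-allFin e)

  ∈-inEdges⁻ : ∀ {v e} → e ∈ inEdges v → tgt e ≡ v
  ∈-inEdges⁻ {v} e∈ = proj₂ (∈.∈-filter⁻ (λ e → tgt e ≟ᵥ v) {xs = allFin #e} e∈)

  ∈-outEdges⁺ : ∀ {v e} → src e ≡ v → e ∈ outEdges v
  ∈-outEdges⁺ {v} {e} = ∈.∈-filter⁺ (λ e → src e ≟ᵥ v) (∈.∈-allFin e)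

  ∈-outEdges⁻ : ∀ {v e} → e ∈ outEdges v → src e ≡ v
  ∈-outEdges⁻ {v} e∈ = proj₂ (∈.∈-filter⁻ (λ e → src e ≟ᵥ v) {xs = allFin #e} e∈)

  inEdges-unique : ∀ v → Unique (inEdges v)
  inEdges-unique v = Unique.filter⁺ (λ e → tgt e ≟ᵥ v) (Unique.allFin⁺ #e)

  outEdges-unique : ∀ v → Unique (outEdges v)
  outEdges-unique v = Unique.filter⁺ (λ e → src e ≟ᵥ v) (Unique.allFin⁺ #e)

  boundary-one-way : ∀ {i e e′} → src e ≡ boundary i → ¬ tgt e′ ≡ boundary i
  boundary-one-way {i} src≡ tgt≡ = ℕ.<-irrefl (≡.sym (boundary-degree i))
    (ℕ.+-mono-≤ (∈.∈-length (∈-inEdges⁺ tgt≡)) (∈.∈-length (∈-outEdges⁺ src≡)))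

  Unknown : Edge → Set
  Unknown e = ¬ EndsAtSink e

  -- A boundary vertex with an incoming edge has degree 1, so no edge leaves it and it is a sink.
  unknown⇒internal : ∀ {e} → Unknown e → ∃ λ v → tgt e ≡ internal v
  unknown⇒internal {e} unk with tgt e in eq
  ... | internal v = v , ≡.refl
  ... | boundary i = contradiction (i , (λ (_ , src≡) → boundary-one-way src≡ eq) , ≡.refl) unk

  internal⇒unknown : ∀ {e v} → tgt e ≡ internal v → Unknown e
  internal⇒unknown eq (j , _ , eq′) with () ← ≡.trans (≡.sym eq) eq′

  -- Either colour leaves a single edge in one of the two directions. This is what makes the
  -- continuation of a flow through a vertex unique.
  perfect : ∀ {v e e′ f f′} → e ≢ e′ → f ≢ f′ → tgt e ≡ internal v → tgt e′ ≡ internal v →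
    src f ≡ internal v → ¬ src f′ ≡ internal v
  perfect {v} e≢e′ f≢f′ te te′ sf sf′ with colour v in eq
  ... | white = ℕ.<-irrefl (≡.sym (white-perfect v eq)) (length≥2 (∈-inEdges⁺ te) (∈-inEdges⁺ te′) e≢e′)
  ... | black = ℕ.<-irrefl (≡.sym (black-perfect v eq)) (length≥2 (∈-outEdges⁺ sf) (∈-outEdges⁺ sf′) f≢f′)

module System {c ℓ₁ ℓ₂ d} {K : OrderedField c ℓ₁ ℓ₂} (N : PlabicNetwork K d)
  (𝔤 : GaugeDirection (PlabicNetwork.graph N)) where
  open OrderedField K
  open PlabicNetwork N
  open Incidence graph
  open Determinant K using (δ; sum-δ)
  open ListSum +-commutativeMonoid
  open SemiringSum semiring using (sum-cong-≋)

  -- All three types of equations have this common form, with one term for each edge leaving the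
  -- vertex.
  equationFrom : List Edge → Edge → Equation N 𝔤
  equationFrom outs e = e := map (λ f → coefficient N 𝔤 e f , f) outs

  equationAt : Edge → Equation N 𝔤
  equationAt e = equationFrom (outEdges (tgt e)) e

  vertexEquations-shape : ∀ {ins outs} → VertexShape ins outs →
    vertexEquations N 𝔤 ins outs ≡ map (equationFrom outs) ins
  vertexEquations-shape no-input  = ≡.refl
  vertexEquations-shape bivalent  = ≡.refl
  vertexEquations-shape trivalentBlack = ≡.refl
  vertexEquations-shape trivalentWhite = ≡.refl

  vertexEquations-internal : ∀ v → vertexEquations N 𝔤 (inEdges (internal v)) (outEdges (internal v)) ≡
    map equationAt (inEdges (internal v))
  vertexEquations-internal v = ≡.trans (vertexEquations-shape (vertexShape _ _ one-way (internal-degree v)))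
    (List.map-cong-local (All.tabulate λ {e} e∈ →
      cong (λ w → equationFrom (outEdges w) e) (≡.sym (∈-inEdges⁻ e∈))))
    where
    one-way : length (inEdges (internal v)) ≡ 1 ⊎ length (outEdges (internal v)) ≡ 1
    one-way with colour v in eq
    ... | white = inj₁ (white-perfect v eq)
    ... | black = inj₂ (black-perfect v eq)

  -- The unknowns in the order in which their equations occur in `system`.
  edgesToInternal : List Edge
  edgesToInternal = concatMap (inEdges ∘ internal) (allFin #i)

  system≡ : system N 𝔤 ≡ map equationAt edgesToInternal
  system≡ = ≡.trans (List.concatMap-cong vertexEquations-internal (allFin #i))
    (≡.sym (List.map-concatMap equationAt (inEdges ∘ internal) (allFin #i)))

  unknowns-unique : Unique unknowns
  unknowns-unique = Unique.filter⁺ (λ e → ¬? (endsAtSink? e)) (Unique.allFin⁺ #e)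

  ∈-unknowns⁺ : ∀ {e} → Unknown e → e ∈ unknowns
  ∈-unknowns⁺ {e} = ∈.∈-filter⁺ (λ e → ¬? (endsAtSink? e)) (∈.∈-allFin e)

  ∈-unknowns⁻ : ∀ {e} → e ∈ unknowns → Unknown e
  ∈-unknowns⁻ e∈ = proj₂ (∈.∈-filter⁻ (λ e → ¬? (endsAtSink? e)) {xs = allFin #e} e∈)

  edgesToInternal↭ : edgesToInternal ↭ unknowns
  edgesToInternal↭ = unique-↭ unique unknowns-unique to from
    where
    unique : Unique edgesToInternal
    unique = Unique.concat⁺ (All.map⁺ (All.tabulate λ {v} _ → inEdges-unique (internal v)))
      (AllPairs.map⁺ {f = inEdges ∘ internal} (AllPairs.map disjoint (Unique.allFin⁺ #i)))
      where
      internal-injective : ∀ {v w : Fin #i} → _≡_ {A = Vertex} (internal v) (internal w) → v ≡ w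
      internal-injective ≡.refl = ≡.refl
      disjoint : ∀ {v w} → v ≢ w → Disjoint (inEdges (internal v)) (inEdges (internal w))
      disjoint v≢w (e∈v , e∈w) =
        v≢w (internal-injective (≡.trans (≡.sym (∈-inEdges⁻ e∈v)) (∈-inEdges⁻ e∈w)))
    to : ∀ {e} → e ∈ edgesToInternal → e ∈ unknowns
    to e∈ = let v , e∈v = Any.satisfied (∈.∈-concatMap⁻ (inEdges ∘ internal) {xs = allFin #i} e∈) in
      ∈-unknowns⁺ (internal⇒unknown (∈-inEdges⁻ e∈v))
    from : ∀ {e} → e ∈ unknowns → e ∈ edgesToInternal
    from {e} e∈ = let v , eq = unknown⇒internal (∈-unknowns⁻ e∈) in
      ∈.∈-concatMap⁺ (inEdges ∘ internal) (Any.map (λ { ≡.refl → ∈-inEdges⁺ eq }) (∈.∈-allFin v))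

  properOrdering : ProperOrdering N 𝔤
  properOrdering = record
    { size       = length edgesToInternal
    ; equation   = equationAt ∘ lookup edgesToInternal
    ; unknown    = lookup edgesToInternal
    ; equations↭ = ↭.↭-reflexive (≡.trans (≡.trans (≡.sym (List.map-tabulate (lookup edgesToInternal) equationAt))
                     (cong (map equationAt) (List.tabulate-lookup edgesToInternal))) (≡.sym system≡))
    ; unknowns↭  = ↭.↭-trans (↭.↭-reflexive (List.tabulate-lookup edgesToInternal)) edgesToInternal↭
    ; aligned    = λ _ → ≡.refl
    }

  square : length (system N 𝔤) ≡ length unknowns
  square = ≡.trans (cong length system≡) (≡.trans (List.length-map equationAt edgesToInternal)
    (↭.↭-length edgesToInternal↭))

  -- The matrix A of M = 1 - A, extended to all edges: the columns of edges ending at sinks give the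
  -- inhomogeneous part.
  transition : Edge → Edge → Carrier
  transition e f = if does (src f ≟ᵥ tgt e) then coefficient N 𝔤 e f else 0#

  -- Stated for commutative monoids because it serves both for scalars, in the entries of M, and for
  -- vectors, in the equations.
  ∑-outEdges : ∀ {b ℓ} (A : CommutativeMonoid b ℓ) →
    let open CommutativeMonoid A renaming (Carrier to B; _≈_ to _≈′_) in
    (h : Edge → B) (v : Vertex) →
    ListSum.∑ₗ A (map h (outEdges v)) ≈′
    MonoidSum.sum A (λ f → if does (src f ≟ᵥ v) then h f else ε)
  ∑-outEdges A h v = M.trans
    (S.∑ₗ-cong (outEdges v) λ {f} f∈ → M.reflexive (cong (λ b → if b then h f else M.ε)
      (≡.sym (dec-true (src f ≟ᵥ v) (∈-outEdges⁻ f∈)))))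
    (M.trans (S.∑ₗ-filter (λ f → src f ≟ᵥ v) (λ f → if does (src f ≟ᵥ v) then h f else M.ε) (allFin #e)
        λ f src≢ → M.reflexive (cong (λ b → if b then h f else M.ε) (dec-false (src f ≟ᵥ v) src≢)))
      (M.reflexive (S.∑ₗ-allFin {B = Edge} λ f → if does (src f ≟ᵥ v) then h f else M.ε)))
    where
    module M = CommutativeMonoid A
    module S = ListSum A

  leftCoefficient≈ : ∀ e f → leftCoefficient N 𝔤 (equationAt e) f ≈ δ e f - transition e f
  leftCoefficient≈ e f = +-congˡ (-‿cong (trans
    (reflexive (cong ∑ (≡.sym (List.map-∘ (outEdges (tgt e))))))
    (trans (∑-outEdges +-commutativeMonoid (λ g → coefficient N 𝔤 e g * δ g f) (tgt e))
      (trans (sum-cong-≋ λ g → if-* (does (src g ≟ᵥ tgt e)) (coefficient N 𝔤 e g) (δ g f))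
        (sum-δ (transition e) f)))))
    where
    if-* : ∀ b x y → (if b then x * y else 0#) ≈ (if b then x else 0#) * y
    if-* true  x y = refl
    if-* false x y = sym (zeroˡ y)

  transition-consecutive : ∀ {e f} → tgt e ≡ src f → transition e f ≡ coefficient N 𝔤 e f
  transition-consecutive {e} {f} eq = cong (λ b → if b then coefficient N 𝔤 e f else 0#)
    (dec-true (src f ≟ᵥ tgt e) (≡.sym eq))

  transition-otherwise : ∀ {e f} → tgt e ≢ src f → transition e f ≡ 0#
  transition-otherwise {e} {f} neq = cong (λ b → if b then coefficient N 𝔤 e f else 0#)
    (dec-false (src f ≟ᵥ tgt e) (neq ∘ ≡.sym))

odd-length-filter : ∀ {a p} {A : Set a} {P : Pred A p} (P? : Decidable P) x xs →
  odd (length (filter P? (x ∷ xs))) ≡ does (P? x) xor odd (length (filter P? xs))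
odd-length-filter P? x xs with does (P? x)
... | true  = ≡.refl
... | false = ≡.refl

∧-not-xor : ∀ m n w → m ∧ not (n xor w) ≡ (m ∧ n) xor (m ∧ not w)
∧-not-xor = solveᵇ 3 (λ m n w → m ⊗ (bit true ⊕ (n ⊕ w)) ⊜ᵇ m ⊗ n ⊕ m ⊗ (bit true ⊕ w)) ≡.refl

-- The sign of a permutation along a flow

module Meeting {c ℓ₁ ℓ₂ d} {K : OrderedField c ℓ₁ ℓ₂} (G : PlabicGraph K d) where
  open OrderedField K
  open Plane K
  open PlabicGraph G
  open OrderProperties K
  open RingProperties ring using (x[y-z]≈xy-xz; x∙y⁻¹≈ε⇒x≈y)
  open CommutativeRingSolver commutativeRing

  onSegment-start : ∀ {a b s} → ¬ a ≈ₚ b → onSegment a b s ≈ₚ a → s ≈ 0#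
  onSegment-start {a₁ , a₂} {b₁ , b₂} {s} a≉b (eq₁ , eq₂) with s ≟ 0#
  ... | yes s≈0 = s≈0
  ... | no s≉0 = contradiction (coordinate eq₁ , coordinate eq₂) a≉b
    where
    coordinate : ∀ {a b} → a + s * (b - a) ≈ a → a ≈ b
    coordinate {a} {b} eq = sym (x∙y⁻¹≈ε⇒x≈y _ _ (*-cancel-0 s≉0 (trans
      (solve 2 (λ a x → x ⊜ (a :+ x) :- a) refl a (s * (b - a)))
      (trans (+-congʳ eq) (-‿inverseʳ a)))))

  onSegment-end : ∀ {a b s} → ¬ a ≈ₚ b → onSegment a b s ≈ₚ b → s ≈ 1#
  onSegment-end {a₁ , a₂} {b₁ , b₂} {s} a≉b (eq₁ , eq₂) with (s - 1#) ≟ 0#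
  ... | yes s-1≈0 = x∙y⁻¹≈ε⇒x≈y _ _ s-1≈0
  ... | no s-1≉0 = contradiction (coordinate eq₁ , coordinate eq₂) a≉b
    where
    coordinate : ∀ {a b} → a + s * (b - a) ≈ b → a ≈ b
    coordinate {a} {b} eq = sym (x∙y⁻¹≈ε⇒x≈y _ _ (*-cancel-0 s-1≉0 (trans
      (distribʳ (b - a) s (- 1#)) (trans (+-congˡ (-1*x≈-x (b - a))) (trans
      (solve 3 (λ a b x → x :- (b :- a) ⊜ (a :+ x) :- b) refl a b (s * (b - a)))
      (trans (+-congʳ eq) (-‿inverseʳ b)))))))
      where open RingProperties ring using (-1*x≈-x)

  distinct-ends : ∀ e → ¬ pos (src e) ≈ₚ pos (tgt e)
  distinct-ends e eq = no-loops e (pos-injective eq)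

  -- By planarity a common point is a common vertex. As the sources differ and the targets differ,
  -- it is the source of one edge and the target of the other, which fixes both parameters.
  meet : ∀ {e f} → e ≢ f → src e ≢ src f → tgt e ≢ tgt f → ∀ s t → InUnit s → InUnit t →
    pointOn e s ≈ₚ pointOn f t → (src e ≡ tgt f × s ≈ 0# × t ≈ 1#) ⊎ (s ≈ 1# × t ≈ 0#)
  meet {e} {f} e≢f src≢ tgt≢ s t s∈ t∈ eq = cases (planar e≢f s t s∈ t∈ eq)
    where
    transfer : ∀ {v w} → w ≡ v → pointOn e s ≈ₚ pos v → pointOn f t ≈ₚ pos w
    transfer ≡.refl at = ≈ₚ-trans (≈ₚ-sym eq) at
    cases : (∃ λ v → Incident v e × Incident v f × pointOn e s ≈ₚ pos v) →
      (src e ≡ tgt f × s ≈ 0# × t ≈ 1#) ⊎ (s ≈ 1# × t ≈ 0#)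
    cases (v , inj₁ se , inj₁ sf , at) = contradiction (≡.trans se (≡.sym sf)) src≢
    cases (v , inj₂ te , inj₂ tf , at) = contradiction (≡.trans te (≡.sym tf)) tgt≢
    cases (v , inj₁ ≡.refl , inj₂ tf , at) = inj₁ (≡.sym tf , onSegment-start (distinct-ends e) at ,
      onSegment-end (distinct-ends f) (transfer tf at))
    cases (v , inj₂ ≡.refl , inj₁ sf , at) = inj₂ (onSegment-end (distinct-ends e) at ,
      onSegment-start (distinct-ends f) (transfer sf at))

  -- A convex combination of the three secants joins the point at parameter g of
  -- the first segment to the point at parameter b + g of the second one.
  combination : ∀ {a b g x x′ y y′} → a + b + g ≈ 1# →
    a * (y - x) + b * (y′ - x) + g * (y′ - x′) ≈ 0# →
    x + g * (x′ - x) ≈ y + (b + g) * (y′ - y)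
  combination {a} {b} {g} {x} {x′} {y} {y′} one eq = sym (x∙y⁻¹≈ε⇒x≈y _ _ (trans
    (+-cong (point-y y y′) (-‿cong (point-x x x′)))
    (trans (solve 6 (λ ay ax bx by gx gy → (ay :+ (by :+ gy)) :- ((ax :+ bx) :+ gx) ⊜
       (ay :- ax) :+ (by :- bx) :+ (gy :- gx)) refl (a * y) (a * x) (b * x) (b * y′) (g * x′) (g * y′))
    (trans (sym (+-cong (+-cong (x[y-z]≈xy-xz a y x) (x[y-z]≈xy-xz b y′ x)) (x[y-z]≈xy-xz g y′ x′))) eq))))
    where
    unit : ∀ z → z ≈ (a * z + b * z) + g * z
    unit z = trans (sym (*-identityˡ z)) (trans (*-congʳ (sym one))
      (trans (distribʳ z (a + b) g) (+-congʳ (distribʳ z a b))))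
    point-x : ∀ x x′ → x + g * (x′ - x) ≈ (a * x + b * x) + g * x′
    point-x x x′ = trans (+-cong (unit x) (x[y-z]≈xy-xz g x′ x))
      (solve 3 (λ p q r → (p :+ q) :+ (r :- q) ⊜ p :+ r) refl (a * x + b * x) (g * x) (g * x′))
    point-y : ∀ y y′ → y + (b + g) * (y′ - y) ≈ a * y + (b * y′ + g * y′)
    point-y y y′ = trans (+-cong (unit y) (trans (x[y-z]≈xy-xz (b + g) y′ y)
        (+-cong (distribʳ y′ b g) (-‿cong (distribʳ y b g)))))
      (solve 5 (λ p q r q′ r′ → ((p :+ q) :+ r) :+ ((q′ :+ r′) :- (q :+ r)) ⊜ p :+ (q′ :+ r′))
        refl (a * y) (b * y) (g * y) (b * y′) (g * y′))

module Ordered {c ℓ₁ ℓ₂ d} {K : OrderedField c ℓ₁ ℓ₂} (N : PlabicNetwork K d)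
  (𝔤 : GaugeDirection (PlabicNetwork.graph N)) (o : ProperOrdering N 𝔤) where
  open OrderedField K
  open PlabicNetwork N
  open GaugeDirection 𝔤
  open ProperOrdering o public renaming (unknown to u)
  open Incidence graph public
  open System N 𝔤 public

  u-injective : Injective _≡_ _≡_ u
  u-injective = tabulate-injective u (Unique-resp-↭ (↭.↭-sym unknowns↭) unknowns-unique)

  u-unknown : ∀ i → Unknown (u i)
  u-unknown i = ∈-unknowns⁻ (↭.∈-resp-↭ unknowns↭ (∈.∈-tabulate⁺ i))

  index : ∀ {e} → Unknown e → ∃ λ i → u i ≡ e
  index unk =
    let i , eq = ∈.∈-tabulate⁻ (↭.∈-resp-↭ (↭.↭-sym unknowns↭) (∈-unknowns⁺ unk)) in i , ≡.sym eq

  -- Every equation of `system` is determined by the edge on its left-hand side, which alignment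
  -- identifies.
  equation≡ : ∀ i → equation i ≡ equationAt (u i)
  equation≡ i =
    let e , _ , eq = ∈.∈-map⁻ equationAt
          (subst (equation i ∈_) system≡ (↭.∈-resp-↭ equations↭ (∈.∈-tabulate⁺ i)))
    in ≡.trans eq (cong equationAt (≡.trans (≡.sym (cong lhs eq)) (aligned i)))

  module _ where
    open Determinant K using (δ)
    M≈ : ∀ i j → M i j ≈ δ (u i) (u j) - transition (u i) (u j)
    M≈ i j = trans (reflexive (cong (λ q → leftCoefficient N 𝔤 q (u j)) (equation≡ i)))
      (leftCoefficient≈ (u i) (u j))

  -- Only these permutations can have a nonzero Leibniz term, since A vanishes off consecutive
  -- edges.
  Legal : Code size → Set
  Legal c = ∀ i → ⟦ c ⟧ i ≡ i ⊎ tgt (u i) ≡ src (u (⟦ c ⟧ i))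

  legal? : Decidable Legal
  legal? c = Fin.all? λ i → (⟦ c ⟧ i Fin.≟ i) ⊎-dec (tgt (u i) ≟ᵥ src (u (⟦ c ⟧ i)))

  module LegalCode (c : Code size) (legal : Legal c) where
    open Meeting graph
    open Plane K
    open OrderProperties K
    open Sides K 𝔩
    open CommutativeRingSolver commutativeRing
    open Turning K 𝔩
    open RayCrossings 𝔤

    f = ⟦ c ⟧

    Moving : Fin size → Set
    Moving i = f i ≢ i

    moving-f : ∀ {i} → Moving i → Moving (f i)
    moving-f mi eq = mi (⟦⟧-injective c eq)

    step : ∀ {i} → Moving i → tgt (u i) ≡ src (u (f i))
    step {i} mi = cases (legal i)
      where
      cases : f i ≡ i ⊎ tgt (u i) ≡ src (u (f i)) → tgt (u i) ≡ src (u (f i))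
      cases (inj₁ fixed) = contradiction fixed mi
      cases (inj₂ eq)    = eq

    predecessor : ∀ {i} → Moving i → ∃ λ k → Moving k × f k ≡ i
    predecessor {i} mi = let k , fk≡i = ⟦⟧-surjective c i in
      k , (λ fk≡k → mi (≡.trans (cong f (≡.trans (≡.sym fk≡i) fk≡k)) fk≡i)) , fk≡i

    -- The source is also the target of the preceding moved edge, and that edge is an unknown.
    src-internal : ∀ {i} → Moving i → ∃ λ v → src (u i) ≡ internal v
    src-internal mi =
      let k , mk , fk≡i = predecessor mi
          v , tk = unknown⇒internal (u-unknown k)
      in v , ≡.trans (cong (src ∘ u) (≡.sym fk≡i)) (≡.trans (≡.sym (step mk)) tk)

    -- A common source would be entered by the two distinct predecessors and left by the two edges,
    -- contrary to `perfect`.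
    src-distinct : ∀ {i j} → Moving i → Moving j → i ≢ j → src (u i) ≢ src (u j)
    src-distinct {i} {j} mi mj i≢j eq =
      let k , mk , fk≡i = predecessor mi
          l , ml , fl≡j = predecessor mj
          v , si = src-internal mi
          sj = ≡.trans (≡.sym eq) si
      in perfect
           (λ uk≡ul → i≢j (≡.trans (≡.sym fk≡i) (≡.trans (cong f (u-injective uk≡ul)) fl≡j)))
           (i≢j ∘ u-injective)
           (≡.trans (step mk) (≡.trans (cong (src ∘ u) fk≡i) si))
           (≡.trans (step ml) (≡.trans (cong (src ∘ u) fl≡j) sj)) si sj

    src-injective : ∀ {i j} → Moving i → Moving j → src (u i) ≡ src (u j) → i ≡ j
    src-injective {i} {j} mi mj eq =
      decidable-stable (i Fin.≟ j) λ i≢j → src-distinct mi mj i≢j eq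

    p : Fin size → Point
    p i = pos (src (u i))

    secant : Fin size → Fin size → Point
    secant i j = p j -ₚ p i

    secant-flip : ∀ i j → secant j i ≈ₚ -ₚ secant i j
    secant-flip i j = flip _ _ , flip _ _
      where
      flip : ∀ x y → x - y ≈ - (y - x)
      flip = solve 2 (λ x y → x :- y ⊜ :- (y :- x)) refl

    secant-nonzero : ∀ {i j} → Moving i → Moving j → i ≢ j → ¬ secant i j ≈ₚ 0ₚ
    secant-nonzero mi mj i≢j (eq , eq′) = i≢j (≡.sym (src-injective mj mi (pos-injective
      (x∙y⁻¹≈ε⇒x≈y _ _ eq , x∙y⁻¹≈ε⇒x≈y _ _ eq′))))
      where open RingProperties ring using (x∙y⁻¹≈ε⇒x≈y)

    direction≡ : ∀ {i} → Moving i → direction (u i) ≡ secant i (f i)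
    direction≡ {i} mi = cong (λ v → pos v -ₚ p i) (step mi)

    -- A vanishing convex combination of the secants from the edge i to the edge j
    -- exhibits an intersection of the two edges.
    degenerate : ∀ {i j} → Moving i → Moving j → i ≢ j → ∀ α β γ → 0# ≤ α → 0# ≤ β → 0# ≤ γ →
      0# < α + β + γ →
      α *ₚ secant i j +ₚ β *ₚ secant i (f j) +ₚ γ *ₚ secant (f i) (f j) ≈ₚ 0ₚ →
      i ≡ f j × (∃ λ τ → (γ * τ ≈ 0# × (β * τ + γ * τ) ≈ 1#))
    degenerate {i} {j} mi mj i≢j α β γ 0≤α 0≤β 0≤γ 0<T (eq₁ , eq₂) = conclude
      (meet (i≢j ∘ u-injective) (i≢j ∘ src-injective mi mj)
        (λ eq → i≢j (⟦⟧-injective c (src-injective (moving-f mi) (moving-f mj)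
          (≡.trans (≡.sym (step mi)) (≡.trans eq (step mj))))))
        (γ * τ) (β * τ + γ * τ) γτ∈ βγτ∈ same-point)
      where
      -- The factor τ normalises the coefficients to sum 1. Then γτ is the parameter of the common
      -- point on the edge i, and βτ + γτ its parameter on the edge j.
      inv = positive-inverse 0<T
      τ = proj₁ inv
      0≤τ : 0# ≤ τ
      0≤τ = inj₁ (proj₁ (proj₂ inv))
      one : α * τ + β * τ + γ * τ ≈ 1#
      one = trans (trans (+-congʳ (sym (distribʳ τ α β))) (sym (distribʳ τ (α + β) γ))) (proj₂ (proj₂ inv))
      βγτ∈ : InUnit (β * τ + γ * τ)
      βγτ∈ = +-nonneg (*-nonneg 0≤β 0≤τ) (*-nonneg 0≤γ 0≤τ) ,
        0≤-⇒≤ (≤-resp refl (trans (solve 3 (λ x y z → x ⊜ (x :+ y :+ z) :- (y :+ z)) refl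
          (α * τ) (β * τ) (γ * τ)) (+-congʳ one)) (*-nonneg 0≤α 0≤τ))
      γτ∈ : InUnit (γ * τ)
      γτ∈ = *-nonneg 0≤γ 0≤τ ,
        0≤-⇒≤ (≤-resp refl (trans (solve 3 (λ x y z → x :+ y ⊜ (x :+ y :+ z) :- z) refl
          (α * τ) (β * τ) (γ * τ)) (+-congʳ one)) (+-nonneg (*-nonneg 0≤α 0≤τ) (*-nonneg 0≤β 0≤τ)))
      scale : ∀ {x y z} → α * x + β * y + γ * z ≈ 0# → α * τ * x + β * τ * y + γ * τ * z ≈ 0#
      scale {x} {y} {z} eq = trans (+-cong (+-cong (pull α x) (pull β y)) (pull γ z))
        (trans (trans (+-congʳ (sym (distribˡ τ _ _))) (sym (distribˡ τ _ _))) (trans (*-congˡ eq) (zeroʳ τ)))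
        where
        pull : ∀ α x → α * τ * x ≈ τ * (α * x)
        pull α x = trans (*-congʳ (*-comm α τ)) (*-assoc τ α x)
      same-point : pointOn (u i) (γ * τ) ≈ₚ pointOn (u j) (β * τ + γ * τ)
      same-point = subst₂ (λ v w → onSegment (p i) (pos v) (γ * τ) ≈ₚ onSegment (p j) (pos w) (β * τ + γ * τ))
        (≡.sym (step mi)) (≡.sym (step mj)) (combination one (scale eq₁) , combination one (scale eq₂))
      conclude : (src (u i) ≡ tgt (u j) × γ * τ ≈ 0# × β * τ + γ * τ ≈ 1#) ⊎ (γ * τ ≈ 1# × β * τ + γ * τ ≈ 0#) →
        i ≡ f j × (∃ λ τ → (γ * τ ≈ 0# × (β * τ + γ * τ) ≈ 1#))
      conclude (inj₁ (eq , γτ≈0 , βγτ≈1)) =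
        src-injective mi (moving-f mj) (≡.trans eq (step mj)) , τ , γτ≈0 , βγτ≈1
      conclude (inj₂ (γτ≈1 , βγτ≈0)) = contradiction (trans (+-comm _ _) βγτ≈0)
        (0<⇒≉0 (+-positive-≤ (positive-resp (sym γτ≈1) 0<1) (*-nonneg 0≤β 0≤τ)))

    avoids₃ : ∀ {i j} → Moving i → Moving j → i ≢ j → i ≢ f j →
      Avoids₃ (secant i j) (secant i (f j)) (secant (f i) (f j))
    avoids₃ mi mj i≢j i≢fj α β γ 0≤α 0≤β 0≤γ 0<T eq =
      i≢fj (proj₁ (degenerate mi mj i≢j α β γ 0≤α 0≤β 0≤γ 0<T eq))

    -- With β = 0 the parameters from `degenerate` would make γτ both 0 and 1. Unlike `avoids₃` this
    -- includes i = f j, the case in which the secants are reversed edges.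
    avoids₂ : ∀ {i j} → Moving i → Moving j → i ≢ j → Avoids₂ (secant i j) (secant (f i) (f j))
    avoids₂ mi mj i≢j α γ 0≤α 0≤γ 0<T (eq , eq′) =
      let _ , τ , γτ≈0 , γτ≈1 = degenerate mi mj i≢j α 0# γ 0≤α 0≤0 0≤γ
                (positive-resp (+-congʳ (sym (+-identityʳ α))) 0<T) (pad eq , pad eq′)
      in 0<⇒≉0 0<1 (trans (sym (trans (sym (trans (+-congʳ (zeroˡ τ)) (+-identityˡ _))) γτ≈1)) γτ≈0)
      where
      pad : ∀ {x y z} → α * x + γ * z ≈ 0# → α * x + 0# * y + γ * z ≈ 0#
      pad eq = trans (+-congʳ (trans (+-congˡ (zeroˡ _)) (+-identityʳ _))) eq

    avoids₂₃ : ∀ {a b d} → Avoids₃ a b d → Avoids₂ a b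
    avoids₂₃ av α β 0≤α 0≤β 0<T (eq , eq′) = av α β 0# 0≤α 0≤β 0≤0
      (positive-resp (sym (+-identityʳ _)) 0<T) (pad eq , pad eq′)
      where
      pad : ∀ {x z} → x ≈ 0# → x + 0# * z ≈ 0#
      pad eq = trans (+-congˡ (zeroˡ _)) (trans (+-identityʳ _) eq)

    open Umlaufsatz c using (moves; umlaufsatz)

    winding-parity : isOdd c ≡ ⨁ (λ j → moves j ∧ not (χ (secant j (f j)) (secant (f j) (f (f j)))))
    winding-parity = umlaufsatz (λ i j → side (secant i j)) (λ i j k l → χ (secant i j) (secant k l))
      (λ {i} {j} mi mj i≢j → ≡.trans (side-cong (secant-flip i j)) (side-neg (secant-nonzero mi mj i≢j)))
      (λ {i} {j} mi mj i≢j → ≡.trans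
        (cong (χ (secant i j) (secant (f i) (f j)) xor_) (χ-cong (secant-flip i j) (secant-flip (f i) (f j))))
        (χ-neg (avoids₂ mi mj i≢j)))
      (λ mi mj i≢j i≢fj → χ-split (avoids₃ mi mj i≢j i≢fj))
      (λ {i} {j} mi mj i≢j i≢fj → ≡.trans
        (cong (χ (secant i j) (secant i (f j)) xor_) (χ-cong (secant-flip i j) (secant-flip i (f j))))
        (χ-neg (avoids₂₃ (avoids₃ mi mj i≢j i≢fj))))

    moves-cong : ∀ {A B : Bool} i → (Moving i → A ≡ B) → moves i ∧ A ≡ moves i ∧ B
    moves-cong {A} {B} i eq = cases (f i Fin.≟ i)
      where
      cases : Dec (f i ≡ i) → moves i ∧ A ≡ moves i ∧ B
      cases (yes fi≡i) = ≡.trans (cong (_∧ A) fixed) (cong (_∧ B) (≡.sym fixed))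
        where
        fixed : moves i ≡ false
        fixed = ≡.trans (cong (_≠ᵇ i) fi≡i) (≠ᵇ-irrefl i)
      cases (no mi) = cong (moves i ∧_) (eq mi)

    -- For each ray, a moved edge crosses it exactly when its ends lie on different sides of the
    -- line. The target of an edge is the source of the next one, so these changes of side cancel
    -- along the permutation.
    intersection-parity : ⨁ (λ i → moves i ∧ odd (int (u i))) ≡ false
    intersection-parity = along sources
      where
      along : ∀ rs → ⨁ (λ i → moves i ∧ odd (length (filter (λ r → meets? r (u i)) rs))) ≡ false
      along []       = ⨁-zero {size} λ i → Bool.∧-zeroʳ (moves i)
      along (r ∷ rs) = ≡.trans (⨁-cong λ i → split i) (≡.trans (⨁-distrib-xor {size} _ _)
        (cong₂ _xor_ crossings-even (along rs)))
        where
        split : ∀ i → moves i ∧ odd (length (filter (λ r → meets? r (u i)) (r ∷ rs))) ≡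
          (moves i ∧ does (meets? r (u i))) xor (moves i ∧ odd (length (filter (λ r → meets? r (u i)) rs)))
        split i = ≡.trans (cong (moves i ∧_) (odd-length-filter (λ r → meets? r (u i)) r rs))
          (Bool.∧-distribˡ-xor (moves i) (does (meets? r (u i))) _)
        side-of : Fin size → Bool
        side-of i = positive? (offset r (p i))
        crossings-even : ⨁ (λ i → moves i ∧ does (meets? r (u i))) ≡ false
        crossings-even = ≡.trans (⨁-cong λ i → moves-cong i λ mi → ≡.trans
            (meets-parity r (u i) (proj₂ (src-internal mi)) (proj₂ (unknown⇒internal (u-unknown i))))
            (cong (λ v → side-of i xor positive? (offset r (pos v))) (step mi)))
          (≡.trans (⨁-cong λ i → Bool.∧-distribˡ-xor (moves i) (side-of i) (side-of (f i)))
          (≡.trans (⨁-distrib-xor {size} _ _)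
          (≡.trans (cong (⨁ (λ i → moves i ∧ side-of i) xor_) (≡.trans
            (⨁-cong λ i → cong (_∧ side-of (f i)) (≡.sym (≠ᵇ-⟦⟧ c (f i) i)))
            (⨁-reindex c λ k → moves k ∧ side-of k)))
          (Bool.xor-same (⨁ λ i → moves i ∧ side-of i)))))

    -- The sign of the entry of M at i and f i. The `not` is the minus sign in M = 1 - A, one for
    -- each moved edge.
    entry-sign : Fin size → Bool
    entry-sign i = moves i ∧ not (odd (int (u i)) xor odd ∣ wind (u i) (u (f i)) ∣)

    sign-parity : isOdd c xor ⨁ entry-sign ≡ false
    sign-parity = ≡.trans (cong (isOdd c xor_) (≡.trans
      (⨁-cong λ i → ≡.trans
        (moves-cong i λ mi → cong (λ z → not (odd (int (u i)) xor z)) (≡.trans (odd-wind 𝔤 (u i) (u (f i)))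
          (cong₂ χ (direction≡ mi) (direction≡ (moving-f mi)))))
        (∧-not-xor (moves i) (odd (int (u i))) _))
      (≡.trans (⨁-distrib-xor {size} _ _) (≡.trans (cong₂ _xor_ intersection-parity (≡.sym winding-parity)) ≡.refl))))
      (Bool.xor-same (isOdd c))

-- Conservative flows

allSubsets-unique : ∀ n → Unique (allSubsets n)
allSubsets-unique zero    = All.[] AllPairs.∷ AllPairs.[]
allSubsets-unique (suc n) = Unique.++⁺
  (Unique.map⁺ Vec.∷-injectiveʳ (allSubsets-unique n))
  (Unique.map⁺ Vec.∷-injectiveʳ (allSubsets-unique n))
  λ (∈out , ∈in) → clash (∈.∈-map⁻ (outside Vec.∷_) ∈out) (∈.∈-map⁻ (inside Vec.∷_) ∈in)
  where
  clash : ∀ {C} → (∃ λ p → p ∈ allSubsets n × C ≡ outside Vec.∷ p) →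
          ¬ (∃ λ p → p ∈ allSubsets n × C ≡ inside Vec.∷ p)
  clash (_ , _ , ≡.refl) (_ , _ , ())

∈-allSubsets : ∀ {n} (C : Subset n) → C ∈ allSubsets n
∈-allSubsets Vec.[]               = here ≡.refl
∈-allSubsets (outside Vec.∷ C) = ∈.∈-++⁺ˡ (∈.∈-map⁺ (outside Vec.∷_) (∈-allSubsets C))
∈-allSubsets (inside  Vec.∷ C) = ∈.∈-++⁺ʳ _ (∈.∈-map⁺ (inside Vec.∷_) (∈-allSubsets C))

module Flows {c ℓ₁ ℓ₂ d} {K : OrderedField c ℓ₁ ℓ₂} (N : PlabicNetwork K d)
  (𝔤 : GaugeDirection (PlabicNetwork.graph N)) (o : ProperOrdering N 𝔤) where
  open OrderedField K
  open PlabicNetwork N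
  open GaugeDirection 𝔤
  open Ordered N 𝔤 o
  open Determinant K
  open ListSum +-commutativeMonoid
  open RingProperties ring using (-0#≈0#; -‿distribˡ-*)
  private module ∏ₗ = ListSum *-commutativeMonoid

  ∏-zero : ∀ {n} (h : Fin n → Carrier) i → h i ≈ 0# → product h ≈ 0#
  ∏-zero h zero    eq = trans (*-congʳ eq) (zeroˡ _)
  ∏-zero h (suc i) eq = trans (*-congˡ (∏-zero (h ∘ suc) i eq)) (zeroʳ _)

  ∏-sgn : ∀ {n} (b : Fin n → Bool) → product (λ i → sgn (b i)) ≈ sgn (⨁ b)
  ∏-sgn {zero}  b = refl
  ∏-sgn {suc n} b = trans (*-congˡ (∏-sgn (b ∘ suc))) (sym (sgn-xor (b zero) _))

  M-diagonal : ∀ i → M i i ≈ 1#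
  M-diagonal i = trans (M≈ i i) (trans (+-cong (reflexive (δ-same (u i)))
    (trans (-‿cong (reflexive (transition-otherwise (no-loops (u i) ∘ ≡.sym)))) -0#≈0#)) (+-identityʳ 1#))

  M-off-diagonal : ∀ {i j} → i ≢ j → M i j ≈ - transition (u i) (u j)
  M-off-diagonal i≢j = trans (M≈ _ _)
    (trans (+-congʳ (reflexive (δ-distinct (i≢j ∘ u-injective)))) (+-identityˡ _))

  term-illegal : ∀ c → ¬ Legal c → term M c ≈ 0#
  term-illegal c ¬legal =
    let i , ¬step = Fin.¬∀⟶∃¬ size _ (λ i → (⟦ c ⟧ i Fin.≟ i) ⊎-dec (tgt (u i) ≟ᵥ src (u (⟦ c ⟧ i)))) ¬legal
    in trans (*-congˡ (∏-zero _ i (trans (M-off-diagonal (λ eq → ¬step (inj₁ (≡.sym eq))))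
         (trans (-‿cong (reflexive (transition-otherwise (¬step ∘ inj₂)))) -0#≈0#)))) (zeroʳ _)

  Moves : Code size → Edge → Set
  Moves c e = ∃ λ i → u i ≡ e × ⟦ c ⟧ i ≢ i

  moves? : ∀ c e → Dec (Moves c e)
  moves? c e = Fin.any? λ i → (u i Fin.≟ e) ×-dec ¬? (⟦ c ⟧ i Fin.≟ i)

  support : Code size → Subset #e
  support c = Vec.tabulate λ e → does (moves? c e)

  ∈-support⁺ : ∀ c {i} → ⟦ c ⟧ i ≢ i → u i ∈ₛ support c
  ∈-support⁺ c {i} mi = Vec.lookup⇒[]= (u i) _ (≡.trans (Vec.lookup∘tabulate _ (u i))
    (dec-true (moves? c (u i)) (i , ≡.refl , mi)))

  ∈-support⁻ : ∀ c {e} → e ∈ₛ support c → Moves c e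
  ∈-support⁻ c {e} e∈ = witness (moves? c e) (≡.trans (≡.sym (Vec.lookup∘tabulate _ e)) (Vec.[]=⇒lookup e∈))
    where
    witness : (d : Dec (Moves c e)) → does d ≡ true → Moves c e
    witness (yes m) _ = m

  ∈-support-u⁻ : ∀ c {i} → u i ∈ₛ support c → ⟦ c ⟧ i ≢ i
  ∈-support-u⁻ c {i} ui∈ = let k , uk≡ui , mk = ∈-support⁻ c ui∈ in
    subst (λ i → ⟦ c ⟧ i ≢ i) (u-injective uk≡ui) mk

  module _ (c : Code size) (legal : Legal c) where
    open LegalCode c legal
    open Umlaufsatz c using (moves)

    movingWeight : Fin size → Carrier
    movingWeight i = if moves i then weight (u i) else 1#

    entry : ∀ i → M i (f i) ≈ sgn (entry-sign i) * movingWeight i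
    entry i = cases (f i Fin.≟ i)
      where
      e = u i
      e′ = u (f i)
      b = odd (int e) xor odd ∣ wind e e′ ∣
      coefficient≈ : coefficient N 𝔤 e e′ ≈ sgn b * weight e
      coefficient≈ = *-congʳ (trans (sgn-odd ∣ + int e ℤ.+ wind e e′ ∣)
        (reflexive (cong sgn (odd-+ℤ (int e) (wind e e′)))))
      value : ∀ {m} → moves i ≡ m →
        sgn (m ∧ not b) * (if m then weight e else 1#) ≈ sgn (entry-sign i) * movingWeight i
      value eq = reflexive (cong (λ m → sgn (m ∧ not b) * (if m then weight e else 1#)) (≡.sym eq))
      cases : Dec (f i ≡ i) → M i (f i) ≈ sgn (entry-sign i) * movingWeight i
      cases (yes fi≡i) = trans (reflexive (cong (M i) fi≡i)) (trans (M-diagonal i) (trans (sym (*-identityˡ 1#))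
        (value (≡.trans (cong (_≠ᵇ i) fi≡i) (≠ᵇ-irrefl i)))))
      cases (no mi) = trans (M-off-diagonal (mi ∘ ≡.sym)) (trans
        (-‿cong (trans (reflexive (transition-consecutive (step mi))) coefficient≈))
        (trans (-‿distribˡ-* (sgn b) (weight e)) (trans (*-congʳ (sym (sgn-not b))) (value (≢⇒≠ᵇ mi)))))

    term-legal : term M c ≈ product movingWeight
    term-legal = begin
      sgn (isOdd c) * product (λ i → M i (f i))
        ≈⟨ *-congˡ (trans (∏-cong entry) (∏.∑-distrib-+ (sgn ∘ entry-sign) movingWeight)) ⟩
      sgn (isOdd c) * (product (sgn ∘ entry-sign) * product movingWeight)
        ≈⟨ sym (*-assoc _ _ _) ⟩
      sgn (isOdd c) * product (sgn ∘ entry-sign) * product movingWeight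
        ≈⟨ *-congʳ (trans (*-congˡ (∏-sgn entry-sign)) (sym (sgn-xor (isOdd c) (⨁ entry-sign)))) ⟩
      sgn (isOdd c xor ⨁ entry-sign) * product movingWeight
        ≈⟨ *-congʳ (reflexive (cong sgn sign-parity)) ⟩
      1# * product movingWeight
        ≈⟨ *-identityˡ _ ⟩
      product movingWeight ∎
      where open SetoidReasoning setoid

    -- Edges ending at sinks are never in the support and contribute the factor 1, so the product
    -- over all edges reduces to the unknowns, which `u` enumerates.
    flowWeight-support : flowWeight N (support c) ≈ product movingWeight
    flowWeight-support = begin
      product g
        ≡⟨ ∏ₗ.∑ₗ-allFin {B = Edge} g ⟨
      ∏ₗ.∑ₗ (map g (allFin #e))
        ≈⟨ sym (∏ₗ.∑ₗ-filter (λ e → ¬? (endsAtSink? e)) g (allFin #e) known) ⟩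
      ∏ₗ.∑ₗ (map g unknowns)
        ≈⟨ sym (∏ₗ.∑ₗ-↭ (↭.map⁺ g unknowns↭)) ⟩
      ∏ₗ.∑ₗ (map g (tabulate u))
        ≡⟨ ≡.trans (cong ∏ₗ.∑ₗ (List.map-tabulate u g)) (∏ₗ.∑ₗ-tabulate (g ∘ u)) ⟩
      product (g ∘ u)
        ≈⟨ ∏-cong (λ i → reflexive (cong (λ m → if m then weight (u i) else 1#) (same i))) ⟩
      product movingWeight ∎
      where
      open SetoidReasoning setoid
      g : Edge → Carrier
      g e = if does (e Subset.∈? support c) then weight e else 1#
      known : ∀ e → ¬ Unknown e → g e ≈ 1#
      known e ¬unk = reflexive (cong (λ m → if m then weight e else 1#)
        (dec-false (e Subset.∈? support c) λ e∈ → let i , ui≡e , _ = ∈-support⁻ c e∈ in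
          ¬unk (subst Unknown ui≡e (u-unknown i))))
      same : ∀ i → does (u i Subset.∈? support c) ≡ moves i
      same i = cases (f i Fin.≟ i)
        where
        cases : Dec (f i ≡ i) → _
        cases (yes fi≡i) = ≡.trans (dec-false (u i Subset.∈? support c) λ ui∈ → ∈-support-u⁻ c ui∈ fi≡i)
          (≡.sym (≡.trans (cong (_≠ᵇ i) fi≡i) (≠ᵇ-irrefl i)))
        cases (no mi) = ≡.trans (dec-true (u i Subset.∈? support c) (∈-support⁺ c mi)) (≡.sym (≢⇒≠ᵇ mi))

    private
      next′ : ∀ {e} → Dec (Moves c e) → Edge
      next′ (yes (i , _)) = u (f i)
      next′ {e} (no _)    = e

      next : Edge → Edge
      next e = next′ (moves? c e)

      next-u : ∀ {i} → Moving i → next (u i) ≡ u (f i)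
      next-u {i} mi = spec (moves? c (u i))
        where
        spec : (d : Dec (Moves c (u i))) → next′ d ≡ u (f i)
        spec (yes (k , uk≡ui , _)) = cong (u ∘ f) (u-injective uk≡ui)
        spec (no ¬m) = contradiction (i , ≡.refl , mi) ¬m

      flowIn flowOut : Vertex → List Edge
      flowIn  v = filter (Subset._∈? support c) (inEdges v)
      flowOut v = filter (Subset._∈? support c) (outEdges v)

      flowIn⁻ : ∀ {v e} → e ∈ flowIn v → tgt e ≡ v × (∃ λ i → u i ≡ e × Moving i)
      flowIn⁻ {v} e∈ = let e∈in , e∈C = ∈.∈-filter⁻ (Subset._∈? support c) {xs = inEdges v} e∈ in
        ∈-inEdges⁻ e∈in , ∈-support⁻ c e∈C

      flowOut⁻ : ∀ {v e} → e ∈ flowOut v → src e ≡ v × (∃ λ i → u i ≡ e × Moving i)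
      flowOut⁻ {v} e∈ = let e∈out , e∈C = ∈.∈-filter⁻ (Subset._∈? support c) {xs = outEdges v} e∈ in
        ∈-outEdges⁻ e∈out , ∈-support⁻ c e∈C

      flowIn⁺ : ∀ {v i} → tgt (u i) ≡ v → Moving i → u i ∈ flowIn v
      flowIn⁺ eq mi = ∈.∈-filter⁺ (Subset._∈? support c) (∈-inEdges⁺ eq) (∈-support⁺ c mi)

      flowOut⁺ : ∀ {v i} → src (u i) ≡ v → Moving i → u i ∈ flowOut v
      flowOut⁺ eq mi = ∈.∈-filter⁺ (Subset._∈? support c) (∈-outEdges⁺ eq) (∈-support⁺ c mi)

      next-injective : ∀ {v x y} → x ∈ flowIn v → y ∈ flowIn v → next x ≡ next y → x ≡ y
      next-injective x∈ y∈ eq =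
        let _ , i , ui≡x , mi = flowIn⁻ x∈
            _ , j , uj≡y , mj = flowIn⁻ y∈
            fi≡fj = u-injective (≡.trans (≡.sym (next-u mi)) (≡.trans (cong next ui≡x)
              (≡.trans eq (≡.trans (cong next (≡.sym uj≡y)) (next-u mj)))))
        in ≡.trans (≡.sym ui≡x) (≡.trans (cong u (⟦⟧-injective c fi≡fj)) uj≡y)

      -- Conservation needs as many leaving as arriving edges; the permutation itself supplies the
      -- bijection.
      flow-next : ∀ v → map next (flowIn v) ↭ flowOut v
      flow-next v = unique-↭
        (Unique-map next next-injective (Unique.filter⁺ (Subset._∈? support c) (inEdges-unique v)))
        (Unique.filter⁺ (Subset._∈? support c) (outEdges-unique v)) to from
        where
        to : ∀ {x} → x ∈ map next (flowIn v) → x ∈ flowOut v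
        to x∈ =
          let e , e∈ , x≡ = ∈.∈-map⁻ next x∈
              te , i , ui≡e , mi = flowIn⁻ e∈
          in subst (_∈ flowOut v) (≡.sym (≡.trans x≡ (≡.trans (cong next (≡.sym ui≡e)) (next-u mi))))
               (flowOut⁺ (≡.trans (≡.sym (step mi)) (≡.trans (cong tgt ui≡e) te)) (moving-f mi))
        from : ∀ {x} → x ∈ flowOut v → x ∈ map next (flowIn v)
        from x∈ =
          let sx , j , uj≡x , mj = flowOut⁻ x∈
              k , mk , fk≡j = predecessor mj
          in subst (_∈ map next (flowIn v)) (≡.trans (next-u mk) (≡.trans (cong u fk≡j) uj≡x))
               (∈.∈-map⁺ next (flowIn⁺ (≡.trans (step mk) (≡.trans (cong (src ∘ u) fk≡j)
                 (≡.trans (cong src uj≡x) sx))) mk))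

    support-flow : ConservativeFlow N (support c)
    support-flow = not-incident , λ v →
      ≡.trans (≡.sym (List.length-map next (flowIn (internal v)))) (↭.↭-length (flow-next (internal v)))
      where
      internal≢boundary : ∀ {v : Vertex} {w i} → v ≡ internal w → v ≢ boundary i
      internal≢boundary ≡.refl ()
      not-incident : ∀ e → e ∈ₛ support c → ∀ i → ¬ Incident (boundary i) e
      not-incident e e∈ i incident =
        let k , uk≡e , mk = ∈-support⁻ c e∈ in
        refute uk≡e (proj₂ (src-internal mk)) (proj₂ (unknown⇒internal (u-unknown k))) incident
        where
        refute : ∀ {k v w} → u k ≡ e → src (u k) ≡ internal v → tgt (u k) ≡ internal w → ¬ Incident (boundary i) e
        refute ≡.refl sk tk (inj₁ se) = internal≢boundary sk se
        refute ≡.refl sk tk (inj₂ te) = internal≢boundary tk te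

  -- The image of i is a moved edge starting where the edge i ends, and moved edges have distinct
  -- sources.
  support-determines : ∀ {c c′} → Legal c → Legal c′ → support c ≡ support c′ →
    ∀ {i} → ⟦ c ⟧ i ≢ i → ⟦ c ⟧ i ≡ ⟦ c′ ⟧ i
  support-determines {c} {c′} legal legal′ eq {i} mi =
    C.src-injective (C.moving-f mi) moved (≡.trans (≡.sym (C.step mi)) (C′.step mi′))
    where
    module C  = LegalCode c legal
    module C′ = LegalCode c′ legal′
    mi′ : ⟦ c′ ⟧ i ≢ i
    mi′ = ∈-support-u⁻ c′ (subst (u i ∈ₛ_) eq (∈-support⁺ c mi))
    moved : C.Moving (⟦ c′ ⟧ i)
    moved = ∈-support-u⁻ c (subst (u (⟦ c′ ⟧ i) ∈ₛ_) (≡.sym eq) (∈-support⁺ c′ (C′.moving-f mi′)))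

  support-injective : ∀ {c c′} → Legal c → Legal c′ → support c ≡ support c′ → c ≡ c′
  support-injective {c} {c′} legal legal′ eq = ⟦⟧-faithful c c′ λ i → cases i (⟦ c ⟧ i Fin.≟ i) (⟦ c′ ⟧ i Fin.≟ i)
    where
    cases : ∀ i → Dec (⟦ c ⟧ i ≡ i) → Dec (⟦ c′ ⟧ i ≡ i) → ⟦ c ⟧ i ≡ ⟦ c′ ⟧ i
    cases i (no mi)   _          = support-determines legal legal′ eq mi
    cases i (yes ci≡) (no mi′)   = ≡.sym (support-determines legal′ legal (≡.sym eq) mi′)
    cases i (yes ci≡) (yes c′i≡) = ≡.trans ci≡ (≡.sym c′i≡)

  module FromFlow (C : Subset #e) (flow : ConservativeFlow N C) where

    tgt-internal : ∀ {e} → e ∈ₛ C → ∃ λ v → tgt e ≡ internal v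
    tgt-internal {e} e∈ = kind (tgt e) ≡.refl
      where
      kind : ∀ v → tgt e ≡ v → ∃ λ w → tgt e ≡ internal w
      kind (internal w) eq = w , eq
      kind (boundary i) eq = contradiction (inj₂ eq) (proj₁ flow e e∈ i)

    private
      flowIn⁺ : ∀ {v e} → e ∈ₛ C → tgt e ≡ v → e ∈ filter (Subset._∈? C) (inEdges v)
      flowIn⁺ e∈ eq = ∈.∈-filter⁺ (Subset._∈? C) (∈-inEdges⁺ eq) e∈

      flowOut⁻ : ∀ {v e} → e ∈ filter (Subset._∈? C) (outEdges v) → e ∈ₛ C × src e ≡ v
      flowOut⁻ {v} e∈ = let e∈out , e∈C = ∈.∈-filter⁻ (Subset._∈? C) {xs = outEdges v} e∈ in e∈C , ∈-outEdges⁻ e∈out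

    successor : ∀ {e} → e ∈ₛ C → ∃ λ g → g ∈ₛ C × tgt e ≡ src g
    successor e∈ =
      let v , eq = tgt-internal e∈
          g , g∈ = some-member (subst (1 ℕ.≤_) (proj₂ flow v) (∈.∈-length (flowIn⁺ e∈ eq)))
          g∈C , sg = flowOut⁻ g∈
      in g , g∈C , ≡.trans eq (≡.sym sg)

    -- Two flow edges arriving at a vertex would, by conservation, force two leaving it, contrary to
    -- `perfect`.
    tgt-injective : ∀ {e e′} → e ∈ₛ C → e′ ∈ₛ C → tgt e ≡ tgt e′ → e ≡ e′
    tgt-injective {e} {e′} e∈ e′∈ eq = decidable-stable (e Fin.≟ e′) λ e≢e′ →
      let v , te = tgt-internal e∈
          te′ = ≡.trans (≡.sym eq) te
          g , g′ , g∈ , g′∈ , g≢g′ = two-members (Unique.filter⁺ (Subset._∈? C) (outEdges-unique (internal v)))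
            (subst (2 ℕ.≤_) (proj₂ flow v) (length≥2 (flowIn⁺ e∈ te) (flowIn⁺ e′∈ te′) e≢e′))
      in perfect e≢e′ g≢g′ te te′ (proj₂ (flowOut⁻ g∈)) (proj₂ (flowOut⁻ g′∈))

    private
      successorIndex : ∀ {i} → u i ∈ₛ C → ∃ λ j → u j ∈ₛ C × tgt (u i) ≡ src (u j)
      successorIndex ui∈ =
        let g , g∈ , eq = successor ui∈
            j , uj≡g = index (internal⇒unknown (proj₂ (tgt-internal g∈)))
        in j , subst (_∈ₛ C) (≡.sym uj≡g) g∈ , ≡.trans eq (cong src (≡.sym uj≡g))

      move : ∀ i → Dec (u i ∈ₛ C) → Fin size
      move i (yes ui∈) = proj₁ (successorIndex ui∈)
      move i (no _)    = i

      move-∈ : ∀ {i} d → u i ∈ₛ C → u (move i d) ∈ₛ C × tgt (u i) ≡ src (u (move i d))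
      move-∈ (yes ui∈) _   = proj₂ (successorIndex ui∈)
      move-∈ (no ui∉)  ui∈ = contradiction ui∈ ui∉

      move-∉ : ∀ {i} d → ¬ u i ∈ₛ C → move i d ≡ i
      move-∉ (yes ui∈) ui∉ = contradiction ui∈ ui∉
      move-∉ (no _)    _   = ≡.refl

      f : Fin size → Fin size
      f i = move i (u i Subset.∈? C)

      f-∈ : ∀ {i} → u i ∈ₛ C → u (f i) ∈ₛ C × tgt (u i) ≡ src (u (f i))
      f-∈ {i} = move-∈ (u i Subset.∈? C)

      f-∉ : ∀ {i} → ¬ u i ∈ₛ C → f i ≡ i
      f-∉ {i} = move-∉ (u i Subset.∈? C)

      f-injective : Injective _≡_ _≡_ f
      f-injective {i} {j} eq = cases (u i Subset.∈? C) (u j Subset.∈? C)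
        where
        cases : Dec (u i ∈ₛ C) → Dec (u j ∈ₛ C) → i ≡ j
        cases (yes ui∈) (yes uj∈) = u-injective (tgt-injective ui∈ uj∈
          (≡.trans (proj₂ (f-∈ ui∈)) (≡.trans (cong (src ∘ u) eq) (≡.sym (proj₂ (f-∈ uj∈))))))
        -- The map sends C into itself and fixes everything else, so an edge of C and one outside
        -- never share an image.
        cases (yes ui∈) (no uj∉)  = contradiction
          (subst (λ k → u k ∈ₛ C) (≡.trans eq (f-∉ uj∉)) (proj₁ (f-∈ ui∈))) uj∉
        cases (no ui∉)  (yes uj∈) = contradiction
          (subst (λ k → u k ∈ₛ C) (≡.trans (≡.sym eq) (f-∉ ui∉)) (proj₁ (f-∈ uj∈))) ui∉
        cases (no ui∉)  (no uj∉)  = ≡.trans (≡.sym (f-∉ ui∉)) (≡.trans eq (f-∉ uj∉))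

    code : Code size
    code = proj₁ (encode f f-injective)

    private
      ⟦code⟧ : ∀ i → ⟦ code ⟧ i ≡ f i
      ⟦code⟧ = proj₂ (encode f f-injective)

    code-legal : Legal code
    code-legal i = cases (u i Subset.∈? C)
      where
      cases : Dec (u i ∈ₛ C) → _
      cases (yes ui∈) = inj₂ (≡.trans (proj₂ (f-∈ ui∈)) (cong (src ∘ u) (≡.sym (⟦code⟧ i))))
      cases (no ui∉)  = inj₁ (≡.trans (⟦code⟧ i) (f-∉ ui∉))

    support-code : support code ≡ C
    support-code = Subset.⊆-antisym
      (λ e∈ → let i , ui≡e , mi = ∈-support⁻ code e∈ in
        subst (_∈ₛ C) ui≡e (decidable-stable (u i Subset.∈? C) λ ui∉ → mi (≡.trans (⟦code⟧ i) (f-∉ ui∉))))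
      (λ {e} e∈ → let i , ui≡e = index (internal⇒unknown (proj₂ (tgt-internal e∈)))
                      ui∈ = subst (_∈ₛ C) (≡.sym ui≡e) e∈
        in subst (_∈ₛ support code) ui≡e (∈-support⁺ code λ fixed →
             -- A fixed edge of C would be its own successor, hence a loop. So the permutation moves
             -- every edge of C.
             no-loops (u i) (≡.sym (≡.trans (proj₂ (f-∈ ui∈))
               (cong (src ∘ u) (≡.trans (≡.sym (⟦code⟧ i)) fixed))))))

  legalCodes : List (Code size)
  legalCodes = filter legal? (codes size)

  legalCodes⁻ : ∀ {c} → c ∈ legalCodes → Legal c
  legalCodes⁻ c∈ = proj₂ (∈.∈-filter⁻ legal? {xs = codes size} c∈)

  flows↭ : map support legalCodes ↭ conservativeFlows N
  flows↭ = unique-↭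
    (Unique-map support (λ c∈ c′∈ → support-injective (legalCodes⁻ c∈) (legalCodes⁻ c′∈))
      (Unique.filter⁺ legal? (codes-unique size)))
    (Unique.filter⁺ (conservativeFlow? N) (allSubsets-unique #e)) to from
    where
    to : ∀ {C} → C ∈ map support legalCodes → C ∈ conservativeFlows N
    to C∈ = let c , c∈ , C≡ = ∈.∈-map⁻ support C∈ in
      ∈.∈-filter⁺ (conservativeFlow? N) (∈-allSubsets _)
        (subst (ConservativeFlow N) (≡.sym C≡) (support-flow c (legalCodes⁻ c∈)))
    from : ∀ {C} → C ∈ conservativeFlows N → C ∈ map support legalCodes
    from {C} C∈ = subst (_∈ map support legalCodes) support-code
      (∈.∈-map⁺ support (∈.∈-filter⁺ legal? (∈-codes code) code-legal))
      where open FromFlow C (proj₂ (∈.∈-filter⁻ (conservativeFlow? N) {xs = allSubsets #e} C∈))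

  det-flows : det K M ≈ ∑ (map (flowWeight N) (conservativeFlows N))
  det-flows = begin
    det K M
      ≈⟨ leibniz M ⟩
    ∑ (map (term M) (codes size))
      ≈⟨ sym (∑ₗ-filter legal? (term M) (codes size) term-illegal) ⟩
    ∑ (map (term M) legalCodes)
      ≈⟨ ∑ₗ-cong legalCodes (λ {c} c∈ → trans (term-legal c (legalCodes⁻ c∈))
           (sym (flowWeight-support c (legalCodes⁻ c∈)))) ⟩
    ∑ (map (flowWeight N ∘ support) legalCodes)
      ≡⟨ cong ∑ (List.map-∘ legalCodes) ⟩
    ∑ (map (flowWeight N) (map support legalCodes))
      ≈⟨ ∑ₗ-↭ (↭.map⁺ (flowWeight N) flows↭) ⟩
    ∑ (map (flowWeight N) (conservativeFlows N)) ∎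
    where open SetoidReasoning setoid

-- Solving the system in a vector space

module LinearSystem {c ℓ₁ ℓ₂ v ℓ} (K : OrderedField c ℓ₁ ℓ₂) (W : VectorSpace K v ℓ) where
  open OrderedField K
  open Module W
  open Determinant K
  open MonoidSum +ᴹ-commutativeMonoid public
    renaming (sum to sumᴹ; sum-cong-≋ to sumᴹ-cong; ∑-comm to sumᴹ-comm; ∑-distrib-+ to sumᴹ-distrib-+)
    using (sum-remove; sum-replicate-zero)
  open SetoidReasoning ≈ᴹ-setoid

  sumᴹ-*ₗ : ∀ {n} a (y : Fin n → Carrierᴹ) → a *ₗ sumᴹ y ≈ᴹ sumᴹ (λ i → a *ₗ y i)
  sumᴹ-*ₗ {zero}  a y = *ₗ-zeroʳ a
  sumᴹ-*ₗ {suc n} a y = ≈ᴹ-trans (*ₗ-distribˡ a _ _) (+ᴹ-congˡ (sumᴹ-*ₗ a (y ∘ suc)))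

  sum-*ₗ : ∀ {n} (a : Fin n → Carrier) y → sum a *ₗ y ≈ᴹ sumᴹ (λ i → a i *ₗ y)
  sum-*ₗ {zero}  a y = *ₗ-zeroˡ y
  sum-*ₗ {suc n} a y = ≈ᴹ-trans (*ₗ-distribʳ y _ _) (+ᴹ-congˡ (sum-*ₗ (a ∘ suc) y))

  infixr 7 _⋆_

  _⋆_ : ∀ {m n} → Matrix K m n → (Fin n → Carrierᴹ) → Fin m → Carrierᴹ
  (A ⋆ y) i = sumᴹ λ j → A i j *ₗ y j

  ⋆-cong : ∀ {m n} {A A′ : Matrix K m n} {y y′} → (∀ i j → A i j ≈ A′ i j) → (∀ j → y j ≈ᴹ y′ j) →
           ∀ i → (A ⋆ y) i ≈ᴹ (A′ ⋆ y′) i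
  ⋆-cong A≈ y≈ i = sumᴹ-cong λ j → *ₗ-cong (A≈ i j) (y≈ j)

  ⋆-assoc : ∀ {l m n} (A : Matrix K l m) (B : Matrix K m n) y i →
    (A ⋆ B ⋆ y) i ≈ᴹ ((λ i k → sum (λ j → A i j * B j k)) ⋆ y) i
  ⋆-assoc A B y i = begin
    sumᴹ (λ j → A i j *ₗ sumᴹ (λ k → B j k *ₗ y k))
      ≈⟨ sumᴹ-cong (λ j → ≈ᴹ-trans (sumᴹ-*ₗ (A i j) (λ k → B j k *ₗ y k))
           (sumᴹ-cong λ k → ≈ᴹ-sym (*ₗ-assoc (A i j) (B j k) (y k)))) ⟩
    sumᴹ (λ j → sumᴹ (λ k → (A i j * B j k) *ₗ y k))
      ≈⟨ sumᴹ-comm (λ j k → (A i j * B j k) *ₗ y k) ⟩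
    sumᴹ (λ k → sumᴹ (λ j → (A i j * B j k) *ₗ y k))
      ≈⟨ sumᴹ-cong (λ k → ≈ᴹ-sym (sum-*ₗ (λ j → A i j * B j k) (y k))) ⟩
    sumᴹ (λ k → sum (λ j → A i j * B j k) *ₗ y k) ∎

  ⋆-identity : ∀ {n} (y : Fin n → Carrierᴹ) i → (δ ⋆ y) i ≈ᴹ y i
  ⋆-identity {suc n} y i = begin
    sumᴹ (λ j → δ i j *ₗ y j)
      ≈⟨ sum-remove {i = i} (λ j → δ i j *ₗ y j) ⟩
    δ i i *ₗ y i +ᴹ sumᴹ (λ k → δ i (punchIn i k) *ₗ y (punchIn i k))
      ≈⟨ +ᴹ-cong (≈ᴹ-trans (*ₗ-congʳ (reflexive (δ-same i))) (*ₗ-identityˡ (y i)))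
           (sumᴹ-cong λ k → ≈ᴹ-trans (*ₗ-congʳ (reflexive (δ-distinct (Fin.punchInᵢ≢i i k ∘ ≡.sym)))) (*ₗ-zeroˡ _)) ⟩
    y i +ᴹ sumᴹ {n} (λ _ → 0ᴹ)
      ≈⟨ ≈ᴹ-trans (+ᴹ-congˡ (sum-replicate-zero n)) (+ᴹ-identityʳ (y i)) ⟩
    y i ∎

  -- The right inverse gives a solution. For uniqueness, the transpose `C` of a right inverse of the
  -- transposed matrix is a left inverse, so every solution equals `C ⋆ r`.
  solution : ∀ {n} (A : Matrix K n n) → ¬ det K A ≈ 0# → (r : Fin n → Carrierᴹ) →
    ∃ λ y → (∀ i → (A ⋆ y) i ≈ᴹ r i) × (∀ y′ → (∀ i → (A ⋆ y′) i ≈ᴹ r i) → ∀ i → y′ i ≈ᴹ y i)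
  solution A det≉0 r = B ⋆ r , solves , λ y′ solves′ i →
    ≈ᴹ-trans (determined y′ solves′ i) (≈ᴹ-sym (determined (B ⋆ r) solves i))
    where
    B = proj₁ (rightInverse A det≉0)
    right-inverse : ∀ {n} (A B : Matrix K n n) → (∀ i k → sum (λ j → A i j * B j k) ≈ δ i k) →
      ∀ y i → (A ⋆ B ⋆ y) i ≈ᴹ y i
    right-inverse A B AB≈δ y i = ≈ᴹ-trans (⋆-assoc A B y i)
      (≈ᴹ-trans (⋆-cong {A = λ i k → sum (λ j → A i j * B j k)} AB≈δ (λ _ → ≈ᴹ-refl) i) (⋆-identity y i))
    solves : ∀ i → (A ⋆ B ⋆ r) i ≈ᴹ r i
    solves = right-inverse A B (proj₂ (rightInverse A det≉0)) r
    Aᵀ⁻¹ = rightInverse (A ᵀ) (λ eq → det≉0 (trans (sym (det-ᵀ A)) eq))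
    C : Matrix K _ _
    C = proj₁ Aᵀ⁻¹ ᵀ
    δ-sym : ∀ {n} (i j : Fin n) → δ i j ≈ δ j i
    δ-sym i j with i Fin.≟ j
    ... | yes ≡.refl = reflexive (≡.sym (δ-same i))
    ... | no i≢j     = reflexive (≡.sym (δ-distinct (i≢j ∘ ≡.sym)))
    determined : ∀ y → (∀ i → (A ⋆ y) i ≈ᴹ r i) → ∀ i → y i ≈ᴹ (C ⋆ r) i
    determined y Ay≈r i = ≈ᴹ-sym (≈ᴹ-trans (≈ᴹ-sym (⋆-cong {A = C} (λ _ _ → refl) Ay≈r i))
      (right-inverse C A (λ i k → trans (SemiringSum.sum-cong-≋ semiring λ j → *-comm (C i j) (A j k))
        (trans (proj₂ Aᵀ⁻¹ k i) (δ-sym k i))) y i))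

-- Positivity of the determinant and the edge vectors

module Solution {c ℓ₁ ℓ₂ d} {K : OrderedField c ℓ₁ ℓ₂} (N : PlabicNetwork K d)
  (𝔤 : GaugeDirection (PlabicNetwork.graph N)) where
  open OrderedField K
  open PlabicNetwork N
  open GaugeDirection 𝔤
  open OrderProperties K
  open Determinant K using (δ)

  flowWeight-positive : ∀ C → 0# < flowWeight N C
  flowWeight-positive C = ∏-positive λ e → factor (e Subset.∈? C)
    where
    factor : ∀ {e} (d : Dec (e ∈ₛ C)) → 0# < (if does d then weight e else 1#)
    factor {e} (yes _) = weight-pos e
    factor     (no _)  = 0<1
    ∏-positive : ∀ {n} {h : Fin n → Carrier} → (∀ i → 0# < h i) → 0# < product h
    ∏-positive {zero}  pos = 0<1
    ∏-positive {suc n} pos = *-pos (pos zero) (∏-positive (pos ∘ suc))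

  trivial-flow : ConservativeFlow N Subset.⊥
  trivial-flow = (λ e e∈ → contradiction e∈ Subset.∉⊥) , λ v → ≡.trans (none (inEdges (internal v))) (≡.sym (none (outEdges (internal v))))
    where
    none : ∀ es → length (filter (Subset._∈? Subset.⊥) es) ≡ 0
    none es = cong length (List.filter-none (Subset._∈? Subset.⊥) {xs = es} (All.tabulate λ _ → Subset.∉⊥))

  ∑-flows-positive : 0# < ∑ (map (flowWeight N) (conservativeFlows N))
  ∑-flows-positive = positive (conservativeFlows N)
    (∈.∈-filter⁺ (conservativeFlow? N) (∈-allSubsets Subset.⊥) trivial-flow)
    where
    nonneg : ∀ Cs → 0# ≤ ∑ (map (flowWeight N) Cs)
    nonneg []       = inj₂ refl
    nonneg (C ∷ Cs) = +-nonneg (inj₁ (flowWeight-positive C)) (nonneg Cs)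
    positive : ∀ {C} Cs → C ∈ Cs → 0# < ∑ (map (flowWeight N) Cs)
    positive (C ∷ Cs) _ = +-positive-≤ (flowWeight-positive C) (nonneg Cs)

  det≉0 : ∀ (o : ProperOrdering N 𝔤) → ¬ det K (ProperOrdering.M o) ≈ 0#
  det≉0 o eq = 0<⇒≉0 ∑-flows-positive (trans (sym (Flows.det-flows N 𝔤 o)) eq)

  module _ {v ℓ} (W : VectorSpace K v ℓ) (B : Fin (length sinks) → Module.Carrierᴹ W) where
    open Module W
    open LinearSystem K W
    open ListSum +ᴹ-commutativeMonoid
    open Ordered N 𝔤 (System.properOrdering N 𝔤)
    open SetoidReasoning ≈ᴹ-setoid

    private
      sinks-injective : Injective _≡_ _≡_ (lookup sinks)
      sinks-injective = tabulate-injective (lookup sinks)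
        (subst Unique (≡.sym (List.tabulate-lookup sinks)) (Unique.filter⁺ sink? (Unique.allFin⁺ #b)))

      sinkIndex : ∀ {j} → Sink j → ∃ λ k → j ≡ lookup sinks k
      sinkIndex {j} sink = Any.index j∈ , Any.lookup-index j∈
        where
        j∈ : j ∈ sinks
        j∈ = ∈.∈-filter⁺ sink? (∈.∈-allFin j) sink

      sinkVector : ∀ {e} → EndsAtSink e → Carrierᴹ
      sinkVector {e} (j , sink , _) = ([-1]^ (+ int e) * weight e) *ₗ B (proj₁ (sinkIndex sink))

      SinkCondition : (Edge → Carrierᴹ) → Set _
      SinkCondition E = ∀ j e → tgt e ≡ boundary (lookup sinks j) → E e ≈ᴹ ([-1]^ (+ int e) * weight e) *ₗ B j

      at-sink : ∀ {E} → SinkCondition E → ∀ {e} (s : EndsAtSink e) → E e ≈ᴹ sinkVector s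
      at-sink cond {e} (j , sink , eq) = cond (proj₁ (sinkIndex sink)) e
        (≡.trans eq (cong boundary (proj₂ (sinkIndex sink))))

      extend : (Fin size → Carrierᴹ) → ∀ {e} → Dec (EndsAtSink e) → Carrierᴹ
      extend y (yes s)  = sinkVector s
      extend y (no unk) = y (proj₁ (index unk))

      assemble : (Fin size → Carrierᴹ) → Edge → Carrierᴹ
      assemble y e = extend y (endsAtSink? e)

      assemble-sinks : ∀ y → SinkCondition (assemble y)
      assemble-sinks y j e eq = at (endsAtSink? e)
        where
        at : (s : Dec (EndsAtSink e)) → extend y s ≈ᴹ ([-1]^ (+ int e) * weight e) *ₗ B j
        at (yes (j′ , sink , eq′)) = ≈ᴹ-reflexive (cong (λ k → ([-1]^ (+ int e) * weight e) *ₗ B k)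
          (sinks-injective (≡.trans (≡.sym (proj₂ (sinkIndex sink)))
            (boundary-injective (≡.trans (≡.sym eq′) eq)))))
          where
          boundary-injective : ∀ {i j : Fin #b} → _≡_ {A = Vertex} (boundary i) (boundary j) → i ≡ j
          boundary-injective ≡.refl = ≡.refl
        at (no unk) = contradiction (lookup sinks j , proj₂ (∈.∈-filter⁻ sink? {xs = allFin #b} (∈.∈-lookup j)) , eq) unk

      assemble-u : ∀ y i → assemble y (u i) ≈ᴹ y i
      assemble-u y i = at (endsAtSink? (u i))
        where
        at : (s : Dec (EndsAtSink (u i))) → extend y s ≈ᴹ y i
        at (yes s)  = contradiction s (u-unknown i)
        at (no unk) = ≈ᴹ-reflexive (cong y (u-injective (proj₂ (index unk))))

      sinkPart : Edge → ∀ {f} → Dec (EndsAtSink f) → Carrierᴹ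
      sinkPart e {f} (yes s) = transition e f *ₗ sinkVector s
      sinkPart e {f} (no _)  = 0ᴹ

      -- The inhomogeneous part: in each equation, the terms at edges ending at sinks, with the
      -- prescribed vectors inserted.
      rightSide : Fin size → Carrierᴹ
      rightSide i = sumᴹ λ f → sinkPart (u i) (endsAtSink? f)

      rhs-sum : ∀ (E : Edge → Carrierᴹ) (h : Edge → Carrier) fs →
        foldr (λ (a , f) y → a *ₗ E f +ᴹ y) 0ᴹ (map (λ f → h f , f) fs) ≡ ∑ₗ (map (λ f → h f *ₗ E f) fs)
      rhs-sum E h []       = ≡.refl
      rhs-sum E h (f ∷ fs) = cong (h f *ₗ E f +ᴹ_) (rhs-sum E h fs)

      T : Matrix K size size
      T i j = transition (u i) (u j)

      -- The edges leaving the target either are unknowns, enumerated by `u`, or end at sinks, where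
      -- `cond` prescribes the vector.
      rhs≈ : ∀ E → SinkCondition E → ∀ i →
        foldr (λ (a , f) y → a *ₗ E f +ᴹ y) 0ᴹ (map (λ f → coefficient N 𝔤 (u i) f , f) (outEdges (tgt (u i)))) ≈ᴹ
        (T ⋆ (E ∘ u)) i +ᴹ rightSide i
      rhs≈ E cond i = begin
        foldr (λ (a , f) y → a *ₗ E f +ᴹ y) 0ᴹ (map (λ f → coefficient N 𝔤 e f , f) (outEdges (tgt e)))
          ≡⟨ rhs-sum E (coefficient N 𝔤 e) (outEdges (tgt e)) ⟩
        ∑ₗ (map (λ f → coefficient N 𝔤 e f *ₗ E f) (outEdges (tgt e)))
          ≈⟨ ∑-outEdges +ᴹ-commutativeMonoid (λ f → coefficient N 𝔤 e f *ₗ E f) (tgt e) ⟩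
        sumᴹ (λ f → if does (src f ≟ᵥ tgt e) then coefficient N 𝔤 e f *ₗ E f else 0ᴹ)
          ≈⟨ sumᴹ-cong (λ f → ≈ᴹ-trans (if-*ₗ (does (src f ≟ᵥ tgt e)) (coefficient N 𝔤 e f) (E f))
               (split (endsAtSink? f))) ⟩
        sumᴹ (λ f → unknownPart (endsAtSink? f) +ᴹ sinkPart e (endsAtSink? f))
          ≈⟨ sumᴹ-distrib-+ (λ f → unknownPart (endsAtSink? f)) (λ f → sinkPart e (endsAtSink? f)) ⟩
        sumᴹ (λ f → unknownPart (endsAtSink? f)) +ᴹ rightSide i
          ≈⟨ +ᴹ-congʳ unknowns-sum ⟩
        (T ⋆ (E ∘ u)) i +ᴹ rightSide i ∎
        where
        e = u i
        unknownPart : ∀ {f} → Dec (EndsAtSink f) → Carrierᴹ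
        unknownPart     (yes _) = 0ᴹ
        unknownPart {f} (no _)  = transition e f *ₗ E f
        if-*ₗ : ∀ b a y → (if b then a *ₗ y else 0ᴹ) ≈ᴹ (if b then a else 0#) *ₗ y
        if-*ₗ true  a y = ≈ᴹ-refl
        if-*ₗ false a y = ≈ᴹ-sym (*ₗ-zeroˡ y)
        split : ∀ {f} (s : Dec (EndsAtSink f)) → transition e f *ₗ E f ≈ᴹ unknownPart s +ᴹ sinkPart e s
        split (yes s) = ≈ᴹ-trans (*ₗ-congˡ (at-sink cond s)) (≈ᴹ-sym (+ᴹ-identityˡ _))
        split (no _)  = ≈ᴹ-sym (+ᴹ-identityʳ _)
        known : ∀ {f} (s : Dec (EndsAtSink f)) → ¬ Unknown f → unknownPart s ≈ᴹ 0ᴹ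
        known (yes _)  _    = ≈ᴹ-refl
        known (no unk) ¬unk = contradiction unk ¬unk
        at-u : ∀ {f} (s : Dec (EndsAtSink f)) → Unknown f → unknownPart s ≈ᴹ transition e f *ₗ E f
        at-u (yes s) unk = contradiction s unk
        at-u (no _)  _   = ≈ᴹ-refl
        part : Edge → Carrierᴹ
        part f = unknownPart (endsAtSink? f)
        unknowns-sum : sumᴹ part ≈ᴹ (T ⋆ (E ∘ u)) i
        unknowns-sum = begin
          sumᴹ part
            ≡⟨ ∑ₗ-allFin {B = Edge} part ⟨
          ∑ₗ (map part (allFin #e))
            ≈⟨ ∑ₗ-filter (λ f → ¬? (endsAtSink? f)) part (allFin #e) (λ f → known (endsAtSink? f)) ⟨
          ∑ₗ (map part unknowns)
            ≈⟨ ∑ₗ-↭ (↭.map⁺ part unknowns↭) ⟨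
          ∑ₗ (map part (tabulate u))
            ≡⟨ ≡.trans (cong ∑ₗ (List.map-tabulate u part)) (∑ₗ-tabulate (part ∘ u)) ⟩
          sumᴹ (part ∘ u)
            ≈⟨ sumᴹ-cong (λ j → at-u (endsAtSink? (u j)) (u-unknown j)) ⟩
          (T ⋆ (E ∘ u)) i ∎

      -- The identity M = 1 - T in additive form. Cancelling `T ⋆ y` passes between an equation as
      -- given and its form with all unknowns on the left.
      M+T : ∀ y i → (M ⋆ y) i +ᴹ (T ⋆ y) i ≈ᴹ y i
      M+T y i = begin
        (M ⋆ y) i +ᴹ (T ⋆ y) i
          ≈⟨ sumᴹ-distrib-+ (λ j → M i j *ₗ y j) (λ j → T i j *ₗ y j) ⟨
        sumᴹ (λ j → M i j *ₗ y j +ᴹ T i j *ₗ y j)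
          ≈⟨ sumᴹ-cong (λ j → ≈ᴹ-sym (*ₗ-distribʳ (y j) (M i j) (T i j))) ⟩
        ((λ i j → M i j + T i j) ⋆ y) i
          ≈⟨ ⋆-cong {A = λ i j → M i j + T i j} M+T≈δ (λ _ → ≈ᴹ-refl) i ⟩
        (δ ⋆ y) i
          ≈⟨ ⋆-identity y i ⟩
        y i ∎
        where
        M+T≈δ : ∀ i j → M i j + T i j ≈ δ i j
        M+T≈δ i j = trans (+-congʳ (M≈ i j)) (trans (trans (+-assoc _ _ _)
          (trans (+-congˡ (-‿inverseˡ (T i j))) (+-identityʳ _))) (reflexive δ-u))
          where
          δ-u : δ (u i) (u j) ≡ δ i j
          δ-u = cong (λ b → if b then 1# else 0#) (does-⇔ (mk⇔ u-injective (cong u)) (u i Fin.≟ u j) (i Fin.≟ j))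

      EquationAt : (Edge → Carrierᴹ) → Fin size → Set ℓ
      EquationAt E i = Holds N 𝔤 W B E (equationAt (u i))

      holds⇒ : ∀ E → SinkCondition E → ∀ i → EquationAt E i → (M ⋆ (E ∘ u)) i ≈ᴹ rightSide i
      holds⇒ E cond i holds = ∙-cancelˡ ((T ⋆ (E ∘ u)) i) _ _ (≈ᴹ-trans (+ᴹ-comm _ _)
        (≈ᴹ-trans (M+T (E ∘ u) i) (≈ᴹ-trans holds (rhs≈ E cond i))))
        where open GroupProperties +ᴹ-group using (∙-cancelˡ)

      ⇒holds : ∀ E → SinkCondition E → ∀ i → (M ⋆ (E ∘ u)) i ≈ᴹ rightSide i → EquationAt E i
      ⇒holds E cond i eq = ≈ᴹ-trans (≈ᴹ-sym (M+T (E ∘ u) i)) (≈ᴹ-trans (+ᴹ-comm _ _)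
        (≈ᴹ-trans (+ᴹ-congˡ eq) (≈ᴹ-sym (rhs≈ E cond i))))

    edgeVectors : ∃ λ E → IsEdgeVectorSystem N 𝔤 W B E ×
      (∀ E′ → IsEdgeVectorSystem N 𝔤 W B E′ → ∀ e → E′ e ≈ᴹ E e)
    edgeVectors = assemble y , (assemble-sinks y , all-hold) , unique
      where
      solved = solution M (det≉0 (System.properOrdering N 𝔤)) rightSide
      y = proj₁ solved
      all-hold : All (Holds N 𝔤 W B (assemble y)) (system N 𝔤)
      all-hold = subst (All (Holds N 𝔤 W B (assemble y))) (≡.sym system≡) (All.map⁺ (All.tabulate λ {e} e∈ →
        let i , ui≡e = index (∈-unknowns⁻ (↭.∈-resp-↭ edgesToInternal↭ e∈)) in
        subst (λ e → Holds N 𝔤 W B (assemble y) (equationAt e)) ui≡e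
          (⇒holds (assemble y) (assemble-sinks y) i
            (≈ᴹ-trans (⋆-cong {A = M} (λ _ _ → refl) (assemble-u y) i) (proj₁ (proj₂ solved) i)))))
      unique : ∀ E′ → IsEdgeVectorSystem N 𝔤 W B E′ → ∀ e → E′ e ≈ᴹ assemble y e
      unique E′ (cond , holds) e = at (endsAtSink? e)
        where
        solves : ∀ i → (M ⋆ (E′ ∘ u)) i ≈ᴹ rightSide i
        solves i = holds⇒ E′ cond i (All.lookup holds (subst (equationAt (u i) ∈_) (≡.sym system≡)
          (∈.∈-map⁺ equationAt (↭.∈-resp-↭ (↭.↭-sym edgesToInternal↭) (∈-unknowns⁺ (u-unknown i))))))
        at : (s : Dec (EndsAtSink e)) → E′ e ≈ᴹ extend y s
        at (yes s)  = at-sink cond s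
        at (no unk) = let i , ui≡e = index unk in
          ≈ᴹ-trans (≈ᴹ-reflexive (cong E′ (≡.sym ui≡e))) (proj₂ (proj₂ solved) (E′ ∘ u) solves i)

theorem3p11 : ∀ {c ℓ₁ ℓ₂ d v ℓ : Level} (K : OrderedField c ℓ₁ ℓ₂)
    (N : PlabicNetwork K d) →
    let open OrderedField K
        open PlabicNetwork N in
    (𝔤 : GaugeDirection graph)
    (W : VectorSpace K v ℓ) →
    (B : Fin (length sinks) → Module.Carrierᴹ W) →
    LinearlyIndependent K W B →
    length (system N 𝔤) ≡ length unknowns ×
    ProperOrdering N 𝔤 ×
    (∀ (o : ProperOrdering N 𝔤) →
      FullRank K (ProperOrdering.M o) ×
      det K (ProperOrdering.M o) ≈ ∑ (map (flowWeight N) (conservativeFlows N))) ×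
    (∃ λ E → IsEdgeVectorSystem N 𝔤 W B E ×
      (∀ E′ → IsEdgeVectorSystem N 𝔤 W B E′ → ∀ e → Module._≈ᴹ_ W (E′ e) (E e)))
theorem3p11 K N 𝔤 W B _ =
  System.square N 𝔤 ,
  System.properOrdering N 𝔤 ,
  (λ o → Determinant.fullRank K (ProperOrdering.M o) (Solution.det≉0 N 𝔤 o) , Flows.det-flows N 𝔤 o) ,
  Solution.edgeVectors N 𝔤 W B
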